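{- The number of Sidon subsets of $[n]$ is at least $2^{(1.16+o(1))\sqrt n}$ and at most $2^{(55+o(1))\sqrt n}$, where $o(1)\to0$ as $n\to\infty$.
   Context: A set $S\subset[n]=\{1,\dots,n\}$ is a Sidon set if all sums of two elements of $S$ are distinct, i.e. there are no $w,x,y,z\in S$ with $w+x=y+z$ and $\{w,x\}\ne\{y,z\}$. -}

module Defs where

open import Data.Nat using (ℕ; zero; suc; _+_; _*_; _^_; _≤_)
open import Data.Nat.Properties using () renaming (_≟_ to _≟ℕ_)
open import Data.Fin using (Fin; toℕ; _≟_)
open import Data.Fin.Subset using (Subset; _∈_; inside; outside)
open import Data.Fin.Subset.Properties using (_∈?_)
open import Data.Fin.Properties using (all?)
open import Data.Vec using (_∷_; [])
open import Data.List using (List; []; _∷_; map; _++_; filter; length)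
open import Data.Product using (_×_)
open import Data.Sum using (_⊎_)
open import Relation.Nullary using (Dec)
open import Relation.Nullary.Decidable using (_×-dec_; _⊎-dec_; _→-dec_)
open import Relation.Binary.PropositionalEquality using (_≡_)

-- A subset S of Fin n represents the subset {suc (toℕ i) | i ∈ S} of [n] = {1,…,n}.
-- S is Sidon: no w,x,y,z ∈ S with w + x = y + z and {w,x} ≠ {y,z}.
IsSidon : ∀ {n} → Subset n → Set
IsSidon {n} S = ∀ (w x y z : Fin n) → w ∈ S → x ∈ S → y ∈ S → z ∈ S →
  suc (toℕ w) + suc (toℕ x) ≡ suc (toℕ y) + suc (toℕ z) →
  (w ≡ y × x ≡ z) ⊎ (w ≡ z × x ≡ y)

isSidon? : ∀ {n} (S : Subset n) → Dec (IsSidon S)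
isSidon? S = all? λ w → all? λ x → all? λ y → all? λ z →
  (w ∈? S) →-dec ((x ∈? S) →-dec ((y ∈? S) →-dec ((z ∈? S) →-dec
  ((suc (toℕ w) + suc (toℕ x) ≟ℕ suc (toℕ y) + suc (toℕ z)) →-dec
  (((w ≟ y) ×-dec (x ≟ z)) ⊎-dec ((w ≟ z) ×-dec (x ≟ y)))))))

allSubsets : ∀ n → List (Subset n)
allSubsets zero = [] ∷ []
allSubsets (suc n) = map (inside ∷_) (allSubsets n) ++ map (outside ∷_) (allSubsets n)

numSidon : ℕ → ℕ
numSidon n = length (filter isSidon? (allSubsets n))

-- For naturals a, b (b ≥ 1) and n, X:
-- Pow2Le a b n X  means  2^((a/b)·√n) ≤ X, i.e. (a/b)√n ≤ log₂ X, expressed as: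
-- for every rational k/m (m ≥ 1) with k/m ≤ (a/b)√n, 2^(k/m) ≤ X, i.e. 2^k ≤ X^m.
Pow2Le : ℕ → ℕ → ℕ → ℕ → Set
Pow2Le a b n X = ∀ (k m : ℕ) → 1 ≤ m → k * k * (b * b) ≤ a * a * (m * m) * n → 2 ^ k ≤ X ^ m

-- LePow2 a b n X  means  X ≤ 2^((a/b)·√n), i.e. log₂ X ≤ (a/b)√n, expressed as:
-- for every rational k/m (m ≥ 1) with k/m ≥ (a/b)√n, X ≤ 2^(k/m), i.e. X^m ≤ 2^k.
LePow2 : ℕ → ℕ → ℕ → ℕ → Set
LePow2 a b n X = ∀ (k m : ℕ) → 1 ≤ m → a * a * (m * m) * n ≤ k * k * (b * b) → X ^ m ≤ 2 ^ k

-- Lower bound.  Let S be a Sidon set modulo m with |S| ≈ √m and n ≈ 4m.  Choosing for each residue in S at most one of its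
-- four lifts to [n] always gives a Sidon set, so there are about 5^|S| of them, and ½ log₂ 5 > 1.16.  Ruzsa's set modulo
-- p (p − 1), which uses a primitive root modulo the prime p, serves as S.  The slack in the constant allows n/m to vary between
-- 3.942 and 4.071, so it suffices to have a prime in (62x/63, x] for all large x.  This is proved in the manner of Chebyshev:
-- with coefficients V_d ≈ μ(d)/d (d ≤ 1000) satisfying Σ V_d = 0, the sum F(x) = Σ d V_d log ⌊x/d⌋! equals
-- Σ Λ(n) Φ(x/n) with Φ(u) = Σ d V_d ⌊u/d⌋, and F(x) − F(62x/63) grows linearly in x.  The difference Φ(u) − Φ(62u/63)
-- is 1 for prime powers n in the window and elsewhere small enough that ψ(y) ≤ 2y log 2 + o(x) bounds its total contribution.
--
-- Upper bound.  Given a Sidon set T of size s, call x and y adjacent if x − y ∈ T − T; the elements that extend T to a larger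
-- Sidon set are pairwise non-adjacent.  By Cauchy–Schwarz every set of at least 3(2n + 1)/s elements contains a vertex adjacent
-- to a fixed proportion of it, so as in the Kleitman–Winston method a few choices confine the extension to O(n/s) elements.
-- Doubling s from √n / log n up to √n, and then allowing all subsets of the last container, gives 2^(O(√n)) sets in total.
module Submission where

open import Defs
open import Data.Nat
open import Data.Nat.Properties
open import Data.Nat.DivMod
open import Data.Nat.Divisibility
open import Data.Nat.Primality
open import Data.Nat.Primality.Factorisation using (PrimeFactorisation; factorise)
open import Data.Nat.Tactic.RingSolver using (solve-∀)
open import Data.List using (List; []; _∷_; length; _++_)
open import Data.Nat.ListAction using (product)
open import Data.List.Relation.Unary.All using (All; []; _∷_)
open import Data.Product using (_×_; _,_; proj₁; proj₂; ∃-syntax)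
open import Data.Sum using (_⊎_; inj₁; inj₂)
open import Data.Empty using (⊥; ⊥-elim)
open import Relation.Nullary
open import Relation.Binary.PropositionalEquality hiding ([_])
open import Function using (_∘_; id; const)

-- Only ½ log₂ 5 = 1.1609... is available against 1.16, so n has to stay close to four times the
-- modulus, and √(4.071/3.942) barely exceeds 63/62: this dictates the width of the prime window.
-- The weights come from the identities Σ μ(d) ⌊u/d⌋ = 1 (over d ≤ u, for u ≥ 1) and -Σ μ(d) (log
-- d)/d = 1. By the first, Φ is nearly constant until u exceeds the range of d; by the second, F(x)
-- grows like x. A window without primes is refuted once the noise, summed against ψ, stays below
-- x/63. That is a finite check, since d ⌊u/d⌋ differs from u by a remainder of period d and
-- arguments beyond 2^17 get a trivial bound. All of this happens in ℕ. Logarithms are integer parts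
-- at a scale K; taking K = x makes the rounding errors of order x log x, against main terms of
-- order x². Signed combinations are kept as two lists of naturals. In the upper bound the number of
-- high-degree choices at size s is about (n/s²) log n, a power of log n once s ≥ √n / log n; so
-- only the container sizes matter, and their contributions form a geometric series.

-- Finite sums, indicators and binary logarithms

module Sums where

  ∑ : ℕ → (ℕ → ℕ) → ℕ
  ∑ zero f = 0
  ∑ (suc n) f = ∑ n f + f n

  interchange : ∀ a b c d → (a + b) + (c + d) ≡ (a + c) + (b + d)
  interchange = solve-∀

  ∑-cong : ∀ n {f g : ℕ → ℕ} → (∀ i → i < n → f i ≡ g i) → ∑ n f ≡ ∑ n g
  ∑-cong zero h = refl
  ∑-cong (suc n) h = cong₂ _+_ (∑-cong n (λ i i<n → h i (m<n⇒m<1+n i<n))) (h n ≤-refl)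

  ∑-mono : ∀ n {f g : ℕ → ℕ} → (∀ i → i < n → f i ≤ g i) → ∑ n f ≤ ∑ n g
  ∑-mono zero h = z≤n
  ∑-mono (suc n) h = +-mono-≤ (∑-mono n (λ i i<n → h i (m<n⇒m<1+n i<n))) (h n ≤-refl)

  ∑-+ : ∀ n (f g : ℕ → ℕ) → ∑ n (λ i → f i + g i) ≡ ∑ n f + ∑ n g
  ∑-+ zero f g = refl
  ∑-+ (suc n) f g rewrite ∑-+ n f g = interchange (∑ n f) (∑ n g) (f n) (g n)

  ∑-*ˡ : ∀ n c (f : ℕ → ℕ) → ∑ n (λ i → c * f i) ≡ c * ∑ n f
  ∑-*ˡ zero c f = sym (*-zeroʳ c)
  ∑-*ˡ (suc n) c f rewrite ∑-*ˡ n c f = sym (*-distribˡ-+ c (∑ n f) (f n))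

  ∑-*ʳ : ∀ n c (f : ℕ → ℕ) → ∑ n (λ i → f i * c) ≡ ∑ n f * c
  ∑-*ʳ zero c f = refl
  ∑-*ʳ (suc n) c f rewrite ∑-*ʳ n c f = sym (*-distribʳ-+ c (∑ n f) (f n))

  ∑-const : ∀ n c → ∑ n (λ _ → c) ≡ n * c
  ∑-const zero c = refl
  ∑-const (suc n) c rewrite ∑-const n c = +-comm (n * c) c

  ∑-swap : ∀ m n (f : ℕ → ℕ → ℕ) → ∑ m (λ i → ∑ n (f i)) ≡ ∑ n (λ j → ∑ m (λ i → f i j))
  ∑-swap zero n f = sym (trans (∑-const n 0) (*-zeroʳ n))
  ∑-swap (suc m) n f rewrite ∑-swap m n f = sym (∑-+ n (λ j → ∑ m (λ i → f i j)) (f m))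

  ∑-split : ∀ m n (f : ℕ → ℕ) → ∑ (m + n) f ≡ ∑ m f + ∑ n (λ i → f (m + i))
  ∑-split m zero f rewrite +-identityʳ m = sym (+-identityʳ _)
  ∑-split m (suc n) f rewrite +-suc m n | ∑-split m n f = +-assoc (∑ m f) _ _

  ∑-shift : ∀ n (f : ℕ → ℕ) → ∑ (suc n) f ≡ f 0 + ∑ n (f ∘ suc)
  ∑-shift n f = ∑-split 1 n f

  ∑-≤const : ∀ n {f : ℕ → ℕ} c → (∀ i → i < n → f i ≤ c) → ∑ n f ≤ n * c
  ∑-≤const n c h = ≤-trans (∑-mono n h) (≤-reflexive (∑-const n c))

  ∑-extend : ∀ {m n} (f : ℕ → ℕ) → m ≤ n → ∑ m f ≤ ∑ n f
  ∑-extend {m} {n} f m≤n = begin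
    ∑ m f ≤⟨ m≤m+n _ _ ⟩
    ∑ m f + ∑ (n ∸ m) (λ i → f (m + i)) ≡⟨ ∑-split m (n ∸ m) f ⟨
    ∑ (m + (n ∸ m)) f ≡⟨ cong (λ t → ∑ t f) (m+[n∸m]≡n m≤n) ⟩
    ∑ n f ∎
    where open ≤-Reasoning

  ∑-blocks : ∀ d m (f : ℕ → ℕ) → ∑ (m * d) f ≡ ∑ m (λ j → ∑ d (λ i → f (j * d + i)))
  ∑-blocks d zero f = refl
  ∑-blocks d (suc m) f rewrite +-comm d (m * d) | ∑-split (m * d) d f | ∑-blocks d m f = refl

  ⟦_⟧ : ∀ {ℓ} {P : Set ℓ} → Dec P → ℕ
  ⟦ yes _ ⟧ = 1
  ⟦ no _ ⟧ = 0

  ⟦⟧-yes : ∀ {ℓ} {P : Set ℓ} (d : Dec P) → P → ⟦ d ⟧ ≡ 1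
  ⟦⟧-yes (yes _) p = refl
  ⟦⟧-yes (no ¬p) p = ⊥-elim (¬p p)

  ⟦⟧-no : ∀ {ℓ} {P : Set ℓ} (d : Dec P) → ¬ P → ⟦ d ⟧ ≡ 0
  ⟦⟧-no (yes p) ¬p = ⊥-elim (¬p p)
  ⟦⟧-no (no _) _ = refl

  ⟦⟧≤1 : ∀ {ℓ} {P : Set ℓ} (d : Dec P) → ⟦ d ⟧ ≤ 1
  ⟦⟧≤1 (yes _) = ≤-refl
  ⟦⟧≤1 (no _) = z≤n

  ⟦⟧-mono : ∀ {ℓ ℓ′} {P : Set ℓ} {Q : Set ℓ′} (d : Dec P) (e : Dec Q) → (P → Q) → ⟦ d ⟧ ≤ ⟦ e ⟧
  ⟦⟧-mono (yes p) e f = ≤-reflexive (sym (⟦⟧-yes e (f p)))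
  ⟦⟧-mono (no _) e f = z≤n

  ⟦⟧-cong : ∀ {ℓ ℓ′} {P : Set ℓ} {Q : Set ℓ′} (d : Dec P) (e : Dec Q) → (P → Q) → (Q → P) → ⟦ d ⟧ ≡ ⟦ e ⟧
  ⟦⟧-cong d e f g = ≤-antisym (⟦⟧-mono d e f) (⟦⟧-mono e d g)

  ∑-single : ∀ n j c (f : ℕ → ℕ) → j < n → (∀ i → i < n → f i ≡ ⟦ i ≟ j ⟧ * c) → ∑ n f ≡ c
  ∑-single n j c f j<n h = trans (∑-cong n h) (trans (∑-*ʳ n c _) (trans (cong (_* c) (one n j<n)) (*-identityˡ c)))
    where
    none : ∀ n → n ≤ j → ∑ n (λ i → ⟦ i ≟ j ⟧) ≡ 0
    none zero _ = refl
    none (suc n) n<j rewrite none n (<⇒≤ n<j) = ⟦⟧-no (n ≟ j) (<⇒≢ n<j)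
    one : ∀ n → j < n → ∑ n (λ i → ⟦ i ≟ j ⟧) ≡ 1
    one (suc n) j<1+n with n ≟ j
    ... | yes refl = cong (_+ 1) (none n ≤-refl)
    ... | no n≢j rewrite one n (≤∧≢⇒< (≤-pred j<1+n) (n≢j ∘ sym)) = refl

  -- ⌊log₂ n⌋, with lg 0 = 0.
  lg : ℕ → ℕ
  lg zero = 0
  lg (suc n) with 2 ^ suc (lg n) ≤? suc n
  ... | yes _ = suc (lg n)
  ... | no _ = lg n

  lg-spec : ∀ n → 2 ^ lg (suc n) ≤ suc n × suc n < 2 ^ suc (lg (suc n))
  lg-spec zero = ≤-refl , ≤-refl
  lg-spec (suc n) with 2 ^ suc (lg (suc n)) ≤? suc (suc n) | lg-spec n
  ... | yes p | _ , u = p , (begin-strict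
      suc (suc n) ≤⟨ u ⟩
      t ≡⟨ *-identityˡ t ⟨
      1 * t <⟨ *-monoˡ-< t {{>-nonZero (m^n>0 2 (suc (lg (suc n))))}} {1} {2} ≤-refl ⟩
      2 * t ∎)
    where open ≤-Reasoning
          t = 2 ^ suc (lg (suc n))
  ... | no ¬p | l , _ = m≤n⇒m≤1+n l , ≰⇒> ¬p

  -- Floors of logarithms come with a lower bound `2 ^ lg n ≤ n` and a strict upper bound off by one
  -- factor 2; a chain from one to the other has exactly this shape, so no unit is lost.
  2^-cancel-≤ : ∀ {m n} → 2 ^ m < 2 ^ suc n → m ≤ n
  2^-cancel-≤ {m} {n} h with m ≤? n
  ... | yes p = p
  ... | no ¬p = ⊥-elim (<⇒≱ h (^-monoʳ-≤ 2 (≰⇒> ¬p)))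

  lg-lower : ∀ n → .{{NonZero n}} → 2 ^ lg n ≤ n
  lg-lower (suc n) = proj₁ (lg-spec n)

  lg-upper : ∀ n → n < 2 ^ suc (lg n)
  lg-upper zero = s≤s z≤n
  lg-upper (suc n) = proj₂ (lg-spec n)

-- Sums over prime powers and an additive integer logarithm

module PrimePowerSums where

  open Sums

  ^-distrib-* : ∀ m n k → (m * n) ^ k ≡ m ^ k * n ^ k
  ^-distrib-* m n zero = refl
  ^-distrib-* m n (suc k) rewrite ^-distrib-* m n k = lem m n (m ^ k) (n ^ k)
    where lem : ∀ a b c d → a * b * (c * d) ≡ a * c * (b * d)
          lem = solve-∀

  prime-induction : ∀ {ℓ} (P : ℕ → Set ℓ) → P 1 → (∀ p k → Prime p → NonZero k → P k → P (p * k)) → ∀ n → .{{NonZero n}} → P n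
  prime-induction P base step n = subst P (sym isFactorisation) (go factors factorsPrime)
    where
    open PrimeFactorisation (factorise n)
    go : ∀ ps → All Prime ps → P (product ps)
    go [] [] = base
    go (p ∷ ps) (pr ∷ prs) = step p (product ps) pr (productOfPrimes≢0 prs) (go ps prs)

  /-unique : ∀ {y n} r q .{{_ : NonZero n}} → y ≡ r + q * n → r < n → y / n ≡ q
  /-unique {y} {n} r q refl r<n = begin
    (r + q * n) / n ≡⟨ +-distrib-/-∣ʳ r (n∣m*n q) ⟩
    r / n + q * n / n ≡⟨ cong₂ _+_ (m<n⇒m/n≡0 r<n) (m*n/n≡m q n) ⟩
    q ∎
    where open ≡-Reasoning

  -- Total division, so that sums over all d and n carry no side conditions. The default 0 agrees
  -- with counting the positive multiples of 0 up to k.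
  _÷_ : ℕ → ℕ → ℕ
  k ÷ zero = 0
  k ÷ suc n = k / suc n

  infixl 7 _÷_

  ÷≡/ : ∀ k n .{{_ : NonZero n}} → k ÷ n ≡ k / n
  ÷≡/ k (suc n) = refl

  ÷-suc : ∀ y n → y ÷ n + ⟦ n ∣? suc y ⟧ ≡ suc y ÷ n
  ÷-suc y zero = ⟦⟧-no (0 ∣? suc y) (λ h → case0 (0∣⇒≡0 h))
    where case0 : suc y ≡ 0 → ⊥
          case0 ()
  ÷-suc y n@(suc n-1) with suc (y % n) ≟ n
  ... | yes e = begin
      y / n + ⟦ n ∣? suc y ⟧ ≡⟨ cong (y / n +_) (⟦⟧-yes (n ∣? suc y) (divides (suc (y / n)) eq)) ⟩
      y / n + 1 ≡⟨ +-comm (y / n) 1 ⟩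
      suc (y / n) ≡⟨ /-unique 0 (suc (y / n)) eq z<s ⟨
      suc y / n ∎
    where
    open ≡-Reasoning
    eq : suc y ≡ 0 + suc (y / n) * n
    eq = trans (cong suc (m≡m%n+[m/n]*n y n)) (cong (_+ y / n * n) e)
  ... | no ne = begin
      y / n + ⟦ n ∣? suc y ⟧ ≡⟨ cong (y / n +_) (⟦⟧-no (n ∣? suc y) n∤) ⟩
      y / n + 0 ≡⟨ +-identityʳ _ ⟩
      y / n ≡⟨ /-unique (suc (y % n)) (y / n) eq r< ⟨
      suc y / n ∎
    where
    open ≡-Reasoning
    eq : suc y ≡ suc (y % n) + y / n * n
    eq = cong suc (m≡m%n+[m/n]*n y n)
    r< : suc (y % n) < n
    r< = ≤∧≢⇒< (m%n<n y n) ne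
    n∤ : ¬ n ∣ suc y
    n∤ h = <⇒≱ r< (∣⇒≤ (∣m+n∣m⇒∣n (subst (n ∣_) (trans eq (+-comm (suc (y % n)) _)) h) (n∣m*n (y / n))))

  ∑-divisible : ∀ y n → ∑ y (λ i → ⟦ n ∣? suc i ⟧) ≡ y ÷ n
  ∑-divisible zero zero = refl
  ∑-divisible zero (suc n) = refl
  ∑-divisible (suc y) n = trans (cong (_+ ⟦ n ∣? suc y ⟧) (∑-divisible y n)) (÷-suc y n)

  prime-power-∣ : ∀ {p q} → Prime p → Prime q → q ≢ p → ∀ j {k} → q ^ j ∣ p * k → q ^ j ∣ k
  prime-power-∣ pp pq q≢p zero h = 1∣ _
  prime-power-∣ {p} {q} pp pq q≢p (suc j) {k} h
    with prime-power-∣ pp pq q≢p j (m*n∣⇒n∣ q (q ^ j) h)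
  ... | divides m refl with euclidsLemma p m pq q∣pm
    where
    instance _ = m^n≢0 q j {{prime⇒nonZero pq}}
    q∣pm : q ∣ p * m
    q∣pm = *-cancelʳ-∣ (q ^ j) (subst (q * q ^ j ∣_) (sym (*-assoc p m (q ^ j))) h)
  ... | inj₂ q∣m = *-monoˡ-∣ (q ^ j) q∣m
  ... | inj₁ q∣p with prime⇒irreducible pp q∣p
  ... | inj₁ refl = ⊥-elim (¬prime[1] pq)
  ... | inj₂ q≡p = ⊥-elim (q≢p q≡p)

  prime≥2 : ∀ {p} → Prime p → 2 ≤ p
  prime≥2 pp = nonTrivial⇒n>1 _ {{prime⇒nonTrivial pp}}

  -- Λ-type sums over prime powers not exceeding X.  The real logarithm is replaced by
  -- lam n = ⌊K log₂ n⌋ for a large scale K; its completely additive companion is ell.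
  module PrimeSums (X K β : ℕ) (X<2^β : X < 2 ^ β) where

    lam : ℕ → ℕ
    lam n = lg (n ^ K)

    lam-lower : ∀ n .{{_ : NonZero n}} → 2 ^ lam n ≤ n ^ K
    lam-lower n = lg-lower (n ^ K) {{m^n≢0 n K}}

    lam-upper : ∀ n → n ^ K < 2 ^ suc (lam n)
    lam-upper n = lg-upper (n ^ K)

    lam-mono : ∀ {m n} .{{_ : NonZero m}} → m ≤ n → lam m ≤ lam n
    lam-mono {m} {n} m≤n = 2^-cancel-≤ (≤-<-trans (lam-lower m) (≤-<-trans (^-monoˡ-≤ K m≤n) (lam-upper n)))

    lam-*-lower : ∀ m n .{{_ : NonZero m}} .{{_ : NonZero n}} → lam m + lam n ≤ lam (m * n)
    lam-*-lower m n = 2^-cancel-≤ (begin-strict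
      2 ^ (lam m + lam n) ≡⟨ ^-distribˡ-+-* 2 (lam m) (lam n) ⟩
      2 ^ lam m * 2 ^ lam n ≤⟨ *-mono-≤ (lam-lower m) (lam-lower n) ⟩
      m ^ K * n ^ K ≡⟨ ^-distrib-* m n K ⟨
      (m * n) ^ K <⟨ lam-upper (m * n) ⟩
      2 ^ suc (lam (m * n)) ∎)
      where open ≤-Reasoning

    lam-*-upper : ∀ m n .{{_ : NonZero m}} .{{_ : NonZero n}} → lam (m * n) ≤ suc (lam m + lam n)
    lam-*-upper m n = 2^-cancel-≤ (begin-strict
      2 ^ lam (m * n) ≤⟨ lam-lower (m * n) {{m*n≢0 m n}} ⟩
      (m * n) ^ K ≡⟨ ^-distrib-* m n K ⟩
      m ^ K * n ^ K <⟨ *-mono-< (lam-upper m) (lam-upper n) ⟩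
      2 ^ suc (lam m) * 2 ^ suc (lam n) ≡⟨ ^-distribˡ-+-* 2 (suc (lam m)) (suc (lam n)) ⟨
      2 ^ (suc (lam m) + suc (lam n)) ≡⟨ cong (λ t → 2 ^ suc t) (+-suc (lam m) (lam n)) ⟩
      2 ^ suc (suc (lam m + lam n)) ∎)
      where open ≤-Reasoning

    lam-≤ : ∀ n .{{_ : NonZero n}} → n ≤ X → lam n ≤ β * K
    lam-≤ n n≤X = 2^-cancel-≤ (begin-strict
      2 ^ lam n ≤⟨ lam-lower n ⟩
      n ^ K ≤⟨ ^-monoˡ-≤ K (≤-trans n≤X (<⇒≤ X<2^β)) ⟩
      (2 ^ β) ^ K ≡⟨ ^-*-assoc 2 β K ⟩
      2 ^ (β * K) <⟨ ^-monoʳ-< 2 ≤-refl (n<1+n (β * K)) ⟩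
      2 ^ suc (β * K) ∎)
      where open ≤-Reasoning

    wt : ℕ → ℕ
    wt p = ⟦ prime? p ⟧ * lam p

    wt-prime : ∀ {p} → Prime p → wt p ≡ lam p
    wt-prime {p} pp rewrite ⟦⟧-yes (prime? p) pp = *-identityˡ _

    wt-* : ∀ p {a b} → (Prime p → a ≤ b) → wt p * a ≤ wt p * b
    wt-* p h with prime? p
    ... | yes pp = *-monoʳ-≤ (1 * lam p) (h pp)
    ... | no _ = z≤n

    wt-*-≡ : ∀ p {a b} → (Prime p → a ≡ b) → wt p * a ≡ wt p * b
    wt-*-≡ p h with prime? p
    ... | yes pp = cong (1 * lam p *_) (h pp)
    ... | no _ = refl

    -- The sum Σ Λ(n) g(n). Exponents up to β reach every prime power ≤ X because 2^β > X; the
    -- larger powers that also occur are harmless, as the functions summed below vanish beyond X.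
    S : (ℕ → ℕ) → ℕ
    S g = ∑ (suc X) λ p → wt p * ∑ β λ j → g (p ^ suc j)

    S-mono : ∀ g h → (∀ p j → Prime p → p ≤ X → g (p ^ suc j) ≤ h (p ^ suc j)) → S g ≤ S h
    S-mono g h le = ∑-mono (suc X) λ p p≤X → wt-* p λ pp → ∑-mono β λ j _ → le p j pp (≤-pred p≤X)

    S-cong : ∀ g h → (∀ n → g n ≡ h n) → S g ≡ S h
    S-cong g h eq = ∑-cong (suc X) λ p _ → cong (wt p *_) (∑-cong β λ j _ → eq (p ^ suc j))

    S-+ : ∀ g h → S (λ n → g n + h n) ≡ S g + S h
    S-+ g h = trans (∑-cong (suc X) λ p _ → trans (cong (wt p *_) (∑-+ β _ _)) (*-distribˡ-+ (wt p) _ _)) (∑-+ (suc X) _ _)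

    S-*ˡ : ∀ c g → S (λ n → c * g n) ≡ c * S g
    S-*ˡ c g = trans (∑-cong (suc X) λ p _ → trans (cong (wt p *_) (∑-*ˡ β c _)) (lem (wt p) c _)) (∑-*ˡ (suc X) c _)
      where lem : ∀ a b c → a * (b * c) ≡ b * (a * c)
            lem = solve-∀

    S-0 : S (λ _ → 0) ≡ 0
    S-0 = S-*ˡ 0 (λ _ → 0)

    S-∑ : ∀ m (g : ℕ → ℕ → ℕ) → ∑ m (λ i → S (g i)) ≡ S (λ n → ∑ m (λ i → g i n))
    S-∑ zero g = sym S-0
    S-∑ (suc m) g = trans (cong (_+ S (g m)) (S-∑ m g)) (sym (S-+ (λ n → ∑ m (λ i → g i n)) (g m)))

    -- The identity Σ Λ(n) = log k over n ∣ k, turned into a definition. It is additive without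
    -- error, whereas `lam` is monotone; the proofs switch between the two. `T y` then stands for
    -- log y!.
    ell : ℕ → ℕ
    ell k = S λ n → ⟦ n ∣? k ⟧

    T : ℕ → ℕ
    T y = ∑ y λ i → ell (suc i)

    T≡S : ∀ y → T y ≡ S (y ÷_)
    T≡S y = trans (S-∑ y (λ i n → ⟦ n ∣? suc i ⟧)) (S-cong (λ n → ∑ y (λ i → ⟦ n ∣? suc i ⟧)) (y ÷_) (∑-divisible y))

    private
      count : ℕ → ℕ → ℕ
      count q k = ∑ β λ j → ⟦ q ^ suc j ∣? k ⟧

      2^β∤ : ∀ {p k} .{{_ : NonZero k}} → Prime p → k ≤ X → ¬ p ^ β ∣ k
      2^β∤ {p} {k} pp k≤X h = <⇒≱ (≤-<-trans k≤X X<2^β) (≤-trans (^-monoˡ-≤ β (prime≥2 pp)) (∣⇒≤ h))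

      count-same : ∀ {p k} .{{_ : NonZero k}} → Prime p → k ≤ X → count p (p * k) ≡ suc (count p k)
      count-same {p} {k} pp k≤X = begin
        ∑ β (λ j → ⟦ p ^ suc j ∣? p * k ⟧)
          ≡⟨ ∑-cong β (λ j _ → ⟦⟧-cong (p ^ suc j ∣? p * k) (p ^ j ∣? k) (*-cancelˡ-∣ p) (*-monoʳ-∣ p)) ⟩
        ∑ β (λ j → ⟦ p ^ j ∣? k ⟧) ≡⟨ +-identityʳ _ ⟨
        -- The term j = β may be appended because p^β ≥ 2^β > k; splitting off j = 0 instead then
        -- yields the extra 1.
        ∑ β (λ j → ⟦ p ^ j ∣? k ⟧) + 0 ≡⟨ cong (∑ β (λ j → ⟦ p ^ j ∣? k ⟧) +_) (⟦⟧-no (p ^ β ∣? k) (2^β∤ pp k≤X)) ⟨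
        ∑ (suc β) (λ j → ⟦ p ^ j ∣? k ⟧) ≡⟨ ∑-shift β _ ⟩
        ⟦ 1 ∣? k ⟧ + count p k ≡⟨ cong (_+ count p k) (⟦⟧-yes (1 ∣? k) (1∣ k)) ⟩
        suc (count p k) ∎
        where open ≡-Reasoning
              instance _ = prime⇒nonZero pp

      count-other : ∀ {p q k} → Prime p → Prime q → q ≢ p → count q (p * k) ≡ count q k
      count-other {p} {q} {k} pp pq q≢p = ∑-cong β λ j _ →
        ⟦⟧-cong (q ^ suc j ∣? p * k) (q ^ suc j ∣? k) (prime-power-∣ pp pq q≢p (suc j)) (∣n⇒∣m*n p)

    ell-1 : ell 1 ≡ 0
    ell-1 = n≤0⇒n≡0 (≤-trans (S-mono (λ n → ⟦ n ∣? 1 ⟧) (λ _ → 0) λ p j pp _ →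
      ≤-reflexive (⟦⟧-no (p ^ suc j ∣? 1) λ h → not1 pp (∣1⇒≡1 (m*n∣⇒m∣ p (p ^ j) h)))) (≤-reflexive S-0))
      where not1 : ∀ {p} → Prime p → p ≢ 1
            not1 pp refl = ¬prime[1] pp

    ell-prime-* : ∀ p k .{{_ : NonZero k}} → Prime p → p * k ≤ X → ell (p * k) ≡ lam p + ell k
    ell-prime-* p k pp pk≤X = begin
      ∑ (suc X) (λ q → wt q * count q (p * k)) ≡⟨ ∑-cong (suc X) (λ q _ → step q) ⟩
      ∑ (suc X) (λ q → ⟦ q ≟ p ⟧ * lam p + wt q * count q k) ≡⟨ ∑-+ (suc X) _ _ ⟩
      ∑ (suc X) (λ q → ⟦ q ≟ p ⟧ * lam p) + ell k ≡⟨ cong (_+ ell k) (∑-single (suc X) p (lam p) _ (s≤s p≤X) (λ _ _ → refl)) ⟩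
      lam p + ell k ∎
      where
      open ≡-Reasoning
      instance _ = prime⇒nonZero pp
      p≤X : p ≤ X
      p≤X = ≤-trans (m≤m*n p k) pk≤X
      k≤X : k ≤ X
      k≤X = ≤-trans (m≤n*m k p) pk≤X
      step : ∀ q → wt q * count q (p * k) ≡ ⟦ q ≟ p ⟧ * lam p + wt q * count q k
      step q with q ≟ p
      ... | yes refl = trans (cong (wt q *_) (count-same pp k≤X))
                         (trans (*-suc (wt q) _) (cong (_+ wt q * count q k) (trans (wt-prime pp) (sym (*-identityˡ _)))))
      ... | no q≢p = wt-*-≡ q λ pq → count-other pp pq q≢p

    ell-* : ∀ m n .{{_ : NonZero m}} .{{_ : NonZero n}} → m * n ≤ X → ell (m * n) ≡ ell m + ell n
    ell-* m n = prime-induction (λ m → m * n ≤ X → ell (m * n) ≡ ell m + ell n) base step m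
      where
      base : 1 * n ≤ X → ell (1 * n) ≡ ell 1 + ell n
      base _ rewrite ell-1 = cong ell (*-identityˡ n)
      step : ∀ p k → Prime p → NonZero k → (k * n ≤ X → ell (k * n) ≡ ell k + ell n) →
             p * k * n ≤ X → ell (p * k * n) ≡ ell (p * k) + ell n
      step p k pp k≢0 ih h = begin
        ell (p * k * n) ≡⟨ cong ell (*-assoc p k n) ⟩
        ell (p * (k * n)) ≡⟨ ell-prime-* p (k * n) pp h′ ⟩
        lam p + ell (k * n) ≡⟨ cong (lam p +_) (ih (≤-trans (m≤n*m (k * n) p) h′)) ⟩
        lam p + (ell k + ell n) ≡⟨ +-assoc (lam p) (ell k) (ell n) ⟨
        lam p + ell k + ell n ≡⟨ cong (_+ ell n) (ell-prime-* p k pp (≤-trans (m≤m*n (p * k) n) h)) ⟨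
        ell (p * k) + ell n ∎
        where
        open ≡-Reasoning
        instance _ = k≢0
                 _ = prime⇒nonZero pp
                 _ = m*n≢0 k n
        h′ : p * (k * n) ≤ X
        h′ = subst (_≤ X) (*-assoc p k n) h

    ell≤lam : ∀ n .{{_ : NonZero n}} → n ≤ X → ell n ≤ lam n
    ell≤lam = prime-induction (λ n → n ≤ X → ell n ≤ lam n) (λ _ → subst (_≤ lam 1) (sym ell-1) z≤n) λ p k pp k≢0 ih h →
      let instance
            _ = k≢0
            _ = prime⇒nonZero pp
      in begin
        ell (p * k) ≡⟨ ell-prime-* p k pp h ⟩
        lam p + ell k ≤⟨ +-monoʳ-≤ (lam p) (ih (≤-trans (m≤n*m k p) h)) ⟩
        lam p + lam k ≤⟨ lam-*-lower p k ⟩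
        lam (p * k) ∎
      where open ≤-Reasoning

    -- Each prime factor split off costs at most one unit of rounding, and n has at most `lg n`
    -- prime factors.
    lam≤ell+lg : ∀ n .{{_ : NonZero n}} → n ≤ X → lam n ≤ ell n + lg n
    lam≤ell+lg = prime-induction (λ n → n ≤ X → lam n ≤ ell n + lg n)
      (λ _ → subst (λ t → lg t ≤ ell 1 + 0) (sym (^-zeroˡ K)) z≤n) λ p k pp k≢0 ih h →
      let instance
            _ = k≢0
            _ = prime⇒nonZero pp
      in begin
        lam (p * k) ≤⟨ lam-*-upper p k ⟩
        suc (lam p + lam k) ≤⟨ s≤s (+-monoʳ-≤ (lam p) (ih (≤-trans (m≤n*m k p) h))) ⟩
        suc (lam p + (ell k + lg k)) ≡⟨ lem (lam p) (ell k) (lg k) ⟩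
        lam p + ell k + suc (lg k) ≡⟨ cong (_+ suc (lg k)) (ell-prime-* p k pp h) ⟨
        ell (p * k) + suc (lg k) ≤⟨ +-monoʳ-≤ (ell (p * k)) (2^-cancel-≤ (≤-<-trans
            (≤-trans (*-mono-≤ (prime≥2 pp) (lg-lower k)) ≤-refl) (lg-upper (p * k)))) ⟩
        ell (p * k) + lg (p * k) ∎
      where
      open ≤-Reasoning
      lem : ∀ a b c → suc (a + (b + c)) ≡ a + b + suc c
      lem = solve-∀

    lam≤ell+β : ∀ n .{{_ : NonZero n}} → n ≤ X → lam n ≤ ell n + β
    lam≤ell+β n n≤X = ≤-trans (lam≤ell+lg n n≤X) (+-monoʳ-≤ (ell n) lg≤β)
      where
      lg≤β : lg n ≤ β
      lg≤β = ≤-pred (m<n⇒m<1+n (≰⇒> λ β≤lg → <⇒≱ (≤-<-trans n≤X X<2^β)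
               (≤-trans (^-monoʳ-≤ 2 β≤lg) (lg-lower n))))

-- Chebyshev's method: combinations of log ⌊x/d⌋!

module FactorialSums where

  open Sums
  open PrimePowerSums

  ≤-/ : ∀ m n o .{{_ : NonZero n}} → m * n ≤ o → m ≤ o / n
  ≤-/ m n o h = subst (_≤ o / n) (m*n/n≡m m n) (/-monoˡ-≤ n h)

  ÷-comm : ∀ k m n → k ÷ m ÷ n ≡ k ÷ n ÷ m
  ÷-comm k zero zero = refl
  ÷-comm k zero (suc n) = 0/n≡0 (suc n)
  ÷-comm k (suc m) zero = sym (0/n≡0 (suc m))
  ÷-comm k (suc m) (suc n) = begin
    k / suc m / suc n ≡⟨ m/n/o≡m/[n*o] k (suc m) (suc n) ⟩
    k / (suc m * suc n) ≡⟨ /-congʳ {m = k} (*-comm (suc m) (suc n)) ⟩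
    k / (suc n * suc m) ≡⟨ m/n/o≡m/[n*o] k (suc n) (suc m) ⟨
    k / suc n / suc m ∎
    where open ≡-Reasoning

  ∑-initial : ∀ n r → ∑ n (λ i → ⟦ i <? r ⟧) ≤ r
  ∑-initial n r with n ≤? r
  ... | yes n≤r = ≤-trans (∑-≤const n 1 (λ i _ → ⟦⟧≤1 (i <? r))) (≤-trans (≤-reflexive (*-identityʳ n)) n≤r)
  ... | no n≰r = begin
    ∑ n f ≡⟨ cong (λ t → ∑ t f) (m+[n∸m]≡n (<⇒≤ (≰⇒> n≰r))) ⟨
    ∑ (r + (n ∸ r)) f ≡⟨ ∑-split r (n ∸ r) f ⟩
    ∑ r f + ∑ (n ∸ r) (λ i → f (r + i))
      ≤⟨ +-mono-≤ (∑-≤const r 1 (λ i _ → ⟦⟧≤1 (i <? r)))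
                  (∑-≤const (n ∸ r) 0 (λ i _ → ≤-reflexive (⟦⟧-no (r + i <? r) (≤⇒≯ (m≤m+n r i))))) ⟩
    r * 1 + (n ∸ r) * 0 ≡⟨ cong₂ _+_ (*-identityʳ r) (*-zeroʳ (n ∸ r)) ⟩
    r + 0 ≡⟨ +-identityʳ r ⟩
    r ∎
    where open ≤-Reasoning
          f : ℕ → ℕ
          f i = ⟦ i <? r ⟧

  -- A list v₁ ∷ v₂ ∷ … of coefficients acts on functions by f ↦ Σ v_d f(d); dot f m starts at d = m + 1.
  dot : (ℕ → ℕ) → ℕ → List ℕ → ℕ
  dot f m [] = 0
  dot f m (v ∷ vs) = v * f (suc m) + dot f (suc m) vs

  dot-cong : ∀ {f g : ℕ → ℕ} m vs → (∀ d → f d ≡ g d) → dot f m vs ≡ dot g m vs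
  dot-cong m [] h = refl
  dot-cong m (v ∷ vs) h = cong₂ (λ a b → v * a + b) (h (suc m)) (dot-cong (suc m) vs h)

  dot-mono : ∀ {f g : ℕ → ℕ} m vs → (∀ d → .{{NonZero d}} → d ≤ m + length vs → f d ≤ g d) → dot f m vs ≤ dot g m vs
  dot-mono m [] h = z≤n
  dot-mono m (v ∷ vs) h rewrite +-suc m (length vs) =
    +-mono-≤ (*-monoʳ-≤ v (h (suc m) (s≤s (m≤m+n m (length vs))))) (dot-mono (suc m) vs h)

  dot-+ : ∀ (f g : ℕ → ℕ) m vs → dot (λ d → f d + g d) m vs ≡ dot f m vs + dot g m vs
  dot-+ f g m [] = refl
  dot-+ f g m (v ∷ vs) rewrite dot-+ f g (suc m) vs = lem v (f (suc m)) (g (suc m)) _ _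
    where lem : ∀ v a b c d → v * (a + b) + (c + d) ≡ v * a + c + (v * b + d)
          lem = solve-∀

  dot-* : ∀ c (f : ℕ → ℕ) m vs → dot (λ d → c * f d) m vs ≡ c * dot f m vs
  dot-* c f m [] = sym (*-zeroʳ c)
  dot-* c f m (v ∷ vs) rewrite dot-* c f (suc m) vs = lem v c (f (suc m)) _
    where lem : ∀ v c a b → v * (c * a) + c * b ≡ c * (v * a + b)
          lem = solve-∀

  total : List ℕ → ℕ
  total = dot (const 1) 0

  dot-const : ∀ c vs → dot (const c) 0 vs ≡ c * total vs
  dot-const c vs = trans (dot-cong 0 vs (λ _ → sym (*-identityʳ c))) (dot-* c (const 1) 0 vs)

  Φ : List ℕ → ℕ → ℕ
  Φ vs k = dot (λ d → d * (k ÷ d)) 0 vs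

  -- A step function given by its jumps (U , e).
  steps : List (ℕ × ℕ) → ℕ → ℕ
  steps [] k = 0
  steps ((U , e) ∷ us) k = e * ⟦ U ≤? k ⟧ + steps us k

  module Certificate (X K β : ℕ) (X<2^β : X < 2 ^ β) where
    open PrimeSums X K β X<2^β

    ell≤βK : ∀ n .{{_ : NonZero n}} → n ≤ X → ell n ≤ β * K
    ell≤βK n n≤X = ≤-trans (ell≤lam n n≤X) (lam-≤ n n≤X)

    private
      T-blocks : ∀ d m → T (m * d) ≡ ∑ m (λ j → ∑ d (λ i → ell (suc (j * d + i))))
      T-blocks d m = ∑-blocks d m (ell ∘ suc)

      block≤ : ∀ d j i → i < d → suc (j * d + i) ≤ d * suc j
      block≤ d j i i<d = subst (suc (j * d + i) ≤_) (trans (+-comm (j * d) d) (trans (cong (d +_) (*-comm j d)) (sym (*-suc d j))))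
        (subst (_≤ j * d + d) (+-suc (j * d) i) (+-monoʳ-≤ (j * d) i<d))

      T-tail : ∀ x d .{{_ : NonZero d}} → x ≤ X → T x ≤ T (x / d * d) + d * (β * K)
      T-tail x d x≤X = begin
        T x ≡⟨ cong T x≡ ⟩
        T (q * d + r) ≡⟨ ∑-split (q * d) r (ell ∘ suc) ⟩
        T (q * d) + ∑ r (λ i → ell (suc (q * d + i)))
          ≤⟨ +-monoʳ-≤ (T (q * d)) (∑-≤const r (β * K) (λ i i<r → ell≤βK (suc (q * d + i))
               (≤-trans (subst (_≤ q * d + r) (+-suc (q * d) i) (+-monoʳ-≤ (q * d) i<r)) (≤-trans (≤-reflexive (sym x≡)) x≤X)))) ⟩
        T (q * d) + r * (β * K) ≤⟨ +-monoʳ-≤ (T (q * d)) (*-monoˡ-≤ (β * K) (<⇒≤ (m%n<n x d))) ⟩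
        T (q * d) + d * (β * K) ∎
        where
        open ≤-Reasoning
        q = x / d
        r = x % d
        x≡ : x ≡ q * d + r
        x≡ = trans (m≡m%n+[m/n]*n x d) (+-comm r (q * d))

    -- The integers up to d ⌊x/d⌋ fall into blocks of length d. An entry of block j is at most d (j
    -- + 1), whose logarithm is `ell d + ell (suc j)`; passing through the monotone `lam` costs β
    -- per integer. Fewer than d integers remain, each with logarithm at most β K.
    T-upper : ∀ x d .{{_ : NonZero d}} → x ≤ X → d ≤ X → T x ≤ d * T (x / d) + x * ell d + (x * β + d * (β * K))
    T-upper x d x≤X d≤X = begin
      T x ≤⟨ T-tail x d x≤X ⟩
      T (q * d) + d * (β * K) ≡⟨ cong (_+ d * (β * K)) (T-blocks d q) ⟩
      ∑ q (λ j → ∑ d (λ i → ell (suc (j * d + i)))) + d * (β * K)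
        ≤⟨ +-monoˡ-≤ (d * (β * K)) (∑-mono q (λ j j<q → ∑-≤const d (ell d + ell (suc j) + β) (λ i i<d → bound j i j<q i<d))) ⟩
      ∑ q (λ j → d * (ell d + ell (suc j) + β)) + d * (β * K) ≡⟨ cong (_+ d * (β * K)) (∑-*ˡ q d _) ⟩
      d * ∑ q (λ j → ell d + ell (suc j) + β) + d * (β * K)
        ≡⟨ cong (λ t → d * t + d * (β * K)) (trans (∑-+ q _ _) (cong₂ _+_ (trans (∑-+ q _ _) (cong (_+ T q) (∑-const q (ell d)))) (∑-const q β))) ⟩
      d * (q * ell d + T q + q * β) + d * (β * K) ≡⟨ lem d q (ell d) (T q) β (d * (β * K)) ⟩
      d * T q + q * d * ell d + (q * d * β + d * (β * K))
        ≤⟨ +-mono-≤ (+-monoʳ-≤ (d * T q) (*-monoˡ-≤ (ell d) qd≤x)) (+-monoˡ-≤ (d * (β * K)) (*-monoˡ-≤ β qd≤x)) ⟩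
      d * T q + x * ell d + (x * β + d * (β * K)) ∎
      where
      open ≤-Reasoning
      q = x / d
      qd≤x : q * d ≤ x
      qd≤x = m/n*n≤m x d
      lem : ∀ d q e t b c → d * (q * e + t + q * b) + c ≡ d * t + q * d * e + (q * d * b + c)
      lem = solve-∀
      bound : ∀ j i → j < q → i < d → ell (suc (j * d + i)) ≤ ell d + ell (suc j) + β
      bound j i j<q i<d = begin
        ell (suc (j * d + i)) ≤⟨ ell≤lam (suc (j * d + i)) (≤-trans (block≤ d j i i<d) dj≤X) ⟩
        lam (suc (j * d + i)) ≤⟨ lam-mono (block≤ d j i i<d) ⟩
        lam (d * suc j) ≤⟨ lam≤ell+β (d * suc j) {{m*n≢0 d (suc j)}} dj≤X ⟩
        ell (d * suc j) + β ≡⟨ cong (_+ β) (ell-* d (suc j) dj≤X) ⟩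
        ell d + ell (suc j) + β ∎
        where
        dj≤X : d * suc j ≤ X
        dj≤X = ≤-trans (≤-trans (*-monoʳ-≤ d j<q) (≤-trans (≤-reflexive (*-comm d q)) qd≤x)) x≤X

    -- The mirror image of `T-upper`: every entry of block m exceeds d m, so the blocks are compared
    -- with the preceding multiple of d.
    T-lower : ∀ x d .{{_ : NonZero d}} → x ≤ X → d ≤ X → d * T (x / d) + x * ell d ≤ T x + (x * β + 3 * (d * (β * K)))
    T-lower x d x≤X d≤X = begin
      d * T q + x * ell d ≡⟨ cong (λ t → d * T q + t * ell d) (m≡m%n+[m/n]*n x d) ⟩
      d * T q + (x % d + q * d) * ell d ≡⟨ lem₁ d (T q) (x % d) q (ell d) ⟩
      d * T q + d * (q * ell d) + x % d * ell d
        ≤⟨ +-mono-≤ (go q qd≤X) (*-mono-≤ (<⇒≤ (m%n<n x d)) (ell≤βK d d≤X)) ⟩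
      T (q * d) + d * (q * β) + d * (end q + ell d) + d * (β * K)
        ≤⟨ +-monoˡ-≤ (d * (β * K)) (+-mono-≤ (+-mono-≤ (∑-extend (ell ∘ suc) qd≤x) (≤-trans (≤-reflexive (lem₂ d q β)) (*-monoˡ-≤ β qd≤x)))
             (*-monoʳ-≤ d (+-mono-≤ (end≤ q (≤-trans (m≤m*n q d) qd≤X)) (ell≤βK d d≤X)))) ⟩
      T x + x * β + d * (β * K + β * K) + d * (β * K) ≡⟨ lem₃ (T x) (x * β) d (β * K) ⟩
      T x + (x * β + 3 * (d * (β * K))) ∎
      where
      open ≤-Reasoning
      q = x / d
      qd≤x : q * d ≤ x
      qd≤x = m/n*n≤m x d
      qd≤X : q * d ≤ X
      qd≤X = ≤-trans qd≤x x≤X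
      lem₁ : ∀ d t r q e → d * t + (r + q * d) * e ≡ d * t + d * (q * e) + r * e
      lem₁ = solve-∀
      lem₂ : ∀ d q b → d * (q * b) ≡ q * d * b
      lem₂ = solve-∀
      lem₃ : ∀ t y d c → t + y + d * (c + c) + d * c ≡ t + (y + 3 * (d * c))
      lem₃ = solve-∀
      -- Block 0 would be compared with log 0. Setting the value there to 0 keeps the induction
      -- uniform, and the missing `ell d` is charged once, through the indicator of m = 0.
      end : ℕ → ℕ
      end zero = 0
      end m@(suc _) = ell m
      end≤ : ∀ m → m ≤ X → end m ≤ β * K
      end≤ zero _ = z≤n
      end≤ (suc m) h = ell≤βK (suc m) h
      block : ∀ m i → suc m * d ≤ X → i < d → ell d + end m ≤ (ell d * ⟦ m ≟ 0 ⟧) + (ell (suc (m * d + i)) + β)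
      block zero i _ _ = ≤-trans (≤-reflexive (trans (+-identityʳ (ell d)) (sym (*-identityʳ (ell d))))) (m≤m+n _ _)
      block m@(suc _) i h i<d rewrite *-zeroʳ (ell d) = begin
        ell d + ell m ≡⟨ ell-* d m (≤-trans (≤-reflexive (*-comm d m)) (≤-trans (m≤n+m (m * d) d) h)) ⟨
        ell (d * m) ≤⟨ ell≤lam (d * m) {{m*n≢0 d m}} (≤-trans (≤-reflexive (*-comm d m)) (≤-trans (m≤n+m (m * d) d) h)) ⟩
        lam (d * m) ≤⟨ lam-mono {{m*n≢0 d m}} (≤-trans (≤-reflexive (*-comm d m)) (m≤n⇒m≤1+n (m≤m+n (m * d) i))) ⟩
        lam (suc (m * d + i)) ≤⟨ lam≤ell+β (suc (m * d + i)) (≤-trans (block≤ d m i i<d) (≤-trans (≤-reflexive (*-comm d (suc m))) h)) ⟩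
        ell (suc (m * d + i)) + β ∎
      step : ∀ m → suc m * d ≤ X → d * (ell d + end m) ≤ d * (ell d * ⟦ m ≟ 0 ⟧) + (∑ d (λ i → ell (suc (m * d + i))) + d * β)
      step m h = begin
        d * (ell d + end m) ≡⟨ ∑-const d _ ⟨
        ∑ d (λ _ → ell d + end m) ≤⟨ ∑-mono d (λ i i<d → block m i h i<d) ⟩
        ∑ d (λ i → (ell d * ⟦ m ≟ 0 ⟧) + (ell (suc (m * d + i)) + β)) ≡⟨ trans (∑-+ d _ _) (cong₂ _+_ (∑-const d _) (trans (∑-+ d _ _) (cong (∑ d (λ i → ell (suc (m * d + i))) +_) (∑-const d β)))) ⟩
        d * (ell d * ⟦ m ≟ 0 ⟧) + (∑ d (λ i → ell (suc (m * d + i))) + d * β) ∎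
      -- The inductive bound compares the block of d consecutive terms after m d with d (ell d + ell m), so it lags by one term.
      go′ : ∀ m → m * d ≤ X → d * T m + d * (m * ell d) ≤ ∑ m (λ j → ∑ d (λ i → ell (suc (j * d + i)))) + d * (m * β) + d * (end m + ell d * ⟦ 1 ≤? m ⟧)
      go′ zero _ rewrite *-zeroʳ d = z≤n
      go′ (suc m) h = begin
        d * (T m + ell (suc m)) + d * (ell d + m * ell d) ≡⟨ lem₄ d (T m) (ell (suc m)) (ell d) m ⟩
        d * T m + d * (m * ell d) + d * (ell (suc m) + ell d) ≤⟨ +-monoˡ-≤ _ (go′ m (≤-trans (m≤n+m (m * d) d) h)) ⟩
        Bm + d * (m * β) + d * (end m + ell d * ⟦ 1 ≤? m ⟧) + d * (ell (suc m) + ell d)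
          ≡⟨ lem₅ Bm (d * (m * β)) d (end m) (ell d * ⟦ 1 ≤? m ⟧) (ell (suc m)) (ell d) ⟩
        d * (ell d + end m) + (Bm + d * (m * β) + d * (ell (suc m) + ell d * ⟦ 1 ≤? m ⟧)) ≤⟨ +-monoˡ-≤ _ (step m h) ⟩
        d * (ell d * ⟦ m ≟ 0 ⟧) + (b + d * β) + (Bm + d * (m * β) + d * (ell (suc m) + ell d * ⟦ 1 ≤? m ⟧))
          ≡⟨ lem₆ d (ell d) ⟦ m ≟ 0 ⟧ b β Bm m (ell (suc m)) ⟦ 1 ≤? m ⟧ ⟩
        (Bm + b) + d * (suc m * β) + d * (ell (suc m) + ell d * (⟦ m ≟ 0 ⟧ + ⟦ 1 ≤? m ⟧))
          ≡⟨ cong (λ t → (Bm + b) + d * (suc m * β) + d * (ell (suc m) + ell d * t)) (ind m) ⟩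
        (Bm + b) + d * (suc m * β) + d * (ell (suc m) + ell d * ⟦ 1 ≤? suc m ⟧) ∎
        where
        Bm = ∑ m (λ j → ∑ d (λ i → ell (suc (j * d + i))))
        b = ∑ d (λ i → ell (suc (m * d + i)))
        ind : ∀ m → ⟦ m ≟ 0 ⟧ + ⟦ 1 ≤? m ⟧ ≡ ⟦ 1 ≤? suc m ⟧
        ind zero = refl
        ind (suc m) = refl
        lem₄ : ∀ d t e l m → d * (t + e) + d * (l + m * l) ≡ d * t + d * (m * l) + d * (e + l)
        lem₄ = solve-∀
        lem₅ : ∀ B c d e f g h → B + c + d * (e + f) + d * (g + h) ≡ d * (h + e) + (B + c + d * (g + f))
        lem₅ = solve-∀
        lem₆ : ∀ d l z b β B m e o → d * (l * z) + (b + d * β) + (B + d * (m * β) + d * (e + l * o)) ≡ (B + b) + d * (β + m * β) + d * (e + l * (z + o))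
        lem₆ = solve-∀
      go : ∀ m → m * d ≤ X → d * T m + d * (m * ell d) ≤ T (m * d) + d * (m * β) + d * (end m + ell d)
      go m h = ≤-trans (go′ m h) (+-mono-≤ (≤-reflexive (cong (_+ d * (m * β)) (sym (T-blocks d m))))
        (*-monoʳ-≤ d (+-monoʳ-≤ (end m) (≤-trans (*-monoʳ-≤ (ell d) (⟦⟧≤1 (1 ≤? m))) (≤-reflexive (*-identityʳ (ell d)))))))
    psi : ℕ → ℕ
    psi y = S λ n → ⟦ n ≤? y ⟧

    private
      ell-2≤K : 2 ≤ X → ell 2 ≤ K
      ell-2≤K h = ≤-trans (ell≤lam 2 h) (2^-cancel-≤ (≤-<-trans (lam-lower 2) (^-monoʳ-< 2 ≤-refl (n<1+n K))))

      -- Chebyshev's observation that ⌊y/n⌋ - 2 ⌊y/(2n)⌋ is never negative and is at least 1 for y/2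
      -- < n ≤ y. Summed over Λ it bounds ψ(y) - ψ(y/2) by log y! - 2 log ⌊y/2⌋!, about y log 2.
      halving : ∀ y n .{{_ : NonZero n}} → ⟦ n ≤? y ⟧ + 2 * (y / 2 ÷ n) ≤ ⟦ n ≤? y / 2 ⟧ + y ÷ n
      halving y n@(suc _) with n ≤? y / 2
      ... | yes n≤z = +-mono-≤ (⟦⟧≤1 (n ≤? y)) (≤-/ (2 * (y / 2 / n)) n y (begin
              2 * (y / 2 / n) * n ≡⟨ *-assoc 2 (y / 2 / n) n ⟩
              2 * (y / 2 / n * n) ≤⟨ *-monoʳ-≤ 2 (m/n*n≤m (y / 2) n) ⟩
              2 * (y / 2) ≡⟨ *-comm 2 (y / 2) ⟩
              y / 2 * 2 ≤⟨ m/n*n≤m y 2 ⟩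
              y ∎))
        where open ≤-Reasoning
      ... | no n≰z rewrite m<n⇒m/n≡0 (≰⇒> n≰z) with n ≤? y
      ... | yes n≤y = m≥n⇒m/n>0 n≤y
      ... | no _ = z≤n

      psi-step : ∀ y → 2 ≤ X → y ≤ X → psi y ≤ psi (y / 2) + (y * (K + β) + 2 * (β * K))
      psi-step y 2≤X y≤X = +-cancelʳ-≤ (2 * T z) _ _ (begin
        psi y + 2 * T z ≡⟨ cong (λ t → psi y + 2 * t) (T≡S z) ⟩
        psi y + 2 * S (z ÷_) ≡⟨ cong (psi y +_) (S-*ˡ 2 (z ÷_)) ⟨
        psi y + S (λ n → 2 * (z ÷ n)) ≡⟨ S-+ (λ n → ⟦ n ≤? y ⟧) (λ n → 2 * (z ÷ n)) ⟨
        S (λ n → ⟦ n ≤? y ⟧ + 2 * (z ÷ n))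
          ≤⟨ S-mono (λ n → ⟦ n ≤? y ⟧ + 2 * (z ÷ n)) (λ n → ⟦ n ≤? z ⟧ + y ÷ n) (λ p j pp _ → halving y (p ^ suc j) {{m^n≢0 p (suc j) {{prime⇒nonZero pp}}}}) ⟩
        S (λ n → ⟦ n ≤? z ⟧ + y ÷ n) ≡⟨ S-+ (λ n → ⟦ n ≤? z ⟧) (y ÷_) ⟩
        psi z + S (y ÷_) ≡⟨ cong (psi z +_) (T≡S y) ⟨
        psi z + T y ≤⟨ +-monoʳ-≤ (psi z) (T-upper y 2 y≤X 2≤X) ⟩
        psi z + (2 * T z + y * ell 2 + (y * β + 2 * (β * K)))
          ≤⟨ +-monoʳ-≤ (psi z) (+-monoˡ-≤ (y * β + 2 * (β * K)) (+-monoʳ-≤ (2 * T z) (*-monoʳ-≤ y (ell-2≤K 2≤X)))) ⟩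
        psi z + (2 * T z + y * K + (y * β + 2 * (β * K))) ≡⟨ lem (psi z) (T z) y K β ⟩
        psi z + (y * (K + β) + 2 * (β * K)) + 2 * T z ∎)
        where
        open ≤-Reasoning
        z = y / 2
        lem : ∀ a t y k b → a + (2 * t + y * k + (y * b + 2 * (b * k))) ≡ a + (y * (k + b) + 2 * (b * k)) + 2 * t
        lem = solve-∀

    -- Repeated halving: y + y/2 + y/4 + ... ≤ 2y, with at most β rounds, each paying the same
    -- rounding error.
    psi-upper : ∀ y → 2 ≤ X → y ≤ X → psi y ≤ 2 * y * (K + β) + β * (2 * (β * K))
    psi-upper y 2≤X y≤X = go β y (≤-<-trans y≤X X<2^β) y≤X
      where
      open ≤-Reasoning
      go : ∀ i y → y < 2 ^ i → y ≤ X → psi y ≤ 2 * y * (K + β) + i * (2 * (β * K))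
      go zero zero _ _ = ≤-trans (S-mono (λ n → ⟦ n ≤? 0 ⟧) (λ _ → 0) (λ p j pp _ →
        ≤-reflexive (⟦⟧-no (p ^ suc j ≤? 0) (<⇒≱ (m^n>0 p {{prime⇒nonZero pp}} (suc j)))))) (≤-reflexive S-0)
      go zero (suc y) (s≤s ()) _
      go (suc i) y y< y≤X = begin
        psi y ≤⟨ psi-step y 2≤X y≤X ⟩
        psi (y / 2) + (y * (K + β) + 2 * (β * K))
          ≤⟨ +-monoˡ-≤ _ (go i (y / 2) (m<n*o⇒m/o<n (subst (y <_) (*-comm 2 (2 ^ i)) y<)) (≤-trans (m/n≤m y 2) y≤X)) ⟩
        2 * (y / 2) * (K + β) + i * (2 * (β * K)) + (y * (K + β) + 2 * (β * K))
          ≤⟨ +-monoˡ-≤ _ (+-monoˡ-≤ (i * (2 * (β * K))) (*-monoˡ-≤ (K + β) (≤-trans (≤-reflexive (*-comm 2 (y / 2))) (m/n*n≤m y 2)))) ⟩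
        y * (K + β) + i * (2 * (β * K)) + (y * (K + β) + 2 * (β * K)) ≡⟨ lem y (K + β) i (2 * (β * K)) ⟩
        2 * y * (K + β) + suc i * (2 * (β * K)) ∎
        where
        lem : ∀ y k i c → y * k + i * c + (y * k + c) ≡ 2 * y * k + (c + i * c)
        lem = solve-∀

    G : List ℕ → ℕ → ℕ
    G vs x = dot (λ d → d * T (x ÷ d)) 0 vs

    L : List ℕ → ℕ
    L vs = dot ell 0 vs

    dot-S : ∀ (g : ℕ → ℕ → ℕ) m vs → dot (λ d → S (g d)) m vs ≡ S (λ n → dot (λ d → g d n) m vs)
    dot-S g m [] = sym S-0
    dot-S g m (v ∷ vs) = begin
      v * S (g (suc m)) + dot (λ d → S (g d)) (suc m) vs ≡⟨ cong₂ _+_ (sym (S-*ˡ v (g (suc m)))) (dot-S g (suc m) vs) ⟩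
      S (λ n → v * g (suc m) n) + S (λ n → dot (λ d → g d n) (suc m) vs) ≡⟨ S-+ (λ n → v * g (suc m) n) (λ n → dot (λ d → g d n) (suc m) vs) ⟨
      S (λ n → v * g (suc m) n + dot (λ d → g d n) (suc m) vs) ∎
      where open ≡-Reasoning

    -- Legendre's formula for each factorial; since ⌊⌊x/d⌋/n⌋ = ⌊⌊x/n⌋/d⌋, the dependence on n is
    -- only through ⌊x/n⌋.
    G≡SΦ : ∀ vs x → G vs x ≡ S (λ n → Φ vs (x ÷ n))
    G≡SΦ vs x = begin
      dot (λ d → d * T (x ÷ d)) 0 vs ≡⟨ dot-cong 0 vs (λ d → trans (cong (d *_) (T≡S (x ÷ d))) (sym (S-*ˡ d (x ÷ d ÷_)))) ⟩
      dot (λ d → S (λ n → d * (x ÷ d ÷ n))) 0 vs ≡⟨ dot-S (λ d n → d * (x ÷ d ÷ n)) 0 vs ⟩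
      S (λ n → dot (λ d → d * (x ÷ d ÷ n)) 0 vs)
        ≡⟨ S-cong _ _ (λ n → dot-cong 0 vs (λ d → cong (d *_) (÷-comm x d n))) ⟩
      S (λ n → Φ vs (x ÷ n)) ∎
      where open ≡-Reasoning

    err : ℕ → ℕ → ℕ
    err D x = x * β + 3 * (D * (β * K))

    -- With `T x` ≈ d `T (x / d)` + x log d for every d, the only term growing faster than x is
    -- `total vs * T x`. It cancels between two lists of equal total, which is where Σ V_d = 0
    -- enters.
    G-lower : ∀ vs x → x ≤ X → length vs ≤ X → G vs x + x * L vs ≤ total vs * (T x + err (length vs) x)
    G-lower vs x x≤X D≤X = begin
      G vs x + x * L vs ≡⟨ cong (G vs x +_) (dot-* x ell 0 vs) ⟨
      G vs x + dot (λ d → x * ell d) 0 vs ≡⟨ dot-+ _ _ 0 vs ⟨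
      dot (λ d → d * T (x ÷ d) + x * ell d) 0 vs
        ≤⟨ dot-mono 0 vs (λ d d≤D → ≤-trans (≤-reflexive (cong (λ t → d * T t + x * ell d) (÷≡/ x d)))
             (≤-trans (T-lower x d x≤X (≤-trans d≤D D≤X)) (+-monoʳ-≤ (T x) (+-monoʳ-≤ (x * β) (*-monoʳ-≤ 3 (*-monoˡ-≤ (β * K) d≤D)))))) ⟩
      dot (const (T x + err (length vs) x)) 0 vs ≡⟨ dot-const _ vs ⟩
      (T x + err (length vs) x) * total vs ≡⟨ *-comm _ (total vs) ⟩
      total vs * (T x + err (length vs) x) ∎
      where open ≤-Reasoning

    G-upper : ∀ vs x → x ≤ X → length vs ≤ X → total vs * T x ≤ G vs x + x * L vs + total vs * err (length vs) x
    G-upper vs x x≤X D≤X = begin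
      total vs * T x ≡⟨ *-comm (total vs) (T x) ⟩
      T x * total vs ≡⟨ dot-const (T x) vs ⟨
      dot (const (T x)) 0 vs
        ≤⟨ dot-mono 0 vs (λ d d≤D → ≤-trans (T-upper x d x≤X (≤-trans d≤D D≤X))
             (+-mono-≤ (≤-reflexive (cong (λ t → d * T t + x * ell d) (sym (÷≡/ x d))))
                       (+-monoʳ-≤ (x * β) (≤-trans (*-monoˡ-≤ (β * K) d≤D) (m≤n*m _ 3))))) ⟩
      dot (λ d → d * T (x ÷ d) + x * ell d + err (length vs) x) 0 vs
        ≡⟨ trans (dot-+ _ _ 0 vs) (cong₂ _+_ (trans (dot-+ _ _ 0 vs) (cong (G vs x +_) (dot-* x ell 0 vs)))
             (trans (dot-const (err (length vs) x) vs) (*-comm _ (total vs)))) ⟩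
      G vs x + x * L vs + total vs * err (length vs) x ∎
      where open ≤-Reasoning

    stepsψ : List (ℕ × ℕ) → ℕ → ℕ
    stepsψ [] x = 0
    stepsψ ((U , e) ∷ us) x = e * psi (x ÷ U) + stepsψ us x

    -- U ≤ ⌊x/n⌋ gives n ≤ ⌊x/U⌋, so a jump at U is paid for by one value of ψ.
    S-steps : ∀ us x → All (NonZero ∘ proj₁) us → S (λ n → steps us (x ÷ n)) ≤ stepsψ us x
    S-steps [] x [] = ≤-reflexive S-0
    S-steps ((U , e) ∷ us) x (U≢0 ∷ us≢0) = begin
      S (λ n → e * ⟦ U ≤? x ÷ n ⟧ + steps us (x ÷ n)) ≡⟨ S-+ (λ n → e * ⟦ U ≤? x ÷ n ⟧) (λ n → steps us (x ÷ n)) ⟩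
      S (λ n → e * ⟦ U ≤? x ÷ n ⟧) + S (λ n → steps us (x ÷ n)) ≤⟨ +-mono-≤ (begin
          S (λ n → e * ⟦ U ≤? x ÷ n ⟧) ≡⟨ S-*ˡ e (λ n → ⟦ U ≤? x ÷ n ⟧) ⟩
          e * S (λ n → ⟦ U ≤? x ÷ n ⟧) ≤⟨ *-monoʳ-≤ e (S-mono (λ n → ⟦ U ≤? x ÷ n ⟧) (λ n → ⟦ n ≤? x ÷ U ⟧)
            (λ p j pp _ → ⟦⟧-mono (U ≤? x ÷ p ^ suc j) (p ^ suc j ≤? x ÷ U) (transfer (p ^ suc j) {{m^n≢0 p (suc j) {{prime⇒nonZero pp}}}}))) ⟩
          e * psi (x ÷ U) ∎) (S-steps us x us≢0) ⟩
      stepsψ ((U , e) ∷ us) x ∎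
      where
      open ≤-Reasoning
      instance _ = U≢0
      transfer : ∀ n .{{_ : NonZero n}} → U ≤ x ÷ n → n ≤ x ÷ U
      transfer n h = subst (n ≤_) (sym (÷≡/ x U)) (≤-/ n U x (≤-trans (*-monoʳ-≤ n (subst (U ≤_) (÷≡/ x n) h))
        (≤-trans (≤-reflexive (*-comm n (x / n))) (m/n*n≤m x n))))

    -- Only proper prime powers lie in a window without primes, and these are few.
    S-window : ∀ w r (P : ℕ → Set) (P? : ∀ n → Dec (P n)) → X < r * r → (∀ n → P n → n ≤ X) → (∀ p → Prime p → ¬ P p) →
               S (λ n → w * ⟦ P? n ⟧) ≤ w * (r * (β * K * β))
    S-window w r P P? X<r² P≤X noP = begin
      S (λ n → w * ⟦ P? n ⟧) ≡⟨ S-*ˡ w (λ n → ⟦ P? n ⟧) ⟩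
      w * S (λ n → ⟦ P? n ⟧) ≤⟨ *-monoʳ-≤ w (begin
        ∑ (suc X) (λ p → wt p * ∑ β (λ j → ⟦ P? (p ^ suc j) ⟧)) ≤⟨ ∑-mono (suc X) (λ p p≤X → term p (≤-pred p≤X)) ⟩
        ∑ (suc X) (λ p → ⟦ p <? r ⟧ * (β * K * β)) ≡⟨ ∑-*ʳ (suc X) (β * K * β) _ ⟩
        ∑ (suc X) (λ p → ⟦ p <? r ⟧) * (β * K * β) ≤⟨ *-monoˡ-≤ (β * K * β) (∑-initial (suc X) r) ⟩
        r * (β * K * β) ∎) ⟩
      w * (r * (β * K * β)) ∎
      where
      open ≤-Reasoning
      inner : ∀ p → Prime p → ∑ β (λ j → ⟦ P? (p ^ suc j) ⟧) ≤ ⟦ p <? r ⟧ * β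
      inner p pp = ≤-trans (∑-≤const β ⟦ p <? r ⟧ (λ j _ → ⟦⟧-mono (P? (p ^ suc j)) (p <? r) (small j))) (≤-reflexive (*-comm β _))
        where
        small : ∀ j → P (p ^ suc j) → p < r
        small zero h = ⊥-elim (noP p pp (subst P (*-identityʳ p) h))
        small (suc j) h with p <? r
        ... | yes p<r = p<r
        ... | no p≮r = ⊥-elim (<⇒≱ X<r² (begin
                r * r ≤⟨ *-mono-≤ (≮⇒≥ p≮r) (≮⇒≥ p≮r) ⟩
                p * p ≤⟨ *-monoʳ-≤ p (m≤m*n p (p ^ j) {{m^n≢0 p j {{prime⇒nonZero pp}}}}) ⟩
                p * (p * p ^ j) ≤⟨ P≤X _ h ⟩
                X ∎))
      term : ∀ p → p ≤ X → wt p * ∑ β (λ j → ⟦ P? (p ^ suc j) ⟧) ≤ ⟦ p <? r ⟧ * (β * K * β)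
      term p p≤X with prime? p
      ... | no _ = z≤n
      ... | yes pp = begin
        (lam p + 0) * ∑ β (λ j → ⟦ P? (p ^ suc j) ⟧) ≤⟨ *-mono-≤ (≤-trans (≤-reflexive (+-identityʳ (lam p))) (lam-≤ p {{prime⇒nonZero pp}} p≤X)) (inner p pp) ⟩
        β * K * (⟦ p <? r ⟧ * β) ≡⟨ lem (β * K) ⟦ p <? r ⟧ β ⟩
        ⟦ p <? r ⟧ * (β * K * β) ∎
        where lem : ∀ a b c → a * (b * c) ≡ b * (a * c)
              lem = solve-∀

    -- The pointwise hypothesis, summed over Λ, bounds F(x) - F(y) by `S b`; replacing every `G` by
    -- its main term cancels `T x` and `T y` and leaves (x - y)(`L ns` - `L ps`) on the left.
    -- Subtracted terms have been moved across, so all quantities stay natural.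
    comparison : ∀ ps ns x y b → x ≤ X → y ≤ X → total ps ≡ total ns → length ps ≡ length ns → length ps ≤ X →
      (∀ p j → Prime p → p ≤ X → Φ ps (x ÷ p ^ suc j) + Φ ns (y ÷ p ^ suc j) ≤ Φ ns (x ÷ p ^ suc j) + Φ ps (y ÷ p ^ suc j) + b (p ^ suc j)) →
      x * L ns + y * L ps ≤ x * L ps + y * L ns + (S b + 2 * total ps * (err (length ps) x + err (length ps) y))
    comparison ps ns x y b x≤X y≤X s≡ len≡ D≤X h = +-cancelˡ-≤ (G ps x + G ns y + (G ns x + G ps y)) _ _ (begin
      Gpx + Gny + (Gnx + Gpy) + (x * L ns + y * L ps) ≡⟨ lem₁ Gpx Gny Gnx Gpy (x * L ns) (y * L ps) ⟩
      (Gpx + Gny) + ((Gnx + x * L ns) + (Gpy + y * L ps)) ≤⟨ +-mono-≤ pointwise (+-mono-≤ lower₁ lower₂) ⟩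
      (Gnx + Gpy + S b) + ((Gpx + x * L ps + s * ex + s * ex) + (Gny + y * L ns + s * ey + s * ey))
        ≡⟨ lem₂ Gpx Gny Gnx Gpy (x * L ps) (y * L ns) (S b) s ex ey ⟩
      Gpx + Gny + (Gnx + Gpy) + (x * L ps + y * L ns + (S b + 2 * s * (ex + ey))) ∎)
      where
      open ≤-Reasoning
      Gpx = G ps x
      Gny = G ns y
      Gnx = G ns x
      Gpy = G ps y
      s = total ps
      ex = err (length ps) x
      ey = err (length ps) y
      lem₁ : ∀ a b c d e f → a + b + (c + d) + (e + f) ≡ (a + b) + ((c + e) + (d + f))
      lem₁ = solve-∀
      lem₂ : ∀ a b c d e f g s x y → (c + d + g) + ((a + e + s * x + s * x) + (b + f + s * y + s * y)) ≡ a + b + (c + d) + (e + f + (g + 2 * s * (x + y)))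
      lem₂ = solve-∀
      pointwise : Gpx + Gny ≤ Gnx + Gpy + S b
      pointwise = begin
        Gpx + Gny ≡⟨ cong₂ _+_ (G≡SΦ ps x) (G≡SΦ ns y) ⟩
        S (λ n → Φ ps (x ÷ n)) + S (λ n → Φ ns (y ÷ n)) ≡⟨ S-+ (λ n → Φ ps (x ÷ n)) (λ n → Φ ns (y ÷ n)) ⟨
        S (λ n → Φ ps (x ÷ n) + Φ ns (y ÷ n)) ≤⟨ S-mono (λ n → Φ ps (x ÷ n) + Φ ns (y ÷ n)) (λ n → Φ ns (x ÷ n) + Φ ps (y ÷ n) + b n) h ⟩
        S (λ n → Φ ns (x ÷ n) + Φ ps (y ÷ n) + b n) ≡⟨ S-+ (λ n → Φ ns (x ÷ n) + Φ ps (y ÷ n)) b ⟩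
        S (λ n → Φ ns (x ÷ n) + Φ ps (y ÷ n)) + S b ≡⟨ cong (_+ S b) (S-+ (λ n → Φ ns (x ÷ n)) (λ n → Φ ps (y ÷ n))) ⟩
        S (λ n → Φ ns (x ÷ n)) + S (λ n → Φ ps (y ÷ n)) + S b ≡⟨ cong (_+ S b) (cong₂ _+_ (G≡SΦ ns x) (G≡SΦ ps y)) ⟨
        Gnx + Gpy + S b ∎
      two-sided : ∀ us vs z → z ≤ X → length us ≤ X → length us ≡ length vs → total us ≡ total vs →
                  G us z + z * L us ≤ G vs z + z * L vs + total us * err (length us) z + total us * err (length us) z
      two-sided us vs z z≤X D≤X refl′ s≡ = begin
        G us z + z * L us ≤⟨ G-lower us z z≤X D≤X ⟩
        total us * (T z + err (length us) z) ≡⟨ *-distribˡ-+ (total us) (T z) _ ⟩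
        total us * T z + total us * err (length us) z ≡⟨ cong (λ t → t * T z + total us * err (length us) z) s≡ ⟩
        total vs * T z + total us * err (length us) z ≤⟨ +-monoˡ-≤ _ (G-upper vs z z≤X (subst (_≤ X) refl′ D≤X)) ⟩
        G vs z + z * L vs + total vs * err (length vs) z + total us * err (length us) z
          ≡⟨ cong (λ t → G vs z + z * L vs + t + total us * err (length us) z) (cong₂ (λ a b → a * err b z) (sym s≡) (sym refl′)) ⟩
        G vs z + z * L vs + total us * err (length us) z + total us * err (length us) z ∎
      lower₁ : Gnx + x * L ns ≤ Gpx + x * L ps + s * ex + s * ex
      lower₁ = subst₂ (λ t l → Gnx + x * L ns ≤ Gpx + x * L ps + t * err l x + t * err l x) (sym s≡) (sym len≡)
                 (two-sided ns ps x x≤X (subst (_≤ X) len≡ D≤X) (sym len≡) (sym s≡))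
      lower₂ : Gpy + y * L ps ≤ Gny + y * L ns + s * ey + s * ey
      lower₂ = two-sided ps ns y y≤X D≤X len≡ s≡

-- Tabulating Σ v_d (k mod d) by arithmetic on large numbers

module BigDigits where

  open import Data.List using (applyUpTo)
  open import Data.Bool using (true; false; if_then_else_; T)
  open import Data.Unit using (tt)
  open Sums
  open PrimePowerSums
  open FactorialSums

  -- A sequence with values below B is stored as the number Σ_{k<n} f(k) B^k.
  module Digits (B : ℕ) {{_ : NonZero B}} where

    number : ℕ → (ℕ → ℕ) → ℕ
    number n f = ∑ n λ k → f k * B ^ k

    number-cong : ∀ n {f g : ℕ → ℕ} → (∀ i → f i ≡ g i) → number n f ≡ number n g
    number-cong n h = ∑-cong n λ i _ → cong (_* B ^ i) (h i)

    number-split : ∀ m n f → number (m + n) f ≡ number m f + B ^ m * number n (f ∘ (m +_))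
    number-split m n f = trans (∑-split m n _) (cong (number m f +_) (trans (∑-cong n (λ i _ →
        trans (cong (f (m + i) *_) (^-distribˡ-+-* B m i)) (lem (f (m + i)) (B ^ m) (B ^ i)))) (∑-*ˡ n (B ^ m) _)))
      where lem : ∀ a b c → a * (b * c) ≡ b * (a * c)
            lem = solve-∀

    number-< : ∀ n f → (∀ i → f i < B) → number n f < B ^ n
    number-< zero f h = s≤s z≤n
    number-< (suc n) f h = begin-strict
      number n f + f n * B ^ n <⟨ +-monoˡ-< (f n * B ^ n) (number-< n f h) ⟩
      B ^ n + f n * B ^ n ≤⟨ *-monoˡ-≤ (B ^ n) (h n) ⟩
      B * B ^ n ∎
      where open ≤-Reasoning

    number-% : ∀ {m n M} .{{_ : NonZero M}} f → (∀ i → f i < B) → n ≤ m → M ≡ B ^ n → number m f % M ≡ number n f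
    number-% {m} {n} f h n≤m refl = begin
      number m f % B ^ n ≡⟨ cong (λ t → number t f % B ^ n) (m+[n∸m]≡n n≤m) ⟨
      number (n + (m ∸ n)) f % B ^ n ≡⟨ cong (_% B ^ n) (number-split n (m ∸ n) f) ⟩
      (number n f + B ^ n * number (m ∸ n) (f ∘ (n +_))) % B ^ n ≡⟨ %-remove-+ʳ (number n f) (m∣m*n _) ⟩
      number n f % B ^ n ≡⟨ m<n⇒m%n≡m (number-< n f h) ⟩
      number n f ∎
      where open ≡-Reasoning

    number-/ : ∀ {m n M} .{{_ : NonZero M}} f → (∀ i → f i < B) → M ≡ B ^ m → number (m + n) f / M ≡ number n (f ∘ (m +_))
    number-/ {m} {n} f h refl = /-unique (number m f) _ (trans (number-split m n f) (cong (number m f +_) (*-comm (B ^ m) _))) (number-< m f h)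

    -- Divide and conquer: one division by B^(2^h) halves a string of 2^(h+1) digits, so all digits
    -- are read off in as many levels as there are moduli. A modulus 0 never arises, since the
    -- moduli are powers of B.
    digits : List ℕ → ℕ → List ℕ → List ℕ
    digits [] N acc = N ∷ acc
    digits (zero ∷ Ms) N acc = N ∷ acc
    digits (M@(suc _) ∷ Ms) N acc = digits Ms (N % M) (digits Ms (N / M) acc)

    data Moduli : ℕ → List ℕ → Set where
      [] : Moduli 0 []
      _∷_ : ∀ {h M Ms} → M ≡ B ^ (2 ^ h) → Moduli h Ms → Moduli (suc h) (M ∷ Ms)

    applyUpTo-split : ∀ m n (f : ℕ → ℕ) → applyUpTo f (m + n) ≡ applyUpTo f m ++ applyUpTo (f ∘ (m +_)) n
    applyUpTo-split zero n f = refl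
    applyUpTo-split (suc m) n f = cong (f 0 ∷_) (applyUpTo-split m n (f ∘ suc))

    digits-spec : ∀ {h Ms} → Moduli h Ms → ∀ f acc → (∀ i → f i < B) → digits Ms (number (2 ^ h) f) acc ≡ applyUpTo f (2 ^ h) ++ acc
    digits-spec [] f acc _ = cong (_∷ acc) (*-identityʳ (f 0))
    digits-spec {suc h} (_∷_ {M = zero} M≡ ms) f acc f<B = ⊥-elim (<⇒≢ (m^n>0 B (2 ^ h)) M≡)
    digits-spec {suc h} {suc m ∷ Ms} (M≡ ∷ ms) f acc f<B = begin
      digits Ms (N % suc m) (digits Ms (N / suc m) acc)
        ≡⟨ cong₂ (λ a b → digits Ms a (digits Ms b acc)) (number-% f f<B (m≤m+n (2 ^ h) _) M≡)
             (trans (cong (λ t → number (2 ^ h + t) f / suc m) (+-identityʳ (2 ^ h))) (number-/ {m = 2 ^ h} {2 ^ h} f f<B M≡)) ⟩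
      digits Ms (number (2 ^ h) f) (digits Ms (number (2 ^ h) g) acc) ≡⟨ digits-spec ms f _ f<B ⟩
      applyUpTo f (2 ^ h) ++ digits Ms (number (2 ^ h) g) acc ≡⟨ cong (applyUpTo f (2 ^ h) ++_) (digits-spec ms g acc (f<B ∘ (2 ^ h +_))) ⟩
      applyUpTo f (2 ^ h) ++ (applyUpTo g (2 ^ h) ++ acc) ≡⟨ ++-assoc (applyUpTo f (2 ^ h)) _ acc ⟨
      (applyUpTo f (2 ^ h) ++ applyUpTo g (2 ^ h)) ++ acc ≡⟨ cong (_++ acc) (applyUpTo-split (2 ^ h) (2 ^ h) f) ⟨
      applyUpTo f (2 ^ h + 2 ^ h) ++ acc ≡⟨ cong (λ t → applyUpTo f (2 ^ h + t) ++ acc) (+-identityʳ (2 ^ h)) ⟨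
      applyUpTo f (2 ^ suc h) ++ acc ∎
      where
      open ≡-Reasoning
      open import Data.List.Properties using (++-assoc)
      N = number (2 ^ suc h) f
      g = f ∘ (2 ^ h +_)

    moduli : ℕ → ℕ → List ℕ → List ℕ
    moduli zero b acc = acc
    moduli (suc h) b acc = moduli h (b * b) (b ∷ acc)

    moduli-spec : ∀ h {i b acc} → b ≡ B ^ (2 ^ i) → Moduli i acc → Moduli (h + i) (moduli h b acc)
    moduli-spec zero _ ms = ms
    moduli-spec (suc h) {i} {b} {acc} b≡ ms = subst (λ t → Moduli t (moduli h (b * b) (b ∷ acc))) (+-suc h i) (moduli-spec h eq (b≡ ∷ ms))
      where
      eq : b * b ≡ B ^ (2 ^ suc i)
      eq = trans (cong₂ _*_ b≡ b≡) (trans (sym (^-distribˡ-+-* B (2 ^ i) (2 ^ i))) (cong (λ t → B ^ (2 ^ i + t)) (sym (+-identityʳ (2 ^ i)))))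

    -- From r = number d f with d-periodic f and b = B^d, repeat r until it has at least n digits.
    repeat : ℕ → ℕ → ℕ → ℕ → ℕ → ℕ
    repeat zero n d r b = r
    repeat (suc i) n d r b = if n ≤ᵇ d then r else repeat i n (d + d) (r + b * r) (b * b)

    repeat-spec : ∀ i n d f → (∀ k → f (d + k) ≡ f k) → n ≤ d * 2 ^ i → ∃[ m ] n ≤ m × repeat i n d (number d f) (B ^ d) ≡ number m f
    repeat-spec zero n d f per n≤ = d , subst (n ≤_) (*-identityʳ d) n≤ , refl
    repeat-spec (suc i) n d f per n≤ with n ≤ᵇ d in eq
    ... | true = d , ≤ᵇ⇒≤ n d (subst T (sym eq) tt) , refl
    ... | false with repeat-spec i n (d + d) f per₂ (subst (n ≤_) (lem d (2 ^ i)) n≤)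
      where
      per₂ : ∀ k → f (d + d + k) ≡ f k
      per₂ k = trans (cong f (+-assoc d d k)) (trans (per (d + k)) (per k))
      lem : ∀ d t → d * (2 * t) ≡ (d + d) * t
      lem = solve-∀
    ... | m , n≤m , e = m , n≤m , trans (cong₂ (repeat i n (d + d)) step (sym (^-distribˡ-+-* B d d))) e
      where
      step : number d f + B ^ d * number d f ≡ number (d + d) f
      step = sym (trans (number-split d d f) (cong (λ t → number d f + B ^ d * t) (number-cong d per)))

  rem : ℕ → ℕ → ℕ
  rem k zero = 0
  rem k (suc d) = k % suc d

  -- Since d ⌊k/d⌋ = k − k mod d, balanced combinations of Φ can be computed from R.
  R : List ℕ → ℕ → ℕ
  R vs k = dot (rem k) 0 vs

  Φ+R : ∀ vs k → Φ vs k + R vs k ≡ k * total vs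
  Φ+R vs k = begin
    Φ vs k + R vs k ≡⟨ dot-+ _ _ 0 vs ⟨
    dot (λ d → d * (k ÷ d) + rem k d) 0 vs ≡⟨ dot-cong′ 0 vs ⟩
    dot (const k) 0 vs ≡⟨ dot-const k vs ⟩
    k * total vs ∎
    where
    open ≡-Reasoning
    dot-cong′ : ∀ m vs → dot (λ d → d * (k ÷ d) + rem k d) m vs ≡ dot (const k) m vs
    dot-cong′ m [] = refl
    dot-cong′ m (v ∷ vs) = cong₂ (λ a b → v * a + b)
      (trans (+-comm (suc m * (k / suc m)) (k % suc m)) (trans (cong (k % suc m +_) (*-comm (suc m) (k / suc m))) (sym (m≡m%n+[m/n]*n k (suc m)))))
      (dot-cong′ (suc m) vs)

  spread : List ℕ → ℕ
  spread = dot pred 0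

  R≤spread : ∀ vs k → R vs k ≤ spread vs
  R≤spread vs k = dot-mono 0 vs λ { (suc d) _ → m<1+n⇒m≤n (m%n<n k (suc d)) }

  square-iter : ℕ → ℕ → ℕ
  square-iter zero b = b
  square-iter (suc i) b = square-iter i (b * b)

  square-iter-spec : ∀ i b → square-iter i b ≡ b ^ (2 ^ i)
  square-iter-spec zero b = sym (*-identityʳ b)
  square-iter-spec (suc i) b = trans (square-iter-spec i (b * b)) (trans (cong (_^ (2 ^ i)) (cong (b *_) (sym (*-identityʳ b)))) (^-*-assoc b 2 (2 ^ i)))

  module Encoding (B : ℕ) {{_ : NonZero B}} (h : ℕ) where
    open Digits B

    -- Along the list, b = B^m and r = Σ k B^k over k < m are maintained, so that `r + m * b` is one
    -- period 0, 1, ..., m of the remainders modulo m + 1. Repeating it by doubling and truncating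
    -- gives all n remainders at once, so a nonzero coefficient costs a few operations on large
    -- numbers instead of n small ones.
    encode : (n Bⁿ : ℕ) .{{_ : NonZero Bⁿ}} → ℕ → ℕ → ℕ → List ℕ → ℕ
    encode n Bⁿ m b r [] = 0
    encode n Bⁿ m b r (zero ∷ vs) = encode n Bⁿ (suc m) (B * b) (r + m * b) vs
    encode n Bⁿ m b r (v@(suc _) ∷ vs) = v * (repeat h n (suc m) (r + m * b) (B * b) % Bⁿ) + encode n Bⁿ (suc m) (B * b) (r + m * b) vs

    encode-spec : ∀ {Bⁿ} .{{_ : NonZero Bⁿ}} m vs → m + length vs ≤ B → Bⁿ ≡ B ^ (2 ^ h) →
      encode (2 ^ h) Bⁿ m (B ^ m) (number m id) vs ≡ number (2 ^ h) (λ k → dot (rem k) m vs)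
    encode-spec m [] _ _ = sym (trans (∑-const (2 ^ h) 0) (*-zeroʳ (2 ^ h)))
    encode-spec m (zero ∷ vs) D≤B e = encode-spec (suc m) vs (subst (_≤ B) (+-suc m (length vs)) D≤B) e
    encode-spec {Bⁿ} m (v@(suc _) ∷ vs) D≤B e = begin
      v * (repeat h (2 ^ h) d (number d id) (B ^ d) % Bⁿ) + rest
        ≡⟨ cong₂ (λ a b → v * a + b) block (encode-spec d vs D≤B′ e) ⟩
      v * number n (_% d) + number n (λ k → dot (rem k) d vs) ≡⟨ cong (_+ number n (λ k → dot (rem k) d vs)) (∑-*ˡ n v _) ⟨
      ∑ n (λ k → v * (k % d * B ^ k)) + number n (λ k → dot (rem k) d vs) ≡⟨ ∑-+ n _ _ ⟨
      ∑ n (λ k → v * (k % d * B ^ k) + dot (rem k) d vs * B ^ k) ≡⟨ ∑-cong n (λ k _ → lem v (k % d) (dot (rem k) d vs) (B ^ k)) ⟩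
      number n (λ k → dot (rem k) m (v ∷ vs)) ∎
      where
      open ≡-Reasoning
      d = suc m
      n = 2 ^ h
      rest = encode (2 ^ h) Bⁿ d (B ^ d) (number d id) vs
      D≤B′ : d + length vs ≤ B
      D≤B′ = subst (_≤ B) (+-suc m (length vs)) D≤B
      lem : ∀ v a c b → v * (a * b) + c * b ≡ (v * a + c) * b
      lem = solve-∀
      per : ∀ k → (d + k) % d ≡ k % d
      per k = %-remove-+ˡ k ∣-refl
      small : ∀ i → i % d < B
      small i = <-≤-trans (m%n<n i d) (≤-trans (m≤m+n d (length vs)) D≤B′)
      start : number d id ≡ number d (_% d)
      start = ∑-cong d λ i i<d → cong (_* B ^ i) (sym (m<n⇒m%n≡m i<d))
      block : repeat h n d (number d id) (B ^ d) % Bⁿ ≡ number n (_% d)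
      block with repeat-spec h n d (_% d) per (m≤n*m n d)
      ... | m′ , n≤m′ , eq = trans (cong (λ t → repeat h n d t (B ^ d) % Bⁿ) start) (trans (cong (_% Bⁿ) eq) (number-% (_% d) small n≤m′ e))

    -- Arithmetic on numbers with 2^h digits keeps the evaluation of all these values feasible.
    remainders : List ℕ → List ℕ
    remainders vs with square-iter h B
    ... | zero = []
    ... | Bⁿ@(suc _) = digits (moduli h B []) (encode (2 ^ h) Bⁿ 0 1 0 vs) []

    remainders-spec : ∀ vs → length vs ≤ B → spread vs < B → remainders vs ≡ applyUpTo (R vs) (2 ^ h)
    remainders-spec vs D≤B s<B with square-iter h B in eq
    ... | zero = ⊥-elim (<⇒≢ (m^n>0 B (2 ^ h)) (trans (sym eq) (square-iter-spec h B)))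
    ... | suc b-1 = begin
      digits ms (encode (2 ^ h) (suc b-1) 0 1 0 vs) [] ≡⟨ cong (λ t → digits ms t []) (encode-spec 0 vs D≤B (trans (sym eq) (square-iter-spec h B))) ⟩
      digits ms (number (2 ^ h) (R vs)) []
        ≡⟨ digits-spec (subst (λ t → Moduli t ms) (+-identityʳ h) (moduli-spec h (sym (*-identityʳ B)) [])) (R vs) [] (λ i → ≤-<-trans (R≤spread vs i) s<B) ⟩
      applyUpTo (R vs) (2 ^ h) ++ [] ≡⟨ ++-identityʳ _ ⟩
      applyUpTo (R vs) (2 ^ h) ∎
      where
      open ≡-Reasoning
      open import Data.List.Properties using (++-identityʳ)
      ms = moduli h B []

-- Checking the noise Φ(k) - Φ(v) for v near 62k/63

module NoiseCheck where

  open import Data.List using (applyUpTo; drop)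
  open import Data.Bool using (Bool; true; false; _∧_; T)
  open import Data.Unit using (tt)
  open Sums
  open PrimePowerSums
  open FactorialSums
  open BigDigits

  ∧-true : ∀ {a b} → a ∧ b ≡ true → a ≡ true × b ≡ true
  ∧-true {true} {true} refl = refl , refl

  ≤ᵇ-sound : ∀ {m n} → (m ≤ᵇ n) ≡ true → m ≤ n
  ≤ᵇ-sound {m} {n} e = ≤ᵇ⇒≤ m n (subst T (sym e) tt)

  -- Segments (length , increment) of a step function starting at k.
  jumps : ℕ → List (ℕ × ℕ) → List (ℕ × ℕ)
  jumps k [] = []
  jumps k ((l , e) ∷ segs) = (k , e) ∷ jumps (k + l) segs

  steps-shift : ∀ k segs i → steps (jumps (suc k) segs) (suc i) ≡ steps (jumps k segs) i
  steps-shift k [] i = refl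
  steps-shift k ((l , e) ∷ segs) i = cong₂ _+_ (cong (e *_) (⟦⟧-cong (suc k ≤? suc i) (k ≤? i) ≤-pred s≤s)) (steps-shift (k + l) segs i)

  steps-++ : ∀ us vs i → steps (us ++ vs) i ≡ steps us i + steps vs i
  steps-++ [] vs i = refl
  steps-++ ((U , e) ∷ us) vs i rewrite steps-++ us vs i = sym (+-assoc (e * ⟦ U ≤? i ⟧) (steps us i) (steps vs i))

  -- Two synchronised passes over the same sequences, the second advancing at q/(q+1) of the speed
  -- of the first; r is the remainder of the division that determines its position.
  scan : (q : ℕ) (a b a′ b′ : List ℕ) (r len cur : ℕ) → List (ℕ × ℕ) → Bool
  scan q [] b a′ b′ r len cur segs = true
  scan q (x ∷ a) b a′ b′ r zero cur [] = false
  scan q (x ∷ a) b a′ b′ r zero cur ((l , e) ∷ segs) = scan q (x ∷ a) b a′ b′ r l (cur + e) segs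
  scan q (x ∷ a) (y ∷ b) (u ∷ a′) (w ∷ b′) zero (suc len) cur segs = (y + u ≤ᵇ x + w + cur) ∧ scan q a b (u ∷ a′) (w ∷ b′) q len cur segs
  scan q (x ∷ a) (y ∷ b) (u ∷ a′) (w ∷ b′) (suc r) (suc len) cur segs = (y + u ≤ᵇ x + w + cur) ∧ scan q a b a′ b′ r len cur segs
  scan q (x ∷ a) b a′ b′ r (suc len) cur segs = false

  -- The equation says that the second list has advanced by j = ⌊(r + q i)/(q + 1)⌋ when the first
  -- has advanced by i. Adding q to a remainder modulo q + 1 lowers it by one and carries, except at
  -- remainder 0, where there is no carry: exactly there the second list pauses.
  scan-sound : ∀ q m segs (x y u w : ℕ → ℕ) l r len cur → r < suc q →
    scan q (applyUpTo x m) (applyUpTo y m) (applyUpTo u l) (applyUpTo w l) r len cur segs ≡ true →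
    ∀ i j s → i < m → s < suc q → r + q * i ≡ suc q * j + s → y i + u j ≤ x i + w j + (cur + steps (jumps len segs) i)
  scan-sound q (suc m) [] x y u w l r zero cur r≤q ()
  scan-sound q (suc m) ((l′ , e) ∷ segs) x y u w l r zero cur r≤q ok i j s i<m s≤q eq =
    ≤-trans (scan-sound q (suc m) segs x y u w l r l′ (cur + e) r≤q ok i j s i<m s≤q eq)
      (≤-reflexive (cong (x i + w j +_) (trans (+-assoc cur e _) (cong (λ t → cur + (t + steps (jumps l′ segs) i)) (sym (*-identityʳ e))))))
  scan-sound q (suc m) segs x y u w zero zero (suc len) cur r≤q ()
  scan-sound q (suc m) segs x y u w zero (suc r) (suc len) cur r≤q ()
  scan-sound q (suc m) segs x y u w (suc l) zero (suc len) cur r≤q ok zero zero s i<m s≤q eq =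
    ≤-trans (≤ᵇ-sound (proj₁ (∧-true ok))) (+-monoʳ-≤ (x 0 + w 0) (m≤m+n cur _))
  scan-sound q (suc m) segs x y u w (suc l) (suc r) (suc len) cur r≤q ok zero zero s i<m s≤q eq =
    ≤-trans (≤ᵇ-sound (proj₁ (∧-true ok))) (+-monoʳ-≤ (x 0 + w 0) (m≤m+n cur _))
  scan-sound q (suc m) segs x y u w (suc l) r (suc len) cur r≤q ok zero (suc j) s i<m s≤q eq =
    ⊥-elim (<⇒≱ r≤q (begin
      suc q ≤⟨ m≤m*n (suc q) (suc j) ⟩
      suc q * suc j ≤⟨ m≤m+n _ s ⟩
      suc q * suc j + s ≡⟨ eq ⟨
      r + q * 0 ≡⟨ cong (r +_) (*-zeroʳ q) ⟩
      r + 0 ≡⟨ +-identityʳ r ⟩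
      r ∎))
    where open ≤-Reasoning
  scan-sound q (suc m) segs x y u w (suc l) zero (suc len) cur r≤q ok (suc i) j s i<m s≤q eq =
    ≤-trans (scan-sound q m segs (x ∘ suc) (y ∘ suc) u w (suc l) q len cur ≤-refl (proj₂ (∧-true ok)) i j s (≤-pred i<m) s≤q
              (trans (sym (*-suc q i)) eq))
      (≤-reflexive (cong (λ t → x (suc i) + w j + (cur + t)) (sym (steps-shift len segs i))))
  scan-sound q (suc m) segs x y u w (suc l) (suc r) (suc len) cur r≤q ok (suc i) zero s i<m s≤q eq =
    ⊥-elim (<⇒≱ s≤q (begin
      suc q ≤⟨ s≤s (m≤m+n q (q * i)) ⟩
      suc (q + q * i) ≤⟨ s≤s (m≤n+m (q + q * i) r) ⟩
      suc r + (q + q * i) ≡⟨ cong (suc r +_) (*-suc q i) ⟨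
      suc r + q * suc i ≡⟨ eq ⟩
      suc q * 0 + s ≡⟨ cong (_+ s) (*-zeroʳ q) ⟩
      s ∎))
    where open ≤-Reasoning
  scan-sound q (suc m) segs x y u w (suc l) (suc r) (suc len) cur r≤q ok (suc i) (suc j) s i<m s≤q eq =
    ≤-trans (scan-sound q m segs (x ∘ suc) (y ∘ suc) (u ∘ suc) (w ∘ suc) l r len cur (<-trans (n<1+n r) r≤q) (proj₂ (∧-true ok)) i j s (≤-pred i<m) s≤q
              (+-cancelˡ-≡ (suc q) _ _ (trans (lem₁ q r i) (trans eq (lem₂ q j s)))))
      (≤-reflexive (cong (λ t → x (suc i) + w (suc j) + (cur + t)) (sym (steps-shift len segs i))))
    where
    lem₁ : ∀ q r i → suc q + (r + q * i) ≡ suc r + q * suc i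
    lem₁ = solve-∀
    lem₂ : ∀ q j s → suc q * suc j + s ≡ suc q + (suc q * j + s)
    lem₂ = solve-∀

  drop-applyUpTo : ∀ k (f : ℕ → ℕ) n → drop k (applyUpTo f n) ≡ applyUpTo (f ∘ (k +_)) (n ∸ k)
  drop-applyUpTo zero f n = refl
  drop-applyUpTo (suc k) f zero = refl
  drop-applyUpTo (suc k) f (suc n) = drop-applyUpTo k (f ∘ suc) n

  -- For k = ⌊x/n⌋ the value v = ⌊y/n⌋ lies between ⌊62k/63⌋ and ⌊(62k + 61)/63⌋, which differ by at
  -- most 1, so there is one scan for each. At k = 2 these quotients are 1 with remainder 61 and 2
  -- with remainder 59, the starting data.
  check-rows : List (ℕ × ℕ) → List ℕ → List ℕ → Bool
  check-rows segs a b = scan 62 (drop 2 a) (drop 2 b) (drop 1 a) (drop 1 b) 61 0 0 segs ∧ scan 62 (drop 2 a) (drop 2 b) (drop 2 a) (drop 2 b) 59 0 0 segs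

  check-rows-sound : ∀ segs (x y : ℕ → ℕ) n → check-rows segs (applyUpTo x n) (applyUpTo y n) ≡ true →
    ∀ k v s → 2 ≤ k → k < n → 1 ≤ v → s < 63 → (62 * k ≡ 63 * v + s) ⊎ (62 * k + 61 ≡ 63 * v + s) → y k + x v ≤ x k + y v + steps (jumps 2 segs) k
  check-rows-sound segs x y n ok (suc (suc i)) (suc v) s (s≤s (s≤s z≤n)) k<n (s≤s z≤n) s<63 h
    rewrite drop-applyUpTo 2 x n | drop-applyUpTo 2 y n | drop-applyUpTo 1 x n | drop-applyUpTo 1 y n
          | steps-shift 1 segs (suc i) | steps-shift 0 segs i with h
  ... | inj₁ e = scan-sound 62 (n ∸ 2) segs (x ∘ (2 +_)) (y ∘ (2 +_)) (x ∘ suc) (y ∘ suc) (n ∸ 1) 61 0 0 (m≤m+n 62 1) (proj₁ (∧-true ok))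
        i v s (∸-monoˡ-≤ 2 k<n) s<63 (+-cancelˡ-≡ 63 _ _ (trans (lem₁ i) (trans e (lem₂ v s))))
    where
    lem₁ : ∀ i → 63 + (61 + 62 * i) ≡ 62 * (2 + i)
    lem₁ = solve-∀
    lem₂ : ∀ v s → 63 * (1 + v) + s ≡ 63 + (63 * v + s)
    lem₂ = solve-∀
  ... | inj₂ e with v
  ... | zero = ⊥-elim (<⇒≱ s<63 (≤-trans (m≤m+n 63 (59 + 62 * i)) (≤-reflexive (+-cancelˡ-≡ 63 _ _ (trans (lem i) e)))))
    where
    lem : ∀ i → 63 + (63 + (59 + 62 * i)) ≡ 62 * (2 + i) + 61
    lem = solve-∀
  ... | suc j = scan-sound 62 (n ∸ 2) segs (x ∘ (2 +_)) (y ∘ (2 +_)) (x ∘ (2 +_)) (y ∘ (2 +_)) (n ∸ 2) 59 0 0 (m≤m+n 60 3) (proj₂ (∧-true {scan 62 (applyUpTo (x ∘ (2 +_)) (n ∸ 2)) (applyUpTo (y ∘ (2 +_)) (n ∸ 2)) (applyUpTo (x ∘ suc) (n ∸ 1)) (applyUpTo (y ∘ suc) (n ∸ 1)) 61 0 0 segs} ok))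
        i j s (∸-monoˡ-≤ 2 k<n) s<63 (+-cancelˡ-≡ 126 _ _ (trans (lem₁ i) (trans e (lem₂ j s))))
    where
    lem₁ : ∀ i → 126 + (59 + 62 * i) ≡ 62 * (2 + i) + 61
    lem₁ = solve-∀
    lem₂ : ∀ j s → 63 * (2 + j) + s ≡ 126 + (63 * j + s)
    lem₂ = solve-∀

  module Noise (B : ℕ) {{_ : NonZero B}} (h : ℕ) where
    open Encoding B h

    check : List ℕ → List ℕ → List (ℕ × ℕ) → Bool
    check ps ns segs = check-rows segs (remainders ps) (remainders ns)

    -- The jump at 2^h covers all larger arguments by the trivial bound.
    bounds : List ℕ → List ℕ → List (ℕ × ℕ) → List (ℕ × ℕ)
    bounds ps ns segs = jumps 2 segs ++ (2 ^ h , spread ps + spread ns) ∷ []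

    module _ (ps ns : List ℕ) (segs : List (ℕ × ℕ)) (D≤B : length ps ≤ B) (len≡ : length ps ≡ length ns)
             (s≡ : total ps ≡ total ns) (sp : spread ps < B) (sn : spread ns < B) (ok : check ps ns segs ≡ true) where

      private
        R-noise : ∀ k v s → 2 ≤ k → 1 ≤ v → s < 63 → (62 * k ≡ 63 * v + s) ⊎ (62 * k + 61 ≡ 63 * v + s) →
                  R ns k + R ps v ≤ R ps k + R ns v + steps (bounds ps ns segs) k
        R-noise k v s 2≤k 1≤v s<63 e rewrite steps-++ (jumps 2 segs) ((2 ^ h , spread ps + spread ns) ∷ []) k with k <? 2 ^ h
        ... | yes k<n = ≤-trans (check-rows-sound segs (R ps) (R ns) (2 ^ h)
                (trans (cong₂ (check-rows segs) (sym (remainders-spec ps D≤B sp)) (sym (remainders-spec ns (subst (_≤ B) len≡ D≤B) sn))) ok)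
                k v s 2≤k k<n 1≤v s<63 e) (+-monoʳ-≤ (R ps k + R ns v) (m≤m+n _ _))
        ... | no k≮n rewrite ⟦⟧-yes (2 ^ h ≤? k) (≮⇒≥ k≮n) = begin
                R ns k + R ps v ≤⟨ +-mono-≤ (R≤spread ns k) (R≤spread ps v) ⟩
                spread ns + spread ps ≡⟨ lem (spread ns) (spread ps) ⟩
                (spread ps + spread ns) * 1 + 0 ≤⟨ m≤n+m _ (steps (jumps 2 segs) k) ⟩
                steps (jumps 2 segs) k + ((spread ps + spread ns) * 1 + 0) ≤⟨ m≤n+m _ (R ps k + R ns v) ⟩
                R ps k + R ns v + (steps (jumps 2 segs) k + ((spread ps + spread ns) * 1 + 0)) ∎
          where
          open ≤-Reasoning
          lem : ∀ a b → a + b ≡ (b + a) * 1 + 0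
          lem = solve-∀

      noise : ∀ k v s → 1 ≤ v → s < 63 → (62 * k ≡ 63 * v + s) ⊎ (62 * k + 61 ≡ 63 * v + s) →
              Φ ps k + Φ ns v ≤ Φ ns k + Φ ps v + steps (bounds ps ns segs) k
      noise k v s 1≤v s<63 e with 2 ≤? k
      ... | yes 2≤k = +-cancelʳ-≤ (R ps k + R ns v) _ _ (begin
              Φ ps k + Φ ns v + (R ps k + R ns v) ≡⟨ interchange (Φ ps k) (Φ ns v) (R ps k) (R ns v) ⟩
              (Φ ps k + R ps k) + (Φ ns v + R ns v)
                ≡⟨ cong₂ _+_ (trans (Φ+R ps k) (trans (cong (k *_) s≡) (sym (Φ+R ns k)))) (trans (Φ+R ns v) (trans (cong (v *_) (sym s≡)) (sym (Φ+R ps v)))) ⟩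
              (Φ ns k + R ns k) + (Φ ps v + R ps v) ≡⟨ interchange (Φ ns k) (R ns k) (Φ ps v) (R ps v) ⟩
              (Φ ns k + Φ ps v) + (R ns k + R ps v) ≤⟨ +-monoʳ-≤ (Φ ns k + Φ ps v) (R-noise k v s 2≤k 1≤v s<63 e) ⟩
              (Φ ns k + Φ ps v) + (R ps k + R ns v + E) ≡⟨ lem (Φ ns k + Φ ps v) (R ps k + R ns v) E ⟩
              Φ ns k + Φ ps v + E + (R ps k + R ns v) ∎)
        where
        open ≤-Reasoning
        E = steps (bounds ps ns segs) k
        lem : ∀ a b c → a + (b + c) ≡ a + c + b
        lem = solve-∀
      -- The scans begin at k = 2. Smaller k with v ≥ 1 leaves only k = v = 1, where both sides
      -- agree.
      ... | no 2≰k = subst (λ k → Φ ps k + Φ ns v ≤ Φ ns k + Φ ps v + steps (bounds ps ns segs) k) (sym (trans k≡1 (sym v≡1)))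
                       (≤-trans (≤-reflexive (+-comm (Φ ps v) (Φ ns v))) (m≤m+n _ _))
        where
        open ≤-Reasoning
        k≤1 : k ≤ 1
        k≤1 = ≤-pred (≰⇒> 2≰k)
        Near : Set
        Near = (62 * k ≡ 63 * v + s) ⊎ (62 * k + 61 ≡ 63 * v + s)
        63v≤123 : Near → 63 * v + s ≤ 123
        63v≤123 (inj₁ e) = ≤-trans (≤-reflexive (sym e)) (≤-trans (*-monoʳ-≤ 62 k≤1) (m≤m+n 62 61))
        63v≤123 (inj₂ e) = ≤-trans (≤-reflexive (sym e)) (+-monoˡ-≤ 61 (*-monoʳ-≤ 62 k≤1))
        v≡1 : v ≡ 1
        v≡1 = ≤-antisym (≤-pred (*-cancelˡ-< 63 v 2 (≤-trans (s≤s (≤-trans (m≤m+n (63 * v) s) (63v≤123 e))) (m≤m+n 124 2)))) 1≤v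
        k≢0 : ∀ k → (62 * k ≡ 63 * v + s) ⊎ (62 * k + 61 ≡ 63 * v + s) → 1 ≤ k
        k≢0 (suc _) _ = s≤s z≤n
        k≢0 zero (inj₁ e) = ⊥-elim (<⇒≱ (s≤s z≤n) (≤-trans (≤-trans (*-monoʳ-≤ 63 1≤v) (m≤m+n (63 * v) s)) (≤-reflexive (sym e))))
        k≢0 zero (inj₂ e) = ⊥-elim (<⇒≱ (m≤m+n 62 1) (≤-trans (≤-trans (*-monoʳ-≤ 63 1≤v) (m≤m+n (63 * v) s)) (≤-reflexive (sym e))))
        k≡1 : k ≡ 1
        k≡1 = ≤-antisym k≤1 (k≢0 k e)

-- From a numerical certificate to primes in (62x/63, x]

module PrimeWindows where

  open import Data.Bool using (Bool; true; _∧_)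
  open import Data.List.Relation.Unary.All.Properties using (++⁺)
  open Sums
  open PrimePowerSums
  open FactorialSums
  open BigDigits
  open NoiseCheck

  n<2^n : ∀ n → n < 2 ^ n
  n<2^n zero = s≤s z≤n
  n<2^n (suc n) = begin-strict
    suc n ≡⟨ +-comm 1 n ⟩
    n + 1 <⟨ +-mono-<-≤ (n<2^n n) (m^n>0 2 n) ⟩
    2 ^ n + 2 ^ n ≡⟨ cong (2 ^ n +_) (+-identityʳ (2 ^ n)) ⟨
    2 ^ suc n ∎
    where open ≤-Reasoning

  -- With t = ⌊h/(k + 1)⌋ one has 2^h ≥ (2^t)^(k+1) ≥ (t + 1)^(k+1): one factor t + 1 more than h^k
  -- needs, and it absorbs the constant.
  poly<exp : ∀ k C → ∃[ H ] (∀ h → H ≤ h → C * h ^ k < 2 ^ h)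
  poly<exp k C = suc k * c , λ h H≤h →
    let t = h / suc k in begin-strict
      C * h ^ k ≤⟨ *-monoʳ-≤ C (^-monoˡ-≤ k (h≤ h)) ⟩
      C * (suc k * suc t) ^ k ≡⟨ cong (C *_) (^-distrib-* (suc k) (suc t) k) ⟩
      C * (suc k ^ k * suc t ^ k) ≡⟨ *-assoc C (suc k ^ k) (suc t ^ k) ⟨
      c * suc t ^ k <⟨ *-monoˡ-< (suc t ^ k) {{m^n≢0 (suc t) k}} (s≤s (≤-/ c (suc k) h (≤-trans (≤-reflexive (*-comm c (suc k))) H≤h))) ⟩
      suc t * suc t ^ k ≤⟨ ^-monoˡ-≤ (suc k) (n<2^n t) ⟩
      (2 ^ t) ^ suc k ≡⟨ ^-*-assoc 2 t (suc k) ⟩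
      2 ^ (t * suc k) ≤⟨ ^-monoʳ-≤ 2 (m/n*n≤m h (suc k)) ⟩
      2 ^ h ∎
    where
    open ≤-Reasoning
    c = C * suc k ^ k
    h≤ : ∀ h → h ≤ suc k * suc (h / suc k)
    h≤ h = begin
      h ≡⟨ m≡m%n+[m/n]*n h (suc k) ⟩
      h % suc k + h / suc k * suc k ≤⟨ +-monoˡ-≤ _ (m%n≤n h (suc k)) ⟩
      suc (h / suc k) * suc k ≡⟨ *-comm (suc (h / suc k)) (suc k) ⟩
      suc k * suc (h / suc k) ∎

  -- Integer parts a_d of 2^i log₂ d, d = m + 1, m + 2, …, given by their differences; pw = 2^a.
  logs-ok : ℕ → ℕ → ℕ → List ℕ → Bool
  logs-ok i m pw [] = true
  logs-ok i m pw (g ∷ gs) = let pw′ = pw * 2 ^ g ; N = square-iter i (suc m) in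
    (pw′ ≤ᵇ N) ∧ ((suc N ≤ᵇ 2 * pw′) ∧ logs-ok i (suc m) pw′ gs)

  log-dot : ℕ → List ℕ → List ℕ → ℕ
  log-dot a [] gs = 0
  log-dot a (v ∷ vs) [] = 0
  log-dot a (v ∷ vs) (g ∷ gs) = v * (a + g) + log-dot (a + g) vs gs

  -- An upper bound for scale · Σ e/U.
  recip : ℕ → List (ℕ × ℕ) → ℕ
  recip sc [] = 0
  recip sc ((U , e) ∷ us) = e * suc (sc ÷ U) + recip sc us

  jump-sum : List (ℕ × ℕ) → ℕ
  jump-sum [] = 0
  jump-sum ((U , e) ∷ us) = e + jump-sum us

  jumps-nonZero : ∀ k segs → .{{NonZero k}} → All (NonZero ∘ proj₁) (jumps k segs)
  jumps-nonZero k [] = []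
  jumps-nonZero (suc k) ((l , e) ∷ segs) = _ ∷ jumps-nonZero (suc (k + l)) segs

  module Logs (i X K β : ℕ) (X<2^β : X < 2 ^ β) where
    open PrimeSums X K β X<2^β
    open Certificate X K β X<2^β

    private
      b : ℕ
      b = 2 ^ i

      scaled : ∀ a k → (2 ^ a) ^ k ≡ 2 ^ (a * k)
      scaled a k = ^-*-assoc 2 a k

      pow-swap : ∀ d → (d ^ K) ^ b ≡ (d ^ b) ^ K
      pow-swap d = trans (^-*-assoc d K b) (trans (cong (d ^_) (*-comm K b)) (sym (^-*-assoc d b K)))

    -- The hypothesis states a ≤ 2^i log₂ d, while `ell d` is K log₂ d up to rounding. Raising to
    -- the powers K and 2^i in either order compares them without a real logarithm.
    ell-above : ∀ d a .{{_ : NonZero d}} → d ≤ X → 2 ^ a ≤ d ^ b → K * a ≤ b * (ell d + suc β)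
    ell-above d a d≤X h = ≤-trans (≤-reflexive (*-comm K a)) (≤-trans (2^-cancel-≤ {a * K} {b * suc (lam d)} (begin-strict
        2 ^ (a * K) ≡⟨ scaled a K ⟨
        (2 ^ a) ^ K ≤⟨ ^-monoˡ-≤ K h ⟩
        (d ^ b) ^ K ≡⟨ pow-swap d ⟨
        (d ^ K) ^ b ≤⟨ ^-monoˡ-≤ b (<⇒≤ (lam-upper d)) ⟩
        (2 ^ suc (lam d)) ^ b ≡⟨ trans (scaled (suc (lam d)) b) (cong (2 ^_) (*-comm (suc (lam d)) b)) ⟩
        2 ^ (b * suc (lam d)) <⟨ ^-monoʳ-< 2 ≤-refl (n<1+n (b * suc (lam d))) ⟩
        2 ^ suc (b * suc (lam d)) ∎))
      (*-monoʳ-≤ b (≤-trans (s≤s (lam≤ell+β d d≤X)) (≤-reflexive (sym (+-suc (ell d) β))))))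
      where open ≤-Reasoning

    ell-below : ∀ d a .{{_ : NonZero d}} → d ≤ X → d ^ b < 2 ^ suc a → b * ell d ≤ K * suc a
    ell-below d a d≤X h = ≤-trans (*-monoʳ-≤ b (ell≤lam d d≤X)) (≤-trans (2^-cancel-≤ {b * lam d} {suc a * K} (begin-strict
        2 ^ (b * lam d) ≡⟨ trans (cong (2 ^_) (*-comm b (lam d))) (sym (scaled (lam d) b)) ⟩
        (2 ^ lam d) ^ b ≤⟨ ^-monoˡ-≤ b (lam-lower d) ⟩
        (d ^ K) ^ b ≡⟨ pow-swap d ⟩
        (d ^ b) ^ K ≤⟨ ^-monoˡ-≤ K (<⇒≤ h) ⟩
        (2 ^ suc a) ^ K ≡⟨ scaled (suc a) K ⟩
        2 ^ (suc a * K) <⟨ ^-monoʳ-< 2 ≤-refl (n<1+n (suc a * K)) ⟩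
        2 ^ suc (suc a * K) ∎))
      (≤-reflexive (*-comm (suc a) K)))
      where open ≤-Reasoning

    private
      N≡ : ∀ d → square-iter i d ≡ d ^ b
      N≡ d = square-iter-spec i d

      module Step {m a g : ℕ} {gs : List ℕ} (ok : logs-ok i m (2 ^ a) (g ∷ gs) ≡ true) where
        pw≡ : 2 ^ a * 2 ^ g ≡ 2 ^ (a + g)
        pw≡ = sym (^-distribˡ-+-* 2 a g)
        above : 2 ^ (a + g) ≤ suc m ^ b
        above = subst₂ _≤_ pw≡ (N≡ (suc m)) (≤ᵇ-sound (proj₁ (∧-true ok)))
        rest : ((suc (square-iter i (suc m)) ≤ᵇ 2 * (2 ^ a * 2 ^ g)) ∧ logs-ok i (suc m) (2 ^ a * 2 ^ g) gs) ≡ true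
        rest = proj₂ (∧-true {2 ^ a * 2 ^ g ≤ᵇ square-iter i (suc m)} ok)
        below : suc m ^ b < 2 ^ suc (a + g)
        below = subst₂ _<_ (N≡ (suc m)) (cong (2 *_) pw≡) (≤ᵇ-sound (proj₁ (∧-true rest)))
        next : logs-ok i (suc m) (2 ^ (a + g)) gs ≡ true
        next = subst (λ t → logs-ok i (suc m) t gs ≡ true) pw≡ (proj₂ (∧-true {suc (square-iter i (suc m)) ≤ᵇ 2 * (2 ^ a * 2 ^ g)} rest))

    dot-above : ∀ m a vs gs → m + length vs ≤ X → logs-ok i m (2 ^ a) gs ≡ true →
      K * log-dot a vs gs ≤ b * (dot ell m vs + dot (const 1) m vs * suc β)
    dot-above m a [] gs _ _ = ≤-trans (≤-reflexive (*-zeroʳ K)) z≤n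
    dot-above m a (v ∷ vs) [] _ _ = ≤-trans (≤-reflexive (*-zeroʳ K)) z≤n
    dot-above m a (v ∷ vs) (g ∷ gs) D≤X ok = begin
      K * (v * (a + g) + log-dot (a + g) vs gs) ≡⟨ lem₁ K v (a + g) (log-dot (a + g) vs gs) ⟩
      v * (K * (a + g)) + K * log-dot (a + g) vs gs
        ≤⟨ +-mono-≤ (*-monoʳ-≤ v (ell-above (suc m) (a + g) (≤-trans (m≤m+n (suc m) (length vs)) D≤X′) above)) (dot-above (suc m) (a + g) vs gs D≤X′ next) ⟩
      v * (b * (ell (suc m) + suc β)) + b * (dot ell (suc m) vs + dot (const 1) (suc m) vs * suc β)
        ≡⟨ lem₂ v b (ell (suc m)) (suc β) (dot ell (suc m) vs) (dot (const 1) (suc m) vs) ⟩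
      b * (dot ell m (v ∷ vs) + dot (const 1) m (v ∷ vs) * suc β) ∎
      where
      open ≤-Reasoning
      open Step {m} {a} {g} {gs} ok
      D≤X′ : suc m + length vs ≤ X
      D≤X′ = subst (_≤ X) (+-suc m (length vs)) D≤X
      lem₁ : ∀ K v a l → K * (v * a + l) ≡ v * (K * a) + K * l
      lem₁ = solve-∀
      lem₂ : ∀ v c e s f t → v * (c * (e + s)) + c * (f + t * s) ≡ c * (v * e + f + (v * 1 + t) * s)
      lem₂ = solve-∀

    dot-below : ∀ m a vs gs → m + length vs ≤ X → length vs ≡ length gs → logs-ok i m (2 ^ a) gs ≡ true →
      b * dot ell m vs ≤ K * (log-dot a vs gs + dot (const 1) m vs)
    dot-below m a [] [] _ _ _ = ≤-trans (≤-reflexive (*-zeroʳ b)) z≤n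
    dot-below m a (v ∷ vs) (g ∷ gs) D≤X len ok = begin
      b * (v * ell (suc m) + dot ell (suc m) vs) ≡⟨ lem₁ b v (ell (suc m)) (dot ell (suc m) vs) ⟩
      v * (b * ell (suc m)) + b * dot ell (suc m) vs
        ≤⟨ +-mono-≤ (*-monoʳ-≤ v (ell-below (suc m) (a + g) (≤-trans (m≤m+n (suc m) (length vs)) D≤X′) below)) (dot-below (suc m) (a + g) vs gs D≤X′ (suc-injective len) next) ⟩
      v * (K * suc (a + g)) + K * (log-dot (a + g) vs gs + dot (const 1) (suc m) vs)
        ≡⟨ lem₂ v K (a + g) (log-dot (a + g) vs gs) (dot (const 1) (suc m) vs) ⟩
      K * (log-dot a (v ∷ vs) (g ∷ gs) + dot (const 1) m (v ∷ vs)) ∎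
      where
      open ≤-Reasoning
      open Step {m} {a} {g} {gs} ok
      D≤X′ : suc m + length vs ≤ X
      D≤X′ = subst (_≤ X) (+-suc m (length vs)) D≤X
      lem₁ : ∀ c v e f → c * (v * e + f) ≡ v * (c * e) + c * f
      lem₁ = solve-∀
      lem₂ : ∀ v K a l t → v * (K * suc a) + K * (l + t) ≡ K * (v * a + l + (v * 1 + t))
      lem₂ = solve-∀

    -- Each jump contributes e ψ(x/U) ≤ 2 e (x/U) K to leading order; multiplying by `sc` and
    -- rounding `sc`/U up replaces the fractions 1/U by one integer that can be evaluated.
    recip-bound : ∀ sc us x → All (NonZero ∘ proj₁) us → 2 ≤ X → x ≤ X →
      sc * stepsψ us x ≤ 2 * (x * recip sc us) * (K + β) + sc * (jump-sum us * (β * (2 * (β * K))))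
    recip-bound sc [] x [] _ _ = ≤-trans (≤-reflexive (*-zeroʳ sc)) z≤n
    recip-bound sc ((U@(suc _) , e) ∷ us) x (_ ∷ nz) 2≤X x≤X = begin
      sc * (e * psi (x / U) + stepsψ us x)
        ≤⟨ *-monoʳ-≤ sc (+-monoˡ-≤ (stepsψ us x) (*-monoʳ-≤ e (psi-upper (x / U) 2≤X (≤-trans (m/n≤m x U) x≤X)))) ⟩
      sc * (e * (2 * (x / U) * (K + β) + β * (2 * (β * K))) + stepsψ us x)
        ≡⟨ lem₁ sc e (x / U) (K + β) (β * (2 * (β * K))) (stepsψ us x) ⟩
      2 * (e * ((x / U) * sc)) * (K + β) + sc * (e * (β * (2 * (β * K)))) + sc * stepsψ us x
        ≤⟨ +-mono-≤ (+-monoˡ-≤ _ (*-monoˡ-≤ (K + β) (*-monoʳ-≤ 2 (*-monoʳ-≤ e q≤)))) (recip-bound sc us x nz 2≤X x≤X) ⟩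
      2 * (e * (x * suc (sc / U))) * (K + β) + sc * (e * (β * (2 * (β * K)))) + (2 * (x * recip sc us) * (K + β) + sc * (jump-sum us * (β * (2 * (β * K)))))
        ≡⟨ lem₂ e x (suc (sc / U)) (K + β) sc (β * (2 * (β * K))) (recip sc us) (jump-sum us) ⟩
      2 * (x * recip sc ((U , e) ∷ us)) * (K + β) + sc * (jump-sum ((U , e) ∷ us) * (β * (2 * (β * K)))) ∎
      where
      open ≤-Reasoning
      lem₁ : ∀ s e q k c t → s * (e * (2 * q * k + c) + t) ≡ 2 * (e * (q * s)) * k + s * (e * c) + s * t
      lem₁ = solve-∀
      lem₂ : ∀ e x q k s c r j → 2 * (e * (x * q)) * k + s * (e * c) + (2 * (x * r) * k + s * (j * c)) ≡ 2 * (x * (e * q + r)) * k + s * ((e + j) * c)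
      lem₂ = solve-∀
      sc≤ : sc ≤ U * suc (sc / U)
      sc≤ = begin
        sc ≡⟨ m≡m%n+[m/n]*n sc U ⟩
        sc % U + sc / U * U ≤⟨ +-monoˡ-≤ _ (m%n≤n sc U) ⟩
        U + sc / U * U ≡⟨ *-comm (suc (sc / U)) U ⟩
        U * suc (sc / U) ∎
      q≤ : x / U * sc ≤ x * suc (sc / U)
      q≤ = begin
        x / U * sc ≤⟨ *-monoʳ-≤ (x / U) sc≤ ⟩
        x / U * (U * suc (sc / U)) ≡⟨ *-assoc (x / U) U _ ⟨
        x / U * U * suc (sc / U) ≤⟨ *-monoˡ-≤ (suc (sc / U)) (m/n*n≤m x U) ⟩
        x * suc (sc / U) ∎

  Φ-0 : ∀ vs → Φ vs 0 ≡ 0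
  Φ-0 vs = n≤0⇒n≡0 (≤-trans (m≤m+n (Φ vs 0) (R vs 0)) (≤-reflexive (Φ+R vs 0)))

  -- y = ⌊62x/63⌋ and x scaled down by n stay in the ratio examined by the noise check.
  module Scaled (x n : ℕ) {{_ : NonZero n}} where
    private
      y = 62 * x / 63
      k = x / n
      v = y / n

      v≤ : 63 * v ≤ 62 * k + 61
      v≤ = ≤-pred (≤-trans (*-cancelʳ-< n (63 * v) (62 * k + 62) (begin-strict
        63 * v * n ≡⟨ *-assoc 63 v n ⟩
        63 * (v * n) ≤⟨ *-monoʳ-≤ 63 (m/n*n≤m y n) ⟩
        63 * y ≡⟨ *-comm 63 y ⟩
        y * 63 ≤⟨ m/n*n≤m (62 * x) 63 ⟩
        62 * x ≡⟨ cong (62 *_) (m≡m%n+[m/n]*n x n) ⟩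
        62 * (x % n + k * n) <⟨ *-monoʳ-< 62 (+-monoˡ-< (k * n) (m%n<n x n)) ⟩
        62 * (n + k * n) ≡⟨ lem n k ⟩
        (62 * k + 62) * n ∎)) (≤-reflexive (+-suc (62 * k) 61)))
        where
        open ≤-Reasoning
        lem : ∀ n k → 62 * (n + k * n) ≡ (62 * k + 62) * n
        lem = solve-∀

      x<y : 62 * x < 63 * suc y
      x<y = begin-strict
        62 * x ≡⟨ m≡m%n+[m/n]*n (62 * x) 63 ⟩
        62 * x % 63 + y * 63 <⟨ +-monoˡ-< (y * 63) (m%n<n (62 * x) 63) ⟩
        63 + y * 63 ≡⟨ *-comm (suc y) 63 ⟩
        63 * suc y ∎
        where open ≤-Reasoning

      y<v : suc y ≤ suc v * n
      y<v = ≤-trans (≤-reflexive (cong suc (m≡m%n+[m/n]*n y n))) (+-monoˡ-≤ (v * n) (m%n<n y n))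

    k< : 62 * k < 63 * suc v
    k< = *-cancelʳ-< n (62 * k) (63 * suc v) (begin-strict
        62 * k * n ≡⟨ *-assoc 62 k n ⟩
        62 * (k * n) ≤⟨ *-monoʳ-≤ 62 (m/n*n≤m x n) ⟩
        62 * x <⟨ x<y ⟩
        63 * suc y ≤⟨ *-monoʳ-≤ 63 y<v ⟩
        63 * (suc v * n) ≡⟨ *-assoc 63 (suc v) n ⟨
        63 * suc v * n ∎)
      where open ≤-Reasoning

    near : ∃[ s ] s < 63 × ((62 * k ≡ 63 * v + s) ⊎ (62 * k + 61 ≡ 63 * v + s))
    near with 63 * v ≤? 62 * k
    ... | yes p = 62 * k ∸ 63 * v , +-cancelˡ-< (63 * v) _ _ (subst₂ _<_ (sym (m+[n∸m]≡n p)) (trans (*-suc 63 v) (+-comm 63 _)) k<) , inj₁ (sym (m+[n∸m]≡n p))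
    ... | no ¬p = 62 * k + 61 ∸ 63 * v , +-cancelˡ-< (63 * v) _ _ (subst (_< 63 * v + 63) (sym (m+[n∸m]≡n v≤)) (+-mono-< (≰⇒> ¬p) (m≤m+n 62 1)))
               , inj₂ (sym (m+[n∸m]≡n v≤))

  module Window (B : ℕ) {{_ : NonZero B}} (h i sc : ℕ) (ps ns gs : List ℕ) (segs : List (ℕ × ℕ)) where
    open Noise B h

    us : List (ℕ × ℕ)
    us = bounds ps ns segs

    module _ (D≤B : length ps ≤ B) (len≡ : length ps ≡ length ns) (lenᵍ : length ps ≡ length gs) (s≡ : total ps ≡ total ns)
             (sp : spread ps < B) (sn : spread ns < B) (ok : check ps ns segs ≡ true) (logs : logs-ok i 0 1 gs ≡ true)
             -- Divided by sc · 2^i, this compares 63 · 2 Σ e/U with Σ (ns_d - ps_d) log₂ d: the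
             -- noise is at most 2x Σ e/U, and the window has length at least x/63. The term
             -- `total ps` covers rounding up the logarithms belonging to `ps`.
             (gap : 126 * 2 ^ i * recip sc us + sc * (log-dot 0 ps gs + total ps) < sc * log-dot 0 ns gs) where

      us≢0 : All (NonZero ∘ proj₁) us
      us≢0 = ++⁺ (jumps-nonZero 2 segs) (m^n≢0 2 h ∷ [])

      module Contra (x β r : ℕ) (2≤x : 2 ≤ x) (D≤x : length ps ≤ x) (x<2^β : x < 2 ^ β) (x<r² : x < r * r)
                    (noP : ∀ p → Prime p → ¬ (62 * x / 63 < p × p ≤ x)) where
        -- The scale K equals x as well. Main terms then have order x², while a rounding error of β
        -- at each of x integers adds up to only x β.
        open PrimeSums x x β x<2^β
        open Certificate x x β x<2^β
        open Logs i x x β x<2^β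

        b y w s D δ : ℕ
        b = 2 ^ i
        y = 62 * x / 63
        w = Φ ps 1
        s = total ps
        D = length ps
        δ = x ∸ y

        P : ℕ → Set
        P n = y < n × n ≤ x

        P? : ∀ n → Dec (P n)
        P? n = (y <? n) ×-dec (n ≤? x)
          where open import Relation.Nullary.Decidable using (_×-dec_)

        63y≤62x : 63 * y ≤ 62 * x
        63y≤62x = ≤-trans (≤-reflexive (*-comm 63 y)) (m/n*n≤m (62 * x) 63)

        y≤x : y ≤ x
        y≤x = *-cancelˡ-≤ 63 (≤-trans 63y≤62x (*-monoˡ-≤ x (m≤m+n 62 1)))

        x≡ : y + δ ≡ x
        x≡ = m+[n∸m]≡n y≤x

        x≤63δ : x ≤ 63 * δ
        x≤63δ = +-cancelˡ-≤ (62 * x) _ _ (begin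
          62 * x + x ≡⟨ +-comm (62 * x) x ⟩
          63 * x ≡⟨ cong (63 *_) x≡ ⟨
          63 * (y + δ) ≡⟨ *-distribˡ-+ 63 y δ ⟩
          63 * y + 63 * δ ≤⟨ +-monoˡ-≤ (63 * δ) 63y≤62x ⟩
          62 * x + 63 * δ ∎)
          where open ≤-Reasoning

        pointwise : ∀ n .{{_ : NonZero n}} → Φ ps (x ÷ n) + Φ ns (y ÷ n) ≤ Φ ns (x ÷ n) + Φ ps (y ÷ n) + (steps us (x ÷ n) + w * ⟦ P? n ⟧)
        pointwise n@(suc _) with near | y / n in v≡ | x / n in k≡
          where open Scaled x n
        ... | e | suc v | k = let (s , s<63 , e) = subst₂ (λ a b → ∃[ s ] s < 63 × ((62 * a ≡ 63 * b + s) ⊎ (62 * a + 61 ≡ 63 * b + s))) k≡ v≡ e in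
          ≤-trans (noise ps ns segs D≤B len≡ s≡ sp sn ok k (suc v) s (s≤s z≤n) s<63 e)
            (+-monoʳ-≤ (Φ ns k + Φ ps (suc v)) (m≤m+n _ _))
        ... | _ | zero | zero = ≤-trans (≤-reflexive (trans (cong₂ _+_ (Φ-0 ps) (Φ-0 ns)) refl)) z≤n
        ... | _ | zero | suc (suc k) = ⊥-elim (<⇒≱ (subst₂ (λ a b → 62 * a < 63 * suc b) k≡ v≡ (Scaled.k< x n))
                (≤-trans (m≤m+n 63 61) (*-monoʳ-≤ 62 (s≤s (s≤s (z≤n {k}))))))
        -- Here n lies in the window y < n ≤ x. Its weight w = Φ ps 1 is the coefficient of d = 1,
        -- as ⌊1/d⌋ = 0 for d ≥ 2.
        ... | _ | zero | suc zero = begin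
          Φ ps 1 + Φ ns 0 ≡⟨ cong (Φ ps 1 +_) (Φ-0 ns) ⟩
          w + 0 ≡⟨ +-identityʳ w ⟩
          w ≡⟨ *-identityʳ w ⟨
          w * 1 ≡⟨ cong (w *_) (⟦⟧-yes (P? n) (m/n≡0⇒m<n v≡ , n≤x)) ⟨
          w * ⟦ P? n ⟧ ≤⟨ m≤n+m _ (steps us 1) ⟩
          steps us 1 + w * ⟦ P? n ⟧ ≤⟨ m≤n+m _ (Φ ns 1 + Φ ps 0) ⟩
          Φ ns 1 + Φ ps 0 + (steps us 1 + w * ⟦ P? n ⟧) ∎
          where
          open ≤-Reasoning
          n≤x : n ≤ x
          n≤x = ≤-trans (≤-reflexive (sym (*-identityˡ n))) (≤-trans (*-monoˡ-≤ n (≤-reflexive (sym k≡))) (m/n*n≤m x n))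

        E₁ E : ℕ
        E₁ = stepsψ us x + w * (r * (β * x * β))
        E = E₁ + 2 * s * (err D x + err D x)

        small-noise : S (λ n → steps us (x ÷ n) + w * ⟦ P? n ⟧) ≤ E₁
        small-noise = ≤-trans (≤-reflexive (S-+ (λ n → steps us (x ÷ n)) (λ n → w * ⟦ P? n ⟧)))
          (+-mono-≤ (S-steps us x us≢0) (S-window w r P P? x<r² (λ n → proj₂) (λ p pp → noP p pp)))

        main : δ * L ns ≤ δ * L ps + E
        main = +-cancelˡ-≤ (y * L ns + y * L ps) _ _ (begin
          y * L ns + y * L ps + δ * L ns ≡⟨ lem₁ y δ (L ns) (L ps) ⟩
          (y + δ) * L ns + y * L ps ≡⟨ cong (λ t → t * L ns + y * L ps) x≡ ⟩
          x * L ns + y * L ps ≤⟨ comparison ps ns x y (λ n → steps us (x ÷ n) + w * ⟦ P? n ⟧) ≤-refl y≤x s≡ len≡ D≤x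
                                   (λ p j pp _ → pointwise (p ^ suc j) {{m^n≢0 p (suc j) {{prime⇒nonZero pp}}}}) ⟩
          x * L ps + y * L ns + (S (λ n → steps us (x ÷ n) + w * ⟦ P? n ⟧) + 2 * s * (err D x + err D y))
            ≤⟨ +-monoʳ-≤ (x * L ps + y * L ns) (+-mono-≤ small-noise (*-monoʳ-≤ (2 * s) (+-monoʳ-≤ (err D x) (+-monoˡ-≤ _ (*-monoˡ-≤ β y≤x))))) ⟩
          x * L ps + y * L ns + E ≡⟨ cong (λ t → t * L ps + y * L ns + E) x≡ ⟨
          (y + δ) * L ps + y * L ns + E ≡⟨ lem₂ y δ (L ns) (L ps) E ⟩
          y * L ns + y * L ps + (δ * L ps + E) ∎)
          where
          open ≤-Reasoning
          lem₁ : ∀ y d a b → y * a + y * b + d * a ≡ (y + d) * a + y * b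
          lem₁ = solve-∀
          lem₂ : ∀ y d a b e → (y + d) * b + y * a + e ≡ y * a + y * b + (d * b + e)
          lem₂ = solve-∀

        A C : ℕ
        A = log-dot 0 ns gs
        C = log-dot 0 ps gs + s

        scaled : δ * (x * A) ≤ δ * (x * C) + b * (E + δ * (s * suc β))
        scaled = begin
          δ * (x * A) ≤⟨ *-monoʳ-≤ δ (dot-above 0 0 ns gs (subst (_≤ x) len≡ D≤x) logs) ⟩
          δ * (b * (L ns + total ns * suc β)) ≡⟨ cong (λ t → δ * (b * (L ns + t * suc β))) s≡ ⟨
          δ * (b * (L ns + s * suc β)) ≡⟨ lem₁ δ b (L ns) (s * suc β) ⟩
          b * (δ * L ns + δ * (s * suc β)) ≤⟨ *-monoʳ-≤ b (+-monoˡ-≤ (δ * (s * suc β)) main) ⟩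
          b * (δ * L ps + E + δ * (s * suc β)) ≡⟨ lem₂ δ b (L ps) E (δ * (s * suc β)) ⟩
          δ * (b * L ps) + b * (E + δ * (s * suc β)) ≤⟨ +-monoˡ-≤ _ (*-monoʳ-≤ δ (dot-below 0 0 ps gs D≤x lenᵍ logs)) ⟩
          δ * (x * C) + b * (E + δ * (s * suc β)) ∎
          where
          open ≤-Reasoning
          lem₁ : ∀ d b l t → d * (b * (l + t)) ≡ b * (d * l + d * t)
          lem₁ = solve-∀
          lem₂ : ∀ d b l e t → b * (d * l + e + t) ≡ d * (b * l) + b * (e + t)
          lem₂ = solve-∀

        Js : ℕ
        Js = jump-sum us

        E₂ : ℕ
        E₂ = w * (r * (β * x * β)) + 2 * s * (err D x + err D x) + δ * (s * suc β)

        γ : ℕ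
        γ = sc * A ∸ (126 * b * recip sc us + sc * C)

        sA : 126 * b * recip sc us + sc * C + γ ≡ sc * A
        sA = m+[n∸m]≡n (<⇒≤ gap)

        1≤γ : 1 ≤ γ
        1≤γ = m<n⇒0<n∸m gap

        rec Q W : ℕ
        rec = recip sc us
        Q = 126 * b * rec
        W = Js * (β * (2 * (β * x)))

        scaled′ : δ * x * (Q + γ) ≤ b * (2 * (x * rec) * (x + β) + sc * W + sc * E₂)
        scaled′ = +-cancelˡ-≤ (sc * (δ * (x * C))) _ _ (begin
          sc * (δ * (x * C)) + δ * x * (Q + γ) ≡⟨ lem₁ sc δ x C Q γ ⟩
          δ * x * (Q + sc * C + γ) ≡⟨ cong (δ * x *_) sA ⟩
          δ * x * (sc * A) ≡⟨ lem₂ δ x sc A ⟩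
          sc * (δ * (x * A)) ≤⟨ *-monoʳ-≤ sc scaled ⟩
          sc * (δ * (x * C) + b * (E + δ * (s * suc β)))
            ≡⟨ lem₃ sc (δ * (x * C)) b (stepsψ us x) (w * (r * (β * x * β))) (2 * s * (err D x + err D x)) (δ * (s * suc β)) ⟩
          sc * (δ * (x * C)) + b * (sc * stepsψ us x + sc * E₂)
            ≤⟨ +-monoʳ-≤ (sc * (δ * (x * C))) (*-monoʳ-≤ b (+-monoˡ-≤ (sc * E₂) (recip-bound sc us x us≢0 2≤x ≤-refl))) ⟩
          sc * (δ * (x * C)) + b * (2 * (x * rec) * (x + β) + sc * W + sc * E₂) ∎)
          where
          open ≤-Reasoning
          lem₁ : ∀ s d x c q g → s * (d * (x * c)) + d * x * (q + g) ≡ d * x * (q + s * c + g)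
          lem₁ = solve-∀
          lem₂ : ∀ d x s a → d * x * (s * a) ≡ s * (d * (x * a))
          lem₂ = solve-∀
          lem₃ : ∀ s c b p u v t → s * (c + b * (p + u + v + t)) ≡ s * c + b * (s * p + s * (u + v + t))
          lem₃ = solve-∀

        -- Multiplying by 63 and using x ≤ 63 δ turns the left side into at least x² (Q + 1). The
        -- leading part of the noise bound is exactly x² Q, because Q contains 126 = 2 · 63; it
        -- cancels, and only lower-order terms are left against x².
        final : x * x ≤ 63 * b * (2 * (x * rec) * β + sc * W + sc * E₂)
        final = +-cancelˡ-≤ (x * x * Q) _ _ (begin
          x * x * Q + x * x ≡⟨ lem₁ x Q ⟩
          x * x * (Q + 1) ≤⟨ *-mono-≤ (*-monoˡ-≤ x x≤63δ) (+-monoʳ-≤ Q 1≤γ) ⟩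
          63 * δ * x * (Q + γ) ≡⟨ cong (_* (Q + γ)) (*-assoc 63 δ x) ⟩
          63 * (δ * x) * (Q + γ) ≡⟨ *-assoc 63 (δ * x) (Q + γ) ⟩
          63 * (δ * x * (Q + γ)) ≤⟨ *-monoʳ-≤ 63 scaled′ ⟩
          63 * (b * (2 * (x * rec) * (x + β) + sc * W + sc * E₂)) ≡⟨ lem₂ 63 b x rec β (sc * W) (sc * E₂) ⟩
          x * x * (2 * 63 * b * rec) + 63 * b * (2 * (x * rec) * β + sc * W + sc * E₂) ∎)
          where
          open ≤-Reasoning
          lem₁ : ∀ x q → x * x * q + x * x ≡ x * x * (q + 1)
          lem₁ = solve-∀
          lem₂ : ∀ k b x c β u v → k * (b * (2 * (x * c) * (x + β) + u + v)) ≡ x * x * (2 * k * b * c) + k * b * (2 * (x * c) * β + u + v)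
          lem₂ = solve-∀

        constant : ℕ
        constant = 63 * b * (2 * rec + 2 * sc * Js + sc * (w + 4 * s * (1 + 3 * D) + 2 * s))

        bound : 1 ≤ β → x ≤ constant * (r * (β * β))
        bound 1≤β = *-cancelˡ-≤ x {{>-nonZero (≤-trans (s≤s z≤n) 2≤x)}} (begin
          x * x ≤⟨ final ⟩
          63 * b * (2 * (x * rec) * β + sc * W + sc * E₂)
            ≤⟨ *-monoʳ-≤ (63 * b) (+-mono-≤ (+-mono-≤ (*-monoʳ-≤ (2 * (x * rec)) β≤) (*-monoʳ-≤ sc W≤)) (*-monoʳ-≤ sc E₂≤)) ⟩
          63 * b * (2 * (x * rec) * m + sc * (2 * Js * x * m) + sc * ((w + 4 * s * (1 + 3 * D) + 2 * s) * x * m))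
            ≡⟨ lem (63 * b) x rec m sc Js (w + 4 * s * (1 + 3 * D) + 2 * s) ⟩
          x * (constant * m) ∎)
          where
          open ≤-Reasoning
          instance _ = >-nonZero 1≤β
          m : ℕ
          m = r * (β * β)
          1≤r : 1 ≤ r
          1≤r = ≮⇒≥ λ r<1 → <⇒≱ x<r² (≤-trans (*-mono-≤ (≤-pred r<1) (≤-pred r<1)) z≤n)
          instance _ = >-nonZero 1≤r
          β²≤ : β * β ≤ m
          β²≤ = m≤n*m (β * β) r
          β≤ : β ≤ m
          β≤ = ≤-trans (m≤m*n β β) β²≤
          1≤m : 1 ≤ m
          1≤m = ≤-trans 1≤β β≤
          W≤ : W ≤ 2 * Js * x * m
          W≤ = ≤-trans (≤-reflexive (lem Js β x)) (*-monoʳ-≤ (2 * Js * x) β²≤)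
            where lem : ∀ J b x → J * (b * (2 * (b * x))) ≡ 2 * J * x * (b * b)
                  lem = solve-∀
          E₂≤ : E₂ ≤ (w + 4 * s * (1 + 3 * D) + 2 * s) * x * m
          E₂≤ = begin
            w * (r * (β * x * β)) + 2 * s * (err D x + err D x) + δ * (s * suc β)
              ≤⟨ +-mono-≤ (≤-reflexive (cong (_+ 2 * s * (err D x + err D x)) (lem₁ w r β x))) (*-mono-≤ (m∸n≤m x y) (*-monoʳ-≤ s (+-mono-≤ 1≤m β≤))) ⟩
            w * x * m + 2 * s * (err D x + err D x) + x * (s * (m + m)) ≡⟨ cong (λ t → w * x * m + t + x * (s * (m + m))) (lem₂ s x β D) ⟩
            w * x * m + 4 * s * (1 + 3 * D) * x * β + x * (s * (m + m)) ≤⟨ +-monoˡ-≤ _ (+-monoʳ-≤ (w * x * m) (*-monoʳ-≤ (4 * s * (1 + 3 * D) * x) β≤)) ⟩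
            w * x * m + 4 * s * (1 + 3 * D) * x * m + x * (s * (m + m)) ≡⟨ lem₃ w x m (4 * s * (1 + 3 * D)) s ⟩
            (w + 4 * s * (1 + 3 * D) + 2 * s) * x * m ∎
            where
            lem₁ : ∀ w r β x → w * (r * (β * x * β)) ≡ w * x * (r * (β * β))
            lem₁ = solve-∀
            lem₂ : ∀ s x β D → 2 * s * ((x * β + 3 * (D * (β * x))) + (x * β + 3 * (D * (β * x)))) ≡ 4 * s * (1 + 3 * D) * x * β
            lem₂ = solve-∀
            lem₃ : ∀ w x m u s → w * x * m + u * x * m + x * (s * (m + m)) ≡ (w + u + 2 * s) * x * m
            lem₃ = solve-∀
          lem : ∀ k x c m t J u → k * (2 * (x * c) * m + t * (2 * J * x * m) + t * (u * x * m)) ≡ x * (k * (2 * c + 2 * t * J + t * u) * m)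
          lem = solve-∀

      prime-in-window : ∃[ N ] ∀ x → N ≤ x → ∃[ p ] Prime p × 62 * x / 63 < p × p ≤ x
      prime-in-window = from-growth (poly<exp 2 (4 * (4 * const′)))
        where
        const′ : ℕ
        const′ = 63 * 2 ^ i * (2 * recip sc us + 2 * sc * jump-sum us + sc * (Φ ps 1 + 4 * total ps * (1 + 3 * length ps) + 2 * total ps))
        from-growth : ∃[ H ] (∀ h → H ≤ h → 4 * (4 * const′) * h ^ 2 < 2 ^ h) → ∃[ N ] ∀ x → N ≤ x → ∃[ p ] Prime p × 62 * x / 63 < p × p ≤ x
        from-growth (H , growth) = 2 ^ (H + H) + (2 + length ps) , search
          where
          search : ∀ x → 2 ^ (H + H) + (2 + length ps) ≤ x → ∃[ p ] Prime p × 62 * x / 63 < p × p ≤ x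
          search x N≤x with anyUpTo? (λ p → prime? p ×-dec (62 * x / 63 <? p)) (suc x)
            where open import Relation.Nullary.Decidable using (_×-dec_)
          ... | yes (p , p≤x , pp , y<p) = p , pp , y<p , ≤-pred p≤x
          ... | no none = ⊥-elim (<⇒≱ too-small (Contra.bound x β (2 ^ t) 2≤x D≤x (lg-upper x) x<r²
                            (λ p pp (y<p , p≤x) → none (p , s≤s p≤x , pp , y<p)) (s≤s z≤n)))
            where
            open ≤-Reasoning
            -- r = 2^t satisfies x < r² ≤ 4x, and β ≤ 2t, so the bound x ≤ constant · r β² obtained
            -- from an empty window would read x = O(√x log² x).
            β t : ℕ
            β = suc (lg x)
            t = suc (lg x / 2)
            2≤x : 2 ≤ x
            2≤x = ≤-trans (m≤m+n 2 (length ps)) (≤-trans (m≤n+m _ (2 ^ (H + H))) N≤x)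
            D≤x : length ps ≤ x
            D≤x = ≤-trans (m≤n+m (length ps) 2) (≤-trans (m≤n+m _ (2 ^ (H + H))) N≤x)
            instance _ = >-nonZero (≤-trans (s≤s z≤n) 2≤x)
            β≤2t : β ≤ t + t
            β≤2t = begin
              suc (lg x) ≡⟨ cong suc (m≡m%n+[m/n]*n (lg x) 2) ⟩
              suc (lg x % 2 + lg x / 2 * 2) ≤⟨ s≤s (+-monoˡ-≤ _ (≤-pred (m%n<n (lg x) 2))) ⟩
              suc (1 + lg x / 2 * 2) ≡⟨ lem (lg x / 2) ⟩
              t + t ∎
              where lem : ∀ q → suc (1 + q * 2) ≡ suc q + suc q
                    lem = solve-∀
            x<r² : x < 2 ^ t * 2 ^ t
            x<r² = <-≤-trans (lg-upper x) (≤-trans (^-monoʳ-≤ 2 β≤2t) (≤-reflexive (^-distribˡ-+-* 2 t t)))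
            H≤t : H ≤ t
            H≤t = ≮⇒≥ λ t<H → <⇒≱ (<-≤-trans x<r² (≤-reflexive (sym (^-distribˡ-+-* 2 t t))))
              (≤-trans (^-monoʳ-≤ 2 (+-mono-≤ (<⇒≤ t<H) (<⇒≤ t<H))) (≤-trans (m≤m+n _ (2 + length ps)) N≤x))
            too-small : const′ * (2 ^ t * (β * β)) < x
            too-small = *-cancelˡ-< 4 _ _ (begin-strict
              4 * (const′ * (2 ^ t * (β * β))) ≤⟨ *-monoʳ-≤ 4 (*-monoʳ-≤ const′ (*-monoʳ-≤ (2 ^ t) (*-mono-≤ β≤2t β≤2t))) ⟩
              4 * (const′ * (2 ^ t * ((t + t) * (t + t)))) ≡⟨ lem const′ (2 ^ t) t ⟩
              2 ^ t * (4 * (4 * const′) * t ^ 2) <⟨ *-monoʳ-< (2 ^ t) {{m^n≢0 2 t}} (growth t H≤t) ⟩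
              2 ^ t * 2 ^ t ≡⟨ ^-distribˡ-+-* 2 t t ⟨
              2 ^ (t + t) ≤⟨ ^-monoʳ-≤ 2 (≤-trans (≤-reflexive (lem′ (lg x / 2))) (s≤s (s≤s (m/n*n≤m (lg x) 2)))) ⟩
              2 ^ (2 + lg x) ≡⟨ ^-distribˡ-+-* 2 2 (lg x) ⟩
              4 * 2 ^ lg x ≤⟨ *-monoʳ-≤ 4 (lg-lower x) ⟩
              4 * x ∎)
              where
              lem : ∀ c p t → 4 * (c * (p * ((t + t) * (t + t)))) ≡ p * (4 * (4 * c) * (t * (t * 1)))
              lem = solve-∀
              lem′ : ∀ q → suc q + suc q ≡ suc (suc (q * 2))
              lem′ = solve-∀

-- The numerical certificate and its verification

module CertificateData where

  open import Data.Bool using (true; if_then_else_)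
  open PrimePowerSums
  open FactorialSums
  open BigDigits
  open NoiseCheck
  open PrimeWindows

  -- V_d = positive_d − negative_d approximates 20000 μ(d)/d for d ≤ 250; for 250 < d ≤ 1000 the weights d V_d/20000
  -- were found by a numerical minimisation of the resulting noise. The segments record the running maximum of the noise.
  opaque
    positive : List ℕ
    positive =
      20000 ∷ 0 ∷ 0 ∷ 0 ∷ 0 ∷ 3334 ∷ 0 ∷ 0 ∷ 0 ∷ 2000 ∷ 0 ∷ 0 ∷ 0 ∷ 1428 ∷ 1334 ∷ 0 ∷ 0 ∷ 0 ∷ 0 ∷ 0 ∷ 952 ∷ 909 ∷ 0 ∷ 0 ∷
      0 ∷ 769 ∷ 0 ∷ 0 ∷ 0 ∷ 0 ∷ 0 ∷ 0 ∷ 606 ∷ 589 ∷ 571 ∷ 0 ∷ 0 ∷ 526 ∷ 513 ∷ 0 ∷ 0 ∷ 0 ∷ 0 ∷ 0 ∷ 0 ∷ 434 ∷ 0 ∷ 0 ∷ 0 ∷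
      0 ∷ 392 ∷ 0 ∷ 0 ∷ 0 ∷ 363 ∷ 0 ∷ 351 ∷ 345 ∷ 0 ∷ 0 ∷ 0 ∷ 323 ∷ 0 ∷ 0 ∷ 307 ∷ 0 ∷ 0 ∷ 0 ∷ 290 ∷ 0 ∷ 0 ∷ 0 ∷ 0 ∷ 271 ∷
      0 ∷ 0 ∷ 259 ∷ 0 ∷ 0 ∷ 0 ∷ 0 ∷ 244 ∷ 0 ∷ 0 ∷ 235 ∷ 233 ∷ 229 ∷ 0 ∷ 0 ∷ 0 ∷ 219 ∷ 0 ∷ 216 ∷ 212 ∷ 211 ∷ 0 ∷ 0 ∷ 0 ∷
      0 ∷ 0 ∷ 0 ∷ 0 ∷ 0 ∷ 0 ∷ 0 ∷ 189 ∷ 0 ∷ 0 ∷ 0 ∷ 0 ∷ 181 ∷ 0 ∷ 0 ∷ 0 ∷ 174 ∷ 0 ∷ 0 ∷ 169 ∷ 169 ∷ 0 ∷ 0 ∷ 163 ∷ 163 ∷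
      0 ∷ 0 ∷ 0 ∷ 0 ∷ 0 ∷ 155 ∷ 0 ∷ 0 ∷ 0 ∷ 151 ∷ 149 ∷ 0 ∷ 0 ∷ 0 ∷ 0 ∷ 0 ∷ 0 ∷ 142 ∷ 141 ∷ 140 ∷ 0 ∷ 137 ∷ 137 ∷ 0 ∷ 0 ∷
      0 ∷ 0 ∷ 0 ∷ 0 ∷ 0 ∷ 0 ∷ 129 ∷ 0 ∷ 0 ∷ 126 ∷ 126 ∷ 0 ∷ 124 ∷ 0 ∷ 0 ∷ 0 ∷ 0 ∷ 121 ∷ 0 ∷ 0 ∷ 0 ∷ 0 ∷ 0 ∷ 0 ∷ 0 ∷ 0 ∷
      0 ∷ 0 ∷ 113 ∷ 112 ∷ 0 ∷ 0 ∷ 0 ∷ 0 ∷ 109 ∷ 0 ∷ 108 ∷ 0 ∷ 107 ∷ 0 ∷ 0 ∷ 0 ∷ 0 ∷ 0 ∷ 0 ∷ 103 ∷ 0 ∷ 0 ∷ 0 ∷ 0 ∷ 0 ∷ 0 ∷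
      99 ∷ 99 ∷ 99 ∷ 0 ∷ 97 ∷ 97 ∷ 0 ∷ 0 ∷ 96 ∷ 95 ∷ 0 ∷ 0 ∷ 93 ∷ 94 ∷ 93 ∷ 0 ∷ 92 ∷ 92 ∷ 91 ∷ 0 ∷ 91 ∷ 0 ∷ 0 ∷ 0 ∷ 0 ∷
      88 ∷ 0 ∷ 0 ∷ 0 ∷ 0 ∷ 0 ∷ 0 ∷ 0 ∷ 0 ∷ 85 ∷ 0 ∷ 84 ∷ 0 ∷ 0 ∷ 0 ∷ 0 ∷ 0 ∷ 0 ∷ 0 ∷ 0 ∷ 0 ∷ 81 ∷ 0 ∷ 80 ∷ 0 ∷ 0 ∷ 0 ∷
      79 ∷ 78 ∷ 0 ∷ 0 ∷ 0 ∷ 0 ∷ 16 ∷ 0 ∷ 0 ∷ 55 ∷ 0 ∷ 24 ∷ 70 ∷ 0 ∷ 75 ∷ 0 ∷ 0 ∷ 0 ∷ 0 ∷ 0 ∷ 0 ∷ 28 ∷ 0 ∷ 0 ∷ 0 ∷ 44 ∷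
      0 ∷ 0 ∷ 0 ∷ 0 ∷ 0 ∷ 0 ∷ 0 ∷ 0 ∷ 17 ∷ 0 ∷ 5 ∷ 0 ∷ 68 ∷ 0 ∷ 0 ∷ 5 ∷ 76 ∷ 0 ∷ 0 ∷ 32 ∷ 11 ∷ 0 ∷ 41 ∷ 7 ∷ 49 ∷ 22 ∷
      41 ∷ 0 ∷ 0 ∷ 0 ∷ 65 ∷ 0 ∷ 0 ∷ 0 ∷ 0 ∷ 63 ∷ 0 ∷ 0 ∷ 0 ∷ 0 ∷ 62 ∷ 0 ∷ 28 ∷ 0 ∷ 0 ∷ 0 ∷ 25 ∷ 68 ∷ 62 ∷ 0 ∷ 33 ∷ 52 ∷
      0 ∷ 6 ∷ 0 ∷ 33 ∷ 33 ∷ 8 ∷ 0 ∷ 13 ∷ 43 ∷ 0 ∷ 0 ∷ 0 ∷ 0 ∷ 0 ∷ 0 ∷ 58 ∷ 0 ∷ 0 ∷ 0 ∷ 0 ∷ 0 ∷ 0 ∷ 0 ∷ 0 ∷ 56 ∷ 0 ∷ 0 ∷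
      56 ∷ 0 ∷ 0 ∷ 0 ∷ 55 ∷ 0 ∷ 0 ∷ 38 ∷ 0 ∷ 0 ∷ 0 ∷ 0 ∷ 0 ∷ 38 ∷ 0 ∷ 0 ∷ 0 ∷ 0 ∷ 0 ∷ 47 ∷ 0 ∷ 0 ∷ 0 ∷ 32 ∷ 47 ∷ 0 ∷ 0 ∷
      0 ∷ 41 ∷ 0 ∷ 0 ∷ 0 ∷ 58 ∷ 17 ∷ 0 ∷ 50 ∷ 44 ∷ 38 ∷ 0 ∷ 0 ∷ 11 ∷ 0 ∷ 0 ∷ 0 ∷ 0 ∷ 47 ∷ 0 ∷ 0 ∷ 0 ∷ 12 ∷ 23 ∷ 0 ∷ 0 ∷
      48 ∷ 0 ∷ 0 ∷ 1 ∷ 48 ∷ 3 ∷ 43 ∷ 0 ∷ 0 ∷ 0 ∷ 0 ∷ 48 ∷ 0 ∷ 0 ∷ 0 ∷ 0 ∷ 47 ∷ 0 ∷ 0 ∷ 0 ∷ 0 ∷ 0 ∷ 0 ∷ 0 ∷ 0 ∷ 0 ∷ 29 ∷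
      0 ∷ 0 ∷ 7 ∷ 0 ∷ 0 ∷ 0 ∷ 0 ∷ 37 ∷ 44 ∷ 58 ∷ 3 ∷ 0 ∷ 0 ∷ 37 ∷ 0 ∷ 30 ∷ 44 ∷ 0 ∷ 0 ∷ 0 ∷ 36 ∷ 0 ∷ 0 ∷ 0 ∷ 42 ∷ 0 ∷ 0 ∷
      0 ∷ 27 ∷ 0 ∷ 0 ∷ 23 ∷ 0 ∷ 13 ∷ 0 ∷ 0 ∷ 0 ∷ 0 ∷ 0 ∷ 13 ∷ 0 ∷ 0 ∷ 0 ∷ 3 ∷ 16 ∷ 0 ∷ 8 ∷ 41 ∷ 0 ∷ 0 ∷ 0 ∷ 35 ∷ 8 ∷ 0 ∷
      7 ∷ 21 ∷ 0 ∷ 0 ∷ 0 ∷ 0 ∷ 0 ∷ 0 ∷ 4 ∷ 40 ∷ 21 ∷ 0 ∷ 0 ∷ 0 ∷ 0 ∷ 0 ∷ 17 ∷ 0 ∷ 48 ∷ 0 ∷ 0 ∷ 17 ∷ 15 ∷ 9 ∷ 0 ∷ 16 ∷ 0 ∷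
      21 ∷ 0 ∷ 0 ∷ 19 ∷ 0 ∷ 4 ∷ 0 ∷ 37 ∷ 21 ∷ 0 ∷ 0 ∷ 0 ∷ 20 ∷ 0 ∷ 0 ∷ 0 ∷ 6 ∷ 5 ∷ 31 ∷ 3 ∷ 0 ∷ 5 ∷ 0 ∷ 0 ∷ 0 ∷ 30 ∷ 8 ∷
      35 ∷ 0 ∷ 0 ∷ 0 ∷ 8 ∷ 0 ∷ 10 ∷ 16 ∷ 26 ∷ 0 ∷ 2 ∷ 0 ∷ 2 ∷ 2 ∷ 1 ∷ 0 ∷ 39 ∷ 0 ∷ 20 ∷ 34 ∷ 38 ∷ 1 ∷ 1 ∷ 0 ∷ 35 ∷ 0 ∷
      11 ∷ 43 ∷ 10 ∷ 0 ∷ 6 ∷ 0 ∷ 0 ∷ 23 ∷ 0 ∷ 23 ∷ 0 ∷ 15 ∷ 13 ∷ 0 ∷ 11 ∷ 0 ∷ 0 ∷ 20 ∷ 0 ∷ 21 ∷ 5 ∷ 0 ∷ 8 ∷ 0 ∷ 18 ∷ 22 ∷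
      0 ∷ 0 ∷ 10 ∷ 0 ∷ 0 ∷ 0 ∷ 30 ∷ 7 ∷ 0 ∷ 0 ∷ 0 ∷ 0 ∷ 0 ∷ 21 ∷ 10 ∷ 0 ∷ 33 ∷ 0 ∷ 2 ∷ 0 ∷ 0 ∷ 0 ∷ 10 ∷ 7 ∷ 32 ∷ 10 ∷ 0 ∷
      3 ∷ 21 ∷ 0 ∷ 2 ∷ 0 ∷ 9 ∷ 5 ∷ 5 ∷ 36 ∷ 25 ∷ 31 ∷ 0 ∷ 0 ∷ 0 ∷ 0 ∷ 11 ∷ 0 ∷ 0 ∷ 0 ∷ 16 ∷ 0 ∷ 0 ∷ 0 ∷ 0 ∷ 28 ∷ 0 ∷ 0 ∷
      0 ∷ 0 ∷ 0 ∷ 8 ∷ 13 ∷ 0 ∷ 0 ∷ 3 ∷ 1 ∷ 0 ∷ 5 ∷ 0 ∷ 1 ∷ 0 ∷ 9 ∷ 24 ∷ 13 ∷ 18 ∷ 0 ∷ 12 ∷ 0 ∷ 0 ∷ 18 ∷ 17 ∷ 0 ∷ 0 ∷ 0 ∷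
      0 ∷ 17 ∷ 22 ∷ 7 ∷ 0 ∷ 6 ∷ 26 ∷ 9 ∷ 24 ∷ 0 ∷ 18 ∷ 38 ∷ 0 ∷ 5 ∷ 2 ∷ 25 ∷ 6 ∷ 2 ∷ 23 ∷ 33 ∷ 25 ∷ 3 ∷ 1 ∷ 9 ∷ 0 ∷ 16 ∷
      0 ∷ 14 ∷ 12 ∷ 4 ∷ 0 ∷ 0 ∷ 2 ∷ 0 ∷ 0 ∷ 36 ∷ 7 ∷ 0 ∷ 26 ∷ 31 ∷ 0 ∷ 0 ∷ 2 ∷ 15 ∷ 11 ∷ 0 ∷ 0 ∷ 0 ∷ 0 ∷ 0 ∷ 4 ∷ 0 ∷ 31 ∷
      11 ∷ 0 ∷ 26 ∷ 9 ∷ 6 ∷ 25 ∷ 13 ∷ 0 ∷ 0 ∷ 0 ∷ 0 ∷ 0 ∷ 5 ∷ 31 ∷ 21 ∷ 17 ∷ 6 ∷ 23 ∷ 5 ∷ 0 ∷ 7 ∷ 19 ∷ 0 ∷ 9 ∷ 0 ∷ 0 ∷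
      16 ∷ 0 ∷ 18 ∷ 0 ∷ 0 ∷ 26 ∷ 9 ∷ 21 ∷ 23 ∷ 5 ∷ 8 ∷ 0 ∷ 35 ∷ 16 ∷ 0 ∷ 0 ∷ 0 ∷ 0 ∷ 15 ∷ 1 ∷ 10 ∷ 0 ∷ 3 ∷ 22 ∷ 0 ∷ 10 ∷
      6 ∷ 21 ∷ 0 ∷ 6 ∷ 0 ∷ 11 ∷ 0 ∷ 7 ∷ 0 ∷ 10 ∷ 5 ∷ 0 ∷ 3 ∷ 0 ∷ 33 ∷ 8 ∷ 6 ∷ 11 ∷ 31 ∷ 16 ∷ 10 ∷ 0 ∷ 0 ∷ 20 ∷ 0 ∷ 0 ∷
      4 ∷ 0 ∷ 6 ∷ 20 ∷ 0 ∷ 25 ∷ 7 ∷ 25 ∷ 15 ∷ 4 ∷ 5 ∷ 0 ∷ 0 ∷ 0 ∷ 3 ∷ 18 ∷ 0 ∷ 0 ∷ 0 ∷ 0 ∷ 0 ∷ 12 ∷ 0 ∷ 2 ∷ 0 ∷ 1 ∷ 13 ∷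
      0 ∷ 19 ∷ 9 ∷ 6 ∷ 13 ∷ 23 ∷ 19 ∷ 0 ∷ 15 ∷ 2 ∷ 0 ∷ 0 ∷ 19 ∷ 0 ∷ 13 ∷ 0 ∷ 0 ∷ 0 ∷ 0 ∷ 0 ∷ 2 ∷ 22 ∷ 3 ∷ 3 ∷ 0 ∷ 12 ∷
      0 ∷ 1 ∷ 22 ∷ 17 ∷ 12 ∷ 14 ∷ 13 ∷ 27 ∷ 23 ∷ 0 ∷ 0 ∷ 0 ∷ 10 ∷ 6 ∷ 0 ∷ 16 ∷ 18 ∷ 6 ∷ 9 ∷ 0 ∷ 0 ∷ 0 ∷ 0 ∷ 13 ∷ 0 ∷ 11 ∷
      22 ∷ 0 ∷ 9 ∷ 0 ∷ 10 ∷ 0 ∷ 9 ∷ 0 ∷ 5 ∷ 24 ∷ 9 ∷ 0 ∷ 4 ∷ 0 ∷ 0 ∷ 0 ∷ 12 ∷ 0 ∷ 4 ∷ 0 ∷ 1 ∷ 24 ∷ 18 ∷ 0 ∷ 0 ∷ 14 ∷ 0 ∷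
      0 ∷ 3 ∷ 2 ∷ 11 ∷ 1 ∷ 20 ∷ 22 ∷ 22 ∷ 8 ∷ 1 ∷ 9 ∷ 0 ∷ 15 ∷ 4 ∷ 16 ∷ 0 ∷ 8 ∷ 1 ∷ 6 ∷ 1 ∷ 5 ∷ 0 ∷ 0 ∷ 11 ∷ 9 ∷ 0 ∷ 0 ∷
      0 ∷ 0 ∷ 2 ∷ 14 ∷ 3 ∷ 1 ∷ 1 ∷ 9 ∷ 8 ∷ 4 ∷ 4 ∷ 14 ∷ 5 ∷ 21 ∷ 0 ∷ 5 ∷ 7 ∷ 8 ∷ 5 ∷ 9 ∷ 11 ∷ 16 ∷ 15 ∷ 15 ∷ 0 ∷ 0 ∷ 2 ∷
      0 ∷ 0 ∷ 11 ∷ 8 ∷ 12 ∷ 5 ∷ 7 ∷ 0 ∷ 0 ∷ 3 ∷ 0 ∷ 14 ∷ 13 ∷ 0 ∷ 12 ∷ 17 ∷ 1 ∷ 0 ∷ 4 ∷ 10 ∷ 6 ∷ 0 ∷ 3 ∷ 1 ∷ 0 ∷ 7 ∷ 9 ∷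
      3 ∷ 12 ∷ 2 ∷ 0 ∷ []

    negative : List ℕ
    negative =
      0 ∷ 10000 ∷ 6667 ∷ 0 ∷ 4000 ∷ 0 ∷ 2857 ∷ 0 ∷ 0 ∷ 0 ∷ 1819 ∷ 0 ∷ 1538 ∷ 0 ∷ 0 ∷ 0 ∷ 1177 ∷ 0 ∷ 1052 ∷ 0 ∷ 0 ∷ 0 ∷
      869 ∷ 0 ∷ 0 ∷ 0 ∷ 0 ∷ 0 ∷ 690 ∷ 667 ∷ 645 ∷ 0 ∷ 0 ∷ 0 ∷ 0 ∷ 0 ∷ 540 ∷ 0 ∷ 0 ∷ 0 ∷ 488 ∷ 476 ∷ 465 ∷ 0 ∷ 0 ∷ 0 ∷
      425 ∷ 0 ∷ 0 ∷ 0 ∷ 0 ∷ 0 ∷ 377 ∷ 0 ∷ 0 ∷ 0 ∷ 0 ∷ 0 ∷ 339 ∷ 0 ∷ 328 ∷ 0 ∷ 0 ∷ 0 ∷ 0 ∷ 303 ∷ 298 ∷ 0 ∷ 0 ∷ 286 ∷ 282 ∷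
      0 ∷ 274 ∷ 0 ∷ 0 ∷ 0 ∷ 0 ∷ 256 ∷ 253 ∷ 0 ∷ 0 ∷ 0 ∷ 241 ∷ 0 ∷ 0 ∷ 0 ∷ 0 ∷ 0 ∷ 224 ∷ 0 ∷ 0 ∷ 0 ∷ 0 ∷ 0 ∷ 0 ∷ 0 ∷ 206 ∷
      0 ∷ 0 ∷ 0 ∷ 198 ∷ 196 ∷ 195 ∷ 0 ∷ 190 ∷ 0 ∷ 187 ∷ 0 ∷ 184 ∷ 182 ∷ 0 ∷ 0 ∷ 177 ∷ 176 ∷ 0 ∷ 0 ∷ 0 ∷ 0 ∷ 0 ∷ 0 ∷ 0 ∷
      0 ∷ 0 ∷ 0 ∷ 0 ∷ 0 ∷ 157 ∷ 0 ∷ 0 ∷ 154 ∷ 153 ∷ 0 ∷ 0 ∷ 0 ∷ 0 ∷ 0 ∷ 146 ∷ 145 ∷ 144 ∷ 0 ∷ 0 ∷ 0 ∷ 0 ∷ 0 ∷ 0 ∷ 0 ∷ 0 ∷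
      0 ∷ 134 ∷ 0 ∷ 132 ∷ 0 ∷ 0 ∷ 130 ∷ 0 ∷ 0 ∷ 127 ∷ 0 ∷ 0 ∷ 0 ∷ 0 ∷ 0 ∷ 123 ∷ 0 ∷ 121 ∷ 0 ∷ 120 ∷ 0 ∷ 0 ∷ 118 ∷ 0 ∷ 0 ∷
      115 ∷ 115 ∷ 0 ∷ 0 ∷ 0 ∷ 0 ∷ 112 ∷ 0 ∷ 110 ∷ 110 ∷ 0 ∷ 0 ∷ 0 ∷ 107 ∷ 0 ∷ 0 ∷ 0 ∷ 105 ∷ 105 ∷ 0 ∷ 104 ∷ 0 ∷ 102 ∷ 0 ∷
      102 ∷ 0 ∷ 100 ∷ 0 ∷ 0 ∷ 0 ∷ 0 ∷ 0 ∷ 0 ∷ 0 ∷ 0 ∷ 0 ∷ 0 ∷ 0 ∷ 94 ∷ 0 ∷ 0 ∷ 0 ∷ 0 ∷ 0 ∷ 0 ∷ 0 ∷ 0 ∷ 0 ∷ 0 ∷ 90 ∷ 90 ∷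
      0 ∷ 0 ∷ 0 ∷ 88 ∷ 0 ∷ 87 ∷ 87 ∷ 87 ∷ 0 ∷ 85 ∷ 0 ∷ 0 ∷ 0 ∷ 0 ∷ 84 ∷ 84 ∷ 0 ∷ 83 ∷ 0 ∷ 0 ∷ 0 ∷ 0 ∷ 81 ∷ 0 ∷ 0 ∷ 0 ∷
      0 ∷ 79 ∷ 1 ∷ 0 ∷ 0 ∷ 140 ∷ 1 ∷ 17 ∷ 78 ∷ 0 ∷ 0 ∷ 11 ∷ 0 ∷ 75 ∷ 0 ∷ 0 ∷ 96 ∷ 0 ∷ 27 ∷ 61 ∷ 5 ∷ 56 ∷ 26 ∷ 79 ∷ 0 ∷
      0 ∷ 2 ∷ 43 ∷ 0 ∷ 0 ∷ 1 ∷ 72 ∷ 70 ∷ 71 ∷ 1 ∷ 70 ∷ 87 ∷ 0 ∷ 15 ∷ 0 ∷ 61 ∷ 0 ∷ 16 ∷ 66 ∷ 0 ∷ 0 ∷ 16 ∷ 27 ∷ 0 ∷ 0 ∷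
      24 ∷ 0 ∷ 0 ∷ 0 ∷ 0 ∷ 0 ∷ 1 ∷ 62 ∷ 3 ∷ 0 ∷ 84 ∷ 45 ∷ 0 ∷ 64 ∷ 0 ∷ 19 ∷ 34 ∷ 10 ∷ 63 ∷ 0 ∷ 18 ∷ 0 ∷ 86 ∷ 4 ∷ 14 ∷ 0 ∷
      0 ∷ 0 ∷ 20 ∷ 0 ∷ 0 ∷ 12 ∷ 0 ∷ 18 ∷ 0 ∷ 0 ∷ 0 ∷ 39 ∷ 0 ∷ 0 ∷ 25 ∷ 10 ∷ 3 ∷ 3 ∷ 8 ∷ 58 ∷ 0 ∷ 50 ∷ 0 ∷ 66 ∷ 0 ∷ 0 ∷
      0 ∷ 49 ∷ 65 ∷ 0 ∷ 0 ∷ 57 ∷ 0 ∷ 55 ∷ 0 ∷ 1 ∷ 0 ∷ 0 ∷ 0 ∷ 0 ∷ 71 ∷ 29 ∷ 15 ∷ 1 ∷ 48 ∷ 0 ∷ 3 ∷ 40 ∷ 69 ∷ 18 ∷ 10 ∷ 0 ∷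
      6 ∷ 11 ∷ 4 ∷ 0 ∷ 0 ∷ 58 ∷ 13 ∷ 45 ∷ 0 ∷ 5 ∷ 19 ∷ 30 ∷ 0 ∷ 0 ∷ 18 ∷ 0 ∷ 0 ∷ 0 ∷ 0 ∷ 13 ∷ 0 ∷ 42 ∷ 9 ∷ 47 ∷ 50 ∷ 0 ∷
      0 ∷ 1 ∷ 49 ∷ 0 ∷ 0 ∷ 35 ∷ 48 ∷ 0 ∷ 0 ∷ 0 ∷ 0 ∷ 0 ∷ 0 ∷ 0 ∷ 48 ∷ 47 ∷ 1 ∷ 46 ∷ 0 ∷ 2 ∷ 0 ∷ 0 ∷ 47 ∷ 0 ∷ 0 ∷ 47 ∷
      46 ∷ 47 ∷ 12 ∷ 34 ∷ 46 ∷ 46 ∷ 0 ∷ 0 ∷ 54 ∷ 33 ∷ 0 ∷ 4 ∷ 45 ∷ 41 ∷ 12 ∷ 0 ∷ 0 ∷ 0 ∷ 0 ∷ 44 ∷ 14 ∷ 0 ∷ 7 ∷ 0 ∷ 0 ∷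
      32 ∷ 0 ∷ 28 ∷ 0 ∷ 16 ∷ 4 ∷ 43 ∷ 0 ∷ 30 ∷ 0 ∷ 35 ∷ 0 ∷ 47 ∷ 0 ∷ 0 ∷ 40 ∷ 0 ∷ 5 ∷ 0 ∷ 29 ∷ 8 ∷ 4 ∷ 0 ∷ 1 ∷ 8 ∷ 12 ∷
      0 ∷ 0 ∷ 23 ∷ 0 ∷ 0 ∷ 14 ∷ 41 ∷ 14 ∷ 0 ∷ 0 ∷ 23 ∷ 0 ∷ 0 ∷ 34 ∷ 13 ∷ 6 ∷ 2 ∷ 42 ∷ 21 ∷ 0 ∷ 0 ∷ 0 ∷ 0 ∷ 8 ∷ 24 ∷ 40 ∷
      5 ∷ 0 ∷ 0 ∷ 0 ∷ 10 ∷ 3 ∷ 0 ∷ 0 ∷ 0 ∷ 1 ∷ 0 ∷ 7 ∷ 0 ∷ 3 ∷ 16 ∷ 0 ∷ 32 ∷ 0 ∷ 15 ∷ 0 ∷ 0 ∷ 15 ∷ 1 ∷ 19 ∷ 0 ∷ 9 ∷ 3 ∷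
      49 ∷ 0 ∷ 0 ∷ 0 ∷ 0 ∷ 24 ∷ 0 ∷ 19 ∷ 2 ∷ 6 ∷ 0 ∷ 0 ∷ 0 ∷ 14 ∷ 17 ∷ 18 ∷ 0 ∷ 6 ∷ 0 ∷ 0 ∷ 0 ∷ 4 ∷ 0 ∷ 11 ∷ 0 ∷ 0 ∷ 0 ∷
      33 ∷ 0 ∷ 27 ∷ 0 ∷ 0 ∷ 0 ∷ 0 ∷ 0 ∷ 35 ∷ 0 ∷ 31 ∷ 0 ∷ 0 ∷ 0 ∷ 0 ∷ 0 ∷ 29 ∷ 2 ∷ 0 ∷ 8 ∷ 0 ∷ 16 ∷ 0 ∷ 0 ∷ 10 ∷ 0 ∷ 4 ∷
      3 ∷ 0 ∷ 15 ∷ 0 ∷ 0 ∷ 32 ∷ 0 ∷ 16 ∷ 0 ∷ 0 ∷ 5 ∷ 7 ∷ 0 ∷ 26 ∷ 19 ∷ 4 ∷ 0 ∷ 0 ∷ 25 ∷ 33 ∷ 11 ∷ 8 ∷ 21 ∷ 0 ∷ 0 ∷ 28 ∷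
      0 ∷ 26 ∷ 0 ∷ 33 ∷ 34 ∷ 25 ∷ 0 ∷ 0 ∷ 0 ∷ 0 ∷ 8 ∷ 0 ∷ 0 ∷ 17 ∷ 0 ∷ 14 ∷ 0 ∷ 0 ∷ 0 ∷ 0 ∷ 0 ∷ 0 ∷ 12 ∷ 0 ∷ 42 ∷ 2 ∷ 0 ∷
      22 ∷ 19 ∷ 2 ∷ 0 ∷ 11 ∷ 22 ∷ 20 ∷ 12 ∷ 0 ∷ 3 ∷ 28 ∷ 4 ∷ 26 ∷ 18 ∷ 0 ∷ 0 ∷ 9 ∷ 17 ∷ 0 ∷ 0 ∷ 18 ∷ 0 ∷ 27 ∷ 0 ∷ 39 ∷
      0 ∷ 0 ∷ 0 ∷ 0 ∷ 15 ∷ 0 ∷ 11 ∷ 22 ∷ 0 ∷ 0 ∷ 16 ∷ 0 ∷ 23 ∷ 2 ∷ 0 ∷ 0 ∷ 0 ∷ 6 ∷ 0 ∷ 0 ∷ 0 ∷ 0 ∷ 9 ∷ 0 ∷ 0 ∷ 16 ∷ 0 ∷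
      0 ∷ 0 ∷ 0 ∷ 0 ∷ 0 ∷ 0 ∷ 0 ∷ 0 ∷ 0 ∷ 0 ∷ 0 ∷ 0 ∷ 8 ∷ 0 ∷ 0 ∷ 0 ∷ 16 ∷ 34 ∷ 0 ∷ 12 ∷ 0 ∷ 0 ∷ 0 ∷ 0 ∷ 0 ∷ 0 ∷ 9 ∷ 0 ∷
      0 ∷ 0 ∷ 0 ∷ 12 ∷ 3 ∷ 0 ∷ 19 ∷ 7 ∷ 0 ∷ 19 ∷ 0 ∷ 0 ∷ 23 ∷ 0 ∷ 0 ∷ 0 ∷ 0 ∷ 0 ∷ 27 ∷ 2 ∷ 23 ∷ 18 ∷ 24 ∷ 0 ∷ 0 ∷ 0 ∷ 0 ∷
      0 ∷ 0 ∷ 0 ∷ 7 ∷ 0 ∷ 0 ∷ 13 ∷ 0 ∷ 0 ∷ 14 ∷ 0 ∷ 24 ∷ 0 ∷ 23 ∷ 19 ∷ 0 ∷ 0 ∷ 0 ∷ 0 ∷ 0 ∷ 0 ∷ 4 ∷ 0 ∷ 0 ∷ 2 ∷ 1 ∷ 1 ∷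
      2 ∷ 0 ∷ 0 ∷ 0 ∷ 2 ∷ 0 ∷ 0 ∷ 0 ∷ 0 ∷ 0 ∷ 0 ∷ 18 ∷ 0 ∷ 1 ∷ 0 ∷ 4 ∷ 0 ∷ 1 ∷ 0 ∷ 0 ∷ 10 ∷ 0 ∷ 0 ∷ 0 ∷ 0 ∷ 0 ∷ 0 ∷ 0 ∷
      0 ∷ 0 ∷ 6 ∷ 21 ∷ 0 ∷ 17 ∷ 13 ∷ 0 ∷ 0 ∷ 0 ∷ 0 ∷ 7 ∷ 0 ∷ 0 ∷ 0 ∷ 0 ∷ 0 ∷ 0 ∷ 25 ∷ 9 ∷ 13 ∷ 0 ∷ 0 ∷ 8 ∷ 4 ∷ 3 ∷ 20 ∷
      15 ∷ 0 ∷ 0 ∷ 0 ∷ 8 ∷ 0 ∷ 0 ∷ 0 ∷ 0 ∷ 0 ∷ 0 ∷ 0 ∷ 0 ∷ 0 ∷ 14 ∷ 0 ∷ 0 ∷ 8 ∷ 0 ∷ 0 ∷ 0 ∷ 0 ∷ 1 ∷ 1 ∷ 2 ∷ 8 ∷ 10 ∷ 0 ∷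
      0 ∷ 0 ∷ 0 ∷ 6 ∷ 0 ∷ 16 ∷ 0 ∷ 0 ∷ 0 ∷ 0 ∷ 0 ∷ 0 ∷ 0 ∷ 0 ∷ 5 ∷ 0 ∷ 15 ∷ 0 ∷ 0 ∷ 23 ∷ 0 ∷ 0 ∷ 0 ∷ 0 ∷ 8 ∷ 4 ∷ 0 ∷ 18 ∷
      0 ∷ 20 ∷ 0 ∷ 0 ∷ 12 ∷ 0 ∷ 0 ∷ 0 ∷ 9 ∷ 0 ∷ 1 ∷ 0 ∷ 0 ∷ 0 ∷ 1 ∷ 0 ∷ 9 ∷ 5 ∷ 14 ∷ 0 ∷ 15 ∷ 0 ∷ 4 ∷ 0 ∷ 0 ∷ 0 ∷ 0 ∷ 0 ∷
      0 ∷ 4 ∷ 9 ∷ 0 ∷ 0 ∷ 0 ∷ 0 ∷ 0 ∷ 0 ∷ 0 ∷ 0 ∷ 0 ∷ 0 ∷ 6 ∷ 0 ∷ 0 ∷ 0 ∷ 10 ∷ 0 ∷ 0 ∷ 0 ∷ 0 ∷ 0 ∷ 4 ∷ 0 ∷ 0 ∷ 0 ∷ 20 ∷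
      3 ∷ 1 ∷ 6 ∷ 0 ∷ 0 ∷ 0 ∷ 0 ∷ 0 ∷ 0 ∷ 0 ∷ 0 ∷ 0 ∷ 0 ∷ 0 ∷ 0 ∷ 12 ∷ 0 ∷ 0 ∷ 0 ∷ 0 ∷ 0 ∷ 0 ∷ 0 ∷ 0 ∷ 0 ∷ 1 ∷ 1 ∷ 0 ∷
      13 ∷ 0 ∷ 0 ∷ 0 ∷ 0 ∷ 0 ∷ 0 ∷ 16 ∷ 14 ∷ 0 ∷ 4 ∷ 0 ∷ 0 ∷ 8 ∷ 0 ∷ 0 ∷ 0 ∷ 11 ∷ 0 ∷ 0 ∷ 0 ∷ 2 ∷ 0 ∷ 0 ∷ 9 ∷ 0 ∷ 0 ∷ 0 ∷
      0 ∷ 0 ∷ 4 ∷ []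

    log-gaps : List ℕ
    log-gaps = gaps 1000 0 1
      where
      gap : ℕ → ℕ → ℕ → ℕ
      gap zero N pw = 0
      gap (suc fuel) N pw = if 2 * pw ≤ᵇ N then suc (gap fuel N (2 * pw)) else 0
      gaps : ℕ → ℕ → ℕ → List ℕ
      gaps zero m pw = []
      -- The entries are differences of ⌊1024 log₂ d⌋. The largest is 1024, from d = 1 to d = 2, so
      -- the fuel 1024 suffices.
      gaps (suc k) m pw = let g = gap 1024 (square-iter 10 (suc m)) pw in g ∷ gaps k (suc m) (pw * 2 ^ g)

    segments : List (ℕ × ℕ)
    segments =
      (4 , 0) ∷ (7 , 3) ∷ (2 , 3) ∷ (4 , 3) ∷ (4 , 3) ∷ (11 , 1) ∷ (3 , 4) ∷ (10 , 3) ∷ (15 , 5) ∷ (5 , 6) ∷ (7 , 20) ∷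
      (19 , 32) ∷ (18 , 9) ∷ (39 , 18) ∷ (23 , 1) ∷ (13 , 55) ∷ (26 , 54) ∷ (122 , 27) ∷ (115 , 86) ∷ (108 , 225) ∷
      (12 , 20617) ∷ (30 , 720) ∷ (52 , 230) ∷ (55 , 199) ∷ (29 , 49) ∷ (71 , 12171) ∷ (18 , 14235) ∷ (41 , 948) ∷
      (117 , 16) ∷ (119 , 202) ∷ (138 , 64) ∷ (70 , 329) ∷ (130 , 427) ∷ (54 , 34902) ∷ (254 , 971) ∷ (135 , 65) ∷
      (209 , 707) ∷ (178 , 125) ∷ (97 , 5273) ∷ (328 , 258) ∷ (103 , 13580) ∷ (578 , 131) ∷ (367 , 104) ∷ (205 , 314) ∷
      (324 , 12530) ∷ (393 , 15514) ∷ (341 , 1568) ∷ (863 , 30499) ∷ (1008 , 27176) ∷ (719 , 255) ∷ (6956 , 4072) ∷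
      (949 , 4088) ∷ (1157 , 152) ∷ (2825 , 1255) ∷ (667 , 10237) ∷ (889 , 40980) ∷ (5166 , 937) ∷ (836 , 11370) ∷
      (787 , 20331) ∷ (877 , 32695) ∷ (34226 , 2083) ∷ (12036 , 3044) ∷ (41481 , 6217) ∷ (14625 , 725) ∷ []

  -- The base 2^24 exceeds both spreads, so digits never carry; the arguments below 2^17 are checked
  -- individually; logarithms are read off 1024th powers; reciprocals are rounded at scale 10^9.
  open Noise 16777216 17
  open Window 16777216 17 10 1000000000 positive negative log-gaps segments using (us)

  opaque
    unfolding positive negative log-gaps segments

    check-lengths : length positive ≤ 16777216 × length positive ≡ length negative × length positive ≡ length log-gaps
    check-lengths = ≤ᵇ-sound refl , refl , refl

    check-totals : total positive ≡ total negative × spread positive < 16777216 × spread negative < 16777216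
    check-totals = refl , ≤ᵇ-sound refl , ≤ᵇ-sound refl

    check-noise : check positive negative segments ≡ true
    check-noise = refl

    check-logs : logs-ok 10 0 1 log-gaps ≡ true
    check-logs = refl

    check-gap : 126 * 2 ^ 10 * recip 1000000000 us + 1000000000 * (log-dot 0 positive log-gaps + total positive) < 1000000000 * log-dot 0 negative log-gaps
    check-gap = ≤ᵇ-sound refl

  opaque
    prime-between : ∃[ N ] ∀ x → N ≤ x → ∃[ p ] Prime p × 62 * x / 63 < p × p ≤ x
    prime-between =
      let (D≤B , len≡ , lenᵍ) = check-lengths
          (s≡ , sp , sn) = check-totals
      in Window.prime-in-window 16777216 17 10 1000000000 positive negative log-gaps segments D≤B len≡ lenᵍ s≡ sp sn check-noise check-logs check-gap

-- Primitive roots and Ruzsa's Sidon sets modulo p (p - 1)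

module RuzsaSets where

  open import Data.Fin as Fin using (Fin; toℕ; fromℕ<)
  import Data.Fin.Properties as Fin
  open import Data.Integer as ℤ using (ℤ; +_)
  import Data.Integer.Properties as ℤ
  import Data.Integer.Divisibility as ℤ
  open import Data.Nat.Coprimality using (Coprime; coprime-divisor)
  import Data.Nat.Coprimality as Coprime
  import Data.Integer.Tactic.RingSolver as ℤ-Solver
  open PrimePowerSums

  %-diff : ∀ {a b} m .{{_ : NonZero m}} → a ≤ b → a % m ≡ b % m → m ∣ b ∸ a
  %-diff {a} {b} m a≤b e = divides (b / m ∸ a / m) (begin
    b ∸ a ≡⟨ cong₂ _∸_ (m≡m%n+[m/n]*n b m) (m≡m%n+[m/n]*n a m) ⟩
    (b % m + b / m * m) ∸ (a % m + a / m * m) ≡⟨ cong (λ t → (t + b / m * m) ∸ (a % m + a / m * m)) (sym e) ⟩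
    (a % m + b / m * m) ∸ (a % m + a / m * m) ≡⟨ [m+n]∸[m+o]≡n∸o (a % m) _ _ ⟩
    b / m * m ∸ a / m * m ≡⟨ *-distribʳ-∸ m (b / m) (a / m) ⟨
    (b / m ∸ a / m) * m ∎)
    where open ≡-Reasoning

  %-from-diff : ∀ {a b} m .{{_ : NonZero m}} → a ≤ b → m ∣ b ∸ a → a % m ≡ b % m
  %-from-diff {a} {b} m a≤b h = sym (trans (cong (_% m) (sym (m+[n∸m]≡n a≤b))) (%-remove-+ʳ a h))

  %-+ : ∀ m .{{_ : NonZero m}} {a b c d} → a % m ≡ b % m → c % m ≡ d % m → (a + c) % m ≡ (b + d) % m
  %-+ m {a} {b} {c} {d} e f = trans (%-distribˡ-+ a c m) (trans (cong₂ (λ x y → (x + y) % m) e f) (sym (%-distribˡ-+ b d m)))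

  %-* : ∀ m .{{_ : NonZero m}} {a b c d} → a % m ≡ b % m → c % m ≡ d % m → (a * c) % m ≡ (b * d) % m
  %-* m {a} {b} {c} {d} e f = trans (%-distribˡ-* a c m) (trans (cong₂ (λ x y → (x * y) % m) e f) (sym (%-distribˡ-* b d m)))

  %-^ : ∀ m .{{_ : NonZero m}} {a b} k → a % m ≡ b % m → (a ^ k) % m ≡ (b ^ k) % m
  %-^ m zero e = refl
  %-^ m {a} {b} (suc k) e = %-* m {a} {b} {a ^ k} {b ^ k} e (%-^ m k e)

  %-weaken : ∀ {a b} m n .{{_ : NonZero m}} .{{_ : NonZero n}} → n ∣ m → a % m ≡ b % m → a % n ≡ b % n
  %-weaken {a} {b} m n n∣m e = trans (sym (m∣n⇒o%n%m≡o%m n m a n∣m)) (trans (cong (_% n) e) (m∣n⇒o%n%m≡o%m n m b n∣m))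

  split-valuation : ∀ {q} → Prime q → ∀ k .{{_ : NonZero k}} → ∃[ t ] ∃[ k′ ] k ≡ q ^ t * k′ × ¬ q ∣ k′
  split-valuation {q} pq = prime-induction _ (0 , 1 , refl , λ h → not1 (∣1⇒≡1 h)) step
    where
    not1 : q ≢ 1
    not1 refl = ¬prime[1] pq
    step : ∀ p k → Prime p → NonZero k → (∃[ t ] ∃[ k′ ] k ≡ q ^ t * k′ × ¬ q ∣ k′) → ∃[ t ] ∃[ k′ ] p * k ≡ q ^ t * k′ × ¬ q ∣ k′
    step p k pp _ (t , k′ , k≡ , q∤k′) with p ≟ q
    ... | yes refl = suc t , k′ , trans (cong (p *_) k≡) (sym (*-assoc p (p ^ t) k′)) , q∤k′
    ... | no p≢q = t , p * k′ , trans (cong (p *_) k≡) (lem p (q ^ t) k′) , λ h → q∤pk′ (euclidsLemma p k′ pq h)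
      where
      lem : ∀ p a k → p * (a * k) ≡ a * (p * k)
      lem = solve-∀
      q∤pk′ : ¬ (q ∣ p ⊎ q ∣ k′)
      q∤pk′ (inj₂ h) = q∤k′ h
      q∤pk′ (inj₁ h) with prime⇒irreducible pp h
      ... | inj₁ q≡1 = not1 q≡1
      ... | inj₂ q≡p = p≢q (sym q≡p)

  -- A prime q whose exponent in m exceeds that in n. Write m = p k: if k fails to divide n,
  -- induction applies; otherwise n = n₁ k with p ∤ n₁, so p has the same exponent in n as in k, one
  -- less than in m.
  ∤-valuation : ∀ n .{{_ : NonZero n}} m .{{_ : NonZero m}} → ¬ m ∣ n →
    ∃[ q ] ∃[ t ] ∃[ m′ ] ∃[ n′ ] Prime q × m ≡ m′ * q ^ suc t × n ≡ q ^ t * n′ × ¬ q ∣ n′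
  ∤-valuation n = prime-induction _ (λ h → ⊥-elim (h (1∣ n))) step
    where
    Goal : ℕ → Set
    Goal m = ¬ m ∣ n → ∃[ q ] ∃[ t ] ∃[ m′ ] ∃[ n′ ] Prime q × m ≡ m′ * q ^ suc t × n ≡ q ^ t * n′ × ¬ q ∣ n′
    step : ∀ p k → Prime p → NonZero k → Goal k → Goal (p * k)
    step p k pp k≢0 ih pk∤n with k ∣? n
    ... | no k∤n = let (q , t , m′ , n′ , pq , k≡ , n≡ , q∤) = ih k∤n in
                   q , t , p * m′ , n′ , pq , trans (cong (p *_) k≡) (sym (*-assoc p m′ _)) , n≡ , q∤
    ... | yes (divides n₁ n≡) with split-valuation pp k {{k≢0}}
    ... | t , k′ , k≡ , p∤k′ = p , t , k′ , n₁ * k′ , pp ,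
          trans (cong (p *_) k≡) (lem₁ p (p ^ t) k′) , trans n≡ (trans (cong (n₁ *_) k≡) (lem₂ n₁ (p ^ t) k′)) , λ h → p∤ (euclidsLemma n₁ k′ pp h)
      where
      lem₁ : ∀ p a k → p * (a * k) ≡ k * (p * a)
      lem₁ = solve-∀
      lem₂ : ∀ n a k → n * (a * k) ≡ a * (n * k)
      lem₂ = solve-∀
      p∤ : ¬ (p ∣ n₁ ⊎ p ∣ k′)
      p∤ (inj₁ (divides c n₁≡)) = pk∤n (divides c (trans n≡ (trans (cong (_* k) n₁≡) (*-assoc c p k))))
      p∤ (inj₂ h) = p∤k′ h

  -- The monic polynomial c₀ + c₁ x + … + x^n.
  monic : List ℕ → ℕ → ℕ
  monic [] x = 1
  monic (c ∷ cs) x = c + x * monic cs x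

  -- The quotient h in f(x) − f(r) = (x − r) h(x).
  quot : List ℕ → ℕ → List ℕ
  combine : List ℕ → ℕ → List ℕ → List ℕ
  quot [] r = []
  quot (c ∷ []) r = []
  quot (c ∷ cs@(_ ∷ _)) r = combine cs r (quot cs r)
  combine [] r ds = []
  combine (c ∷ cs) r [] = (c + r) ∷ []
  combine (c ∷ cs) r (d ∷ ds) = (c + r * d) ∷ combine cs r ds

  combine-length : ∀ cs r ds → length cs ≡ suc (length ds) → length (combine cs r ds) ≡ length cs
  combine-length (c ∷ []) r [] _ = refl
  combine-length (c ∷ cs) r (d ∷ ds) e = cong suc (combine-length cs r ds (suc-injective e))

  quot-length : ∀ c cs r → length (quot (c ∷ cs) r) ≡ length cs
  quot-length c [] r = refl
  quot-length c (c′ ∷ cs) r = combine-length (c′ ∷ cs) r (quot (c′ ∷ cs) r) (cong suc (sym (quot-length c′ cs r)))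

  combine-spec : ∀ cs r ds x → length cs ≡ suc (length ds) → monic (combine cs r ds) x ≡ monic cs x + r * monic ds x
  combine-spec (c ∷ []) r [] x _ = lem c r x
    where lem : ∀ c r x → c + r + x * 1 ≡ c + x * 1 + r * 1
          lem = solve-∀
  combine-spec (c ∷ cs) r (d ∷ ds) x e rewrite combine-spec cs r ds x (suc-injective e) = lem c r d x (monic cs x) (monic ds x)
    where lem : ∀ c r d x a b → c + r * d + x * (a + r * b) ≡ c + x * a + r * (d + x * b)
          lem = solve-∀

  quot-spec : ∀ c cs r x → monic (c ∷ cs) x + r * monic (quot (c ∷ cs) r) x ≡ monic (c ∷ cs) r + x * monic (quot (c ∷ cs) r) x
  quot-spec c [] r x = lem c r x
    where lem : ∀ c r x → c + x * 1 + r * 1 ≡ c + r * 1 + x * 1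
          lem = solve-∀
  quot-spec c cs@(c′ ∷ cs′) r x rewrite combine-spec cs r (quot cs r) x (cong suc (sym (quot-length c′ cs′ r))) = begin
    c + x * g + r * (g + r * h) ≡⟨ cong (λ t → c + x * g + r * t) (quot-spec c′ cs′ r x) ⟩
    c + x * g + r * (g₀ + x * h) ≡⟨ lem₂ c x g r g₀ h ⟩
    c + r * g₀ + x * (g + r * h) ∎
    where
    open ≡-Reasoning
    g = monic cs x
    g₀ = monic cs r
    h = monic (quot cs r) x
    lem₂ : ∀ c x g r g₀ h → c + x * g + r * (g₀ + x * h) ≡ c + r * g₀ + x * (g + r * h)
    lem₂ = solve-∀

  module ModPrime (p : ℕ) (pp : Prime p) where
    instance
      p≢0 : NonZero p
      p≢0 = prime⇒nonZero pp

    2≤p : 2 ≤ p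
    2≤p = prime≥2 pp

    infix 4 _~_
    _~_ : ℕ → ℕ → Set
    a ~ b = a % p ≡ b % p

    p∤small : ∀ {a} → 1 ≤ a → a < p → ¬ p ∣ a
    p∤small {suc a} _ a<p h = <⇒≱ a<p (∣⇒≤ h)

    -- Division by x - a, where a is the first of the consecutive roots: a + k ≤ p keeps the
    -- differences x - a prime to p, so the other roots pass to the quotient. Consecutive roots are
    -- what the application provides, namely 1, ..., p - 1.
    root-bound : ∀ n cs a k → length cs ≡ n → a + k ≤ p → (∀ x → a ≤ x → x < a + k → p ∣ monic cs x) → k ≤ n
    root-bound n cs a zero _ _ _ = z≤n
    root-bound zero [] a (suc k) _ _ root = ⊥-elim (<⇒≱ 2≤p (∣⇒≤ (root a ≤-refl (m<m+n a z<s))))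
    root-bound (suc n) (c ∷ cs) a (suc k) len a+k≤p root = s≤s (root-bound n (quot (c ∷ cs) a) (suc a) k
      (trans (quot-length c cs a) (suc-injective len)) (subst (_≤ p) (+-suc a k) a+k≤p) λ x a<x x< → root′ x a<x (subst (x <_) (sym (+-suc a k)) x<))
      where
      root′ : ∀ x → a < x → x < a + suc k → p ∣ monic (quot (c ∷ cs) a) x
      root′ x a<x x< with euclidsLemma (x ∸ a) h pp (subst (p ∣_) (sym (*-distribʳ-∸ h x a)) (%-diff p (*-monoˡ-≤ h (<⇒≤ a<x)) ah~xh))
        where
        h = monic (quot (c ∷ cs) a) x
        f₁ = monic (c ∷ cs) x
        f₂ = monic (c ∷ cs) a
        ah~xh : a * h ~ x * h
        ah~xh = begin
          (a * h) % p ≡⟨ %-remove-+ˡ (a * h) (root x (<⇒≤ a<x) x<) ⟨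
          (f₁ + a * h) % p ≡⟨ cong (_% p) (quot-spec c cs a x) ⟩
          (f₂ + x * h) % p ≡⟨ %-remove-+ˡ (x * h) (root a ≤-refl (m<m+n a z<s)) ⟩
          (x * h) % p ∎
          where open ≡-Reasoning
      ... | inj₂ h = h
      ... | inj₁ h = ⊥-elim (p∤small (m<n⇒0<n∸m a<x) (≤-<-trans (m∸n≤m x a) (<-≤-trans x< a+k≤p)) h)

    ~-cancelˡ-≤ : ∀ {a b} c → ¬ p ∣ c → a ≤ b → c * a ~ c * b → a ~ b
    ~-cancelˡ-≤ {a} {b} c p∤c a≤b e with euclidsLemma c (b ∸ a) pp (subst (p ∣_) (sym (*-distribˡ-∸ c b a)) (%-diff p (*-monoʳ-≤ c a≤b) e))
    ... | inj₁ h = ⊥-elim (p∤c h)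
    ... | inj₂ h = %-from-diff p a≤b h

    ~-cancelˡ : ∀ {a b} c → ¬ p ∣ c → c * a ~ c * b → a ~ b
    ~-cancelˡ {a} {b} c p∤c e with ≤-total a b
    ... | inj₁ a≤b = ~-cancelˡ-≤ c p∤c a≤b e
    ... | inj₂ b≤a = sym (~-cancelˡ-≤ c p∤c b≤a (sym e))

    p∤^ : ∀ {a} → ¬ p ∣ a → ∀ k → ¬ p ∣ a ^ k
    p∤^ p∤a zero h = <⇒≱ 2≤p (∣⇒≤ h)
    p∤^ {a} p∤a (suc k) h with euclidsLemma a (a ^ k) pp h
    ... | inj₁ h = p∤a h
    ... | inj₂ h = p∤^ p∤a k h

    p∤* : ∀ {a b} → ¬ p ∣ a → ¬ p ∣ b → ¬ p ∣ a * b
    p∤* {a} {b} p∤a p∤b h with euclidsLemma a b pp h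
    ... | inj₁ h = p∤a h
    ... | inj₂ h = p∤b h

    record Order (a n : ℕ) : Set where
      field
        positive : 1 ≤ n
        one : a ^ n ~ 1
        least : ∀ m → a ^ m ~ 1 → n ∣ m

    ~1-multiple : ∀ {a n} → a ^ n ~ 1 → ∀ k → a ^ (n * k) ~ 1
    ~1-multiple {a} {n} e k = trans (cong (_% p) (sym (^-*-assoc a n k))) (trans (%-^ p {a ^ n} {1} k e) (cong (_% p) (^-zeroˡ k)))

    least-period⇒Order : ∀ {a n} → 1 ≤ n → a ^ n ~ 1 → (∀ m → 1 ≤ m → m < n → ¬ a ^ m ~ 1) → Order a n
    least-period⇒Order {a} {n@(suc _)} 1≤n one min = record { positive = 1≤n ; one = one ; least = λ m e → m%n≡0⇒n∣m m n (rest m e) }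
      where
      rest : ∀ m → a ^ m ~ 1 → m % n ≡ 0
      rest m e with m % n in eq
      ... | zero = refl
      ... | suc r = ⊥-elim (min (suc r) (s≤s z≤n) (subst (_< n) eq (m%n<n m n)) (begin
        a ^ suc r % p ≡⟨ cong (_% p) (*-identityʳ (a ^ suc r)) ⟨
        a ^ suc r * 1 % p ≡⟨ %-* p {a ^ suc r} {a ^ suc r} {1} {a ^ (n * (m / n))} refl (sym (~1-multiple {a} {n} one (m / n))) ⟩
        a ^ suc r * a ^ (n * (m / n)) % p ≡⟨ cong (_% p) (^-distribˡ-+-* a (suc r) _) ⟨
        a ^ (suc r + n * (m / n)) % p ≡⟨ cong (λ t → a ^ t % p) (trans (cong₂ _+_ (sym eq) (*-comm n (m / n))) (sym (m≡m%n+[m/n]*n m n))) ⟩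
        a ^ m % p ≡⟨ e ⟩
        1 % p ∎))
        where open ≡-Reasoning

    -- The p powers a^0, ..., a^(p-1) have only p - 1 nonzero residues to share; two that coincide
    -- are cancelled. This gives an exponent below p without Fermat's theorem.
    period : ∀ a → ¬ p ∣ a → ∃[ n ] 1 ≤ n × n < p × a ^ n ~ 1
    period a p∤a = let (i , j , i<j , e) = Fin.pigeonhole {m = pred p} {n = p} (≤-reflexive (suc-pred p)) residue in
        toℕ j ∸ toℕ i , m<n⇒0<n∸m i<j , ≤-<-trans (m∸n≤m (toℕ j) (toℕ i)) (Fin.toℕ<n j) , collide i j i<j e
      where
      1≤res : ∀ k → 1 ≤ a ^ k % p
      1≤res k with a ^ k % p in eq
      ... | zero = ⊥-elim (p∤^ p∤a k (m%n≡0⇒n∣m (a ^ k) p eq))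
      ... | suc _ = s≤s z≤n
      res< : ∀ k → pred (a ^ k % p) < pred p
      res< k = ≤-pred (subst₂ _<_ (sym (suc-pred (a ^ k % p) {{>-nonZero (1≤res k)}})) (sym (suc-pred p)) (m%n<n (a ^ k) p))
      residue : Fin p → Fin (pred p)
      residue i = fromℕ< (res< (toℕ i))
      collide : ∀ i j → toℕ i < toℕ j → residue i ≡ residue j → a ^ (toℕ j ∸ toℕ i) ~ 1
      collide i j i<j e = ~-cancelˡ (a ^ toℕ i) (p∤^ p∤a (toℕ i)) (begin
        a ^ toℕ i * a ^ (toℕ j ∸ toℕ i) % p ≡⟨ cong (_% p) (^-distribˡ-+-* a (toℕ i) _) ⟨
        a ^ (toℕ i + (toℕ j ∸ toℕ i)) % p ≡⟨ cong (λ t → a ^ t % p) (m+[n∸m]≡n (<⇒≤ i<j)) ⟩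
        a ^ toℕ j % p ≡⟨ suc-pred (a ^ toℕ j % p) {{>-nonZero (1≤res (toℕ j))}} ⟨
        suc (pred (a ^ toℕ j % p)) ≡⟨ cong suc (trans (sym (Fin.toℕ-fromℕ< (res< (toℕ j)))) (trans (cong toℕ (sym e)) (Fin.toℕ-fromℕ< (res< (toℕ i))))) ⟩
        suc (pred (a ^ toℕ i % p)) ≡⟨ suc-pred (a ^ toℕ i % p) {{>-nonZero (1≤res (toℕ i))}} ⟩
        a ^ toℕ i % p ≡⟨ cong (_% p) (*-identityʳ (a ^ toℕ i)) ⟨
        a ^ toℕ i * 1 % p ∎)
        where open ≡-Reasoning

    least-below : ∀ {P : ℕ → Set} → (∀ n → Dec (P n)) → ∀ n → (∃[ m ] m < n × P m × (∀ k → k < m → ¬ P k)) ⊎ (∀ k → k < n → ¬ P k)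
    least-below P? zero = inj₂ λ _ ()
    least-below P? (suc n) with least-below P? n
    ... | inj₁ (m , m<n , h) = inj₁ (m , m<n⇒m<1+n m<n , h)
    ... | inj₂ none with P? n
    ... | yes pn = inj₁ (n , ≤-refl , pn , none)
    ... | no ¬pn = inj₂ λ k k<1+n → [ none k , (λ { refl → ¬pn }) ]′ (m≤n⇒m<n∨m≡n (≤-pred k<1+n))
      where open import Data.Sum using ([_,_]′)

    order : ∀ a → ¬ p ∣ a → ∃[ n ] n < p × Order a n
    order a p∤a with period a p∤a
    ... | n , 1≤n , n<p , e with least-below (λ m → (1 ≤? m) ×-dec (a ^ m % p ≟ 1 % p)) (suc n)
      where open import Relation.Nullary.Decidable using (_×-dec_)
    ... | inj₂ none = ⊥-elim (none n ≤-refl (1≤n , e))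
    ... | inj₁ (m , m<1+n , (1≤m , e′) , min) = m , <-≤-trans m<1+n n<p , least-period⇒Order 1≤m e′ (λ k 1≤k k<m h → min k k<m (1≤k , h))

    order-< : ∀ {a n} → ¬ p ∣ a → Order a n → n < p
    order-< {a} {n} p∤a o = let (m , 1≤m , m<p , e) = period a p∤a in ≤-<-trans (∣⇒≤ {{>-nonZero 1≤m}} (Order.least o m e)) m<p

    order-power : ∀ {a d e} → 1 ≤ d → Order a (d * e) → Order (a ^ d) e
    order-power {a} {d@(suc _)} {zero} 1≤d o = ⊥-elim (<⇒≱ (Order.positive o) (≤-reflexive (*-zeroʳ d)))
    order-power {a} {d@(suc _)} {suc e} 1≤d o = record
      { positive = s≤s z≤n
      ; one = trans (cong (_% p) (^-*-assoc a d (suc e))) (Order.one o)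
      ; least = λ m h → *-cancelˡ-∣ d (Order.least o (d * m) (trans (cong (_% p) (sym (^-*-assoc a d m))) h)) }

    coprime-∣-* : ∀ {m n k} → Coprime m n → m ∣ k → n ∣ k → m * n ∣ k
    coprime-∣-* {m} {n} cop (divides c refl) n∣cm with coprime-divisor (Coprime.sym cop) (subst (n ∣_) (*-comm c m) n∣cm)
    ... | divides d refl = divides d (trans (*-assoc d n m) (cong (d *_) (*-comm n m)))

    -- Raising (ab)^k ~ 1 to the power n removes b and leaves a^(nk) ~ 1, so m ∣ n k and, by
    -- coprimality, m ∣ k; symmetrically n ∣ k.
    order-* : ∀ {a b m n} → Coprime m n → Order a m → Order b n → Order (a * b) (m * n)
    order-* {a} {b} {m} {n} cop oa ob = record
      { positive = *-mono-≤ (Order.positive oa) (Order.positive ob)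
      ; one = trans (cong (_% p) (^-distrib-* a b (m * n))) (%-* p {a ^ (m * n)} {1} {b ^ (m * n)} {1}
                (~1-multiple {a} {m} (Order.one oa) n) (trans (cong (λ t → b ^ t % p) (*-comm m n)) (~1-multiple {b} {n} (Order.one ob) m)))
      ; least = λ k h → coprime-∣-* cop
          (coprime-divisor cop (Order.least oa (n * k) (kill a b n k (Order.one ob) h)))
          (coprime-divisor (Coprime.sym cop) (Order.least ob (m * k) (kill b a m k (Order.one oa) (trans (cong (λ t → t ^ k % p) (*-comm b a)) h)))) }
      where
      kill : ∀ a b n k → b ^ n ~ 1 → (a * b) ^ k ~ 1 → a ^ (n * k) ~ 1
      kill a b n k e h = begin
        a ^ (n * k) % p ≡⟨ cong (_% p) (*-identityʳ _) ⟨
        a ^ (n * k) * 1 % p ≡⟨ %-* p {a ^ (n * k)} {a ^ (n * k)} {1} {b ^ (n * k)} refl (sym (~1-multiple {b} {n} e k)) ⟩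
        a ^ (n * k) * b ^ (n * k) % p ≡⟨ cong (_% p) (^-distrib-* a b (n * k)) ⟨
        (a * b) ^ (n * k) % p ≡⟨ cong (λ t → (a * b) ^ t % p) (*-comm n k) ⟩
        (a * b) ^ (k * n) % p ≡⟨ ~1-multiple {a * b} {k} h n ⟩
        1 % p ∎
        where open ≡-Reasoning

    coprime-^ : ∀ {q n} → Prime q → ¬ q ∣ n → ∀ j → Coprime n (q ^ j)
    coprime-^ pq q∤n zero (_ , d∣1) = ∣1⇒≡1 d∣1
    coprime-^ {q} {n} pq q∤n (suc j) {d} (d∣n , d∣q) = coprime-^ pq q∤n j (d∣n , coprime-divisor (λ {e} → cop {e}) d∣q)
      where
      cop : Coprime d q
      cop (e∣d , e∣q) with prime⇒irreducible pq e∣q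
      ... | inj₁ e≡1 = e≡1
      ... | inj₂ refl = ⊥-elim (q∤n (∣-trans e∣d d∣n))

    -- The new element combines the q-part of b with the prime-to-q part of a.
    enlarge : ∀ {a b m n} → ¬ p ∣ a → ¬ p ∣ b → Order a n → Order b m → ¬ m ∣ n → ∃[ c ] ∃[ k ] ¬ p ∣ c × Order c k × n < k
    enlarge {a} {b} {m} {n} p∤a p∤b oa ob m∤n
      with ∤-valuation n {{>-nonZero (Order.positive oa)}} m {{>-nonZero (Order.positive ob)}} m∤n
    ... | q , t , m′ , n′ , pq , refl , refl , q∤n′ =
      a ^ (q ^ t) * b ^ m′ , n′ * q ^ suc t , p∤* (p∤^ p∤a (q ^ t)) (p∤^ p∤b m′) ,
      order-* (coprime-^ pq q∤n′ (suc t)) (order-power (m^n>0 q t) oa) (order-power m′>0 ob) , bigger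
      where
      instance _ = prime⇒nonZero pq
      left>0 : ∀ x y → 1 ≤ x * y → 1 ≤ x
      left>0 (suc x) y _ = s≤s z≤n
      m′>0 : 1 ≤ m′
      m′>0 = left>0 m′ (q ^ suc t) (Order.positive ob)
      n′>0 : 1 ≤ n′
      n′>0 = left>0 n′ (q ^ t) (subst (1 ≤_) (*-comm (q ^ t) n′) (Order.positive oa))
      bigger : q ^ t * n′ < n′ * (q * q ^ t)
      bigger = begin-strict
        q ^ t * n′ ≡⟨ *-comm (q ^ t) n′ ⟩
        n′ * q ^ t <⟨ *-monoʳ-< n′ {{>-nonZero n′>0}} (m<n*m (q ^ t) q {{m^n≢0 q t}} (prime≥2 pq)) ⟩
        n′ * (q * q ^ t) ∎
        where
        open ≤-Reasoning
        m<n*m : ∀ m n .{{_ : NonZero m}} → 1 < n → m < n * m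
        m<n*m m n 1<n = ≤-trans (≤-reflexive (cong suc (sym (*-identityˡ m)))) (*-monoˡ-< m 1<n)

    -- Given a of order n, either some b has b^n ≢ 1, so that its order does not divide n and
    -- `enlarge` yields a larger order, or all p - 1 nonzero residues are roots of x^n - 1 and n ≥ p
    -- - 1. Orders stay below p, so the climb ends within the fuel.
    primitive-root : ∃[ g ] ¬ p ∣ g × Order g (pred p)
    primitive-root = climb p 1 1 (p∤small ≤-refl 2≤p) (least-period⇒Order {1} ≤-refl refl (λ { (suc m) _ (s≤s ()) })) (n≤1+n p)
      where
      climb : ∀ fuel a n → ¬ p ∣ a → Order a n → p ≤ n + fuel → ∃[ g ] ¬ p ∣ g × Order g (pred p)
      climb zero a n p∤a o p≤ = ⊥-elim (<⇒≱ (order-< p∤a o) (≤-trans p≤ (≤-reflexive (+-identityʳ n))))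
      climb (suc fuel) a n p∤a o p≤ with anyUpTo? (λ b → (1 ≤? b) ×-dec ¬? (b ^ n % p ≟ 1 % p)) p
        where open import Relation.Nullary.Decidable using (_×-dec_; ¬?)
      ... | yes (b , b<p , 1≤b , ne) =
        let p∤b = p∤small 1≤b b<p
            (m , m<p , ob) = order b p∤b
            (c , k , p∤c , oc , n<k) = enlarge p∤a p∤b o ob (λ { (divides e n≡) → ne (trans (cong (λ t → b ^ t % p) (trans n≡ (*-comm e m))) (~1-multiple {b} {m} (Order.one ob) e)) })
        in climb fuel c k p∤c oc (≤-trans p≤ (≤-trans (≤-reflexive (+-suc n fuel)) (+-monoˡ-≤ fuel n<k)))
      ... | no all = a , p∤a , subst (Order a) (≤-antisym (≤-pred (subst (n <_) (sym (suc-pred p)) (order-< p∤a o))) (p-1≤n n (Order.positive o) all)) o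
        where
        p-1≤n : ∀ n → 1 ≤ n → ¬ (∃[ b ] b < p × 1 ≤ b × ¬ b ^ n % p ≡ 1 % p) → pred p ≤ n
        -- The coefficient list represents x^(n+1) - 1, with p - 1 in place of -1.
        p-1≤n (suc n) _ all = root-bound (suc n) (pred p ∷ zeros n) 1 (pred p) (cong suc (zeros-length n)) (≤-reflexive (suc-pred p)) root
          where
          zeros : ℕ → List ℕ
          zeros zero = []
          zeros (suc n) = 0 ∷ zeros n
          zeros-length : ∀ n → length (zeros n) ≡ n
          zeros-length zero = refl
          zeros-length (suc n) = cong suc (zeros-length n)
          zeros-monic : ∀ n x → monic (zeros n) x ≡ x ^ n
          zeros-monic zero x = refl
          zeros-monic (suc n) x = cong (x *_) (zeros-monic n x)
          root : ∀ x → 1 ≤ x → x < 1 + pred p → p ∣ monic (pred p ∷ zeros n) x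
          root x 1≤x x< rewrite zeros-monic n x with x ^ suc n % p ≟ 1 % p
          ... | no ne = ⊥-elim (all (x , subst (x <_) (suc-pred p) x< , 1≤x , ne))
          ... | yes e = m%n≡0⇒n∣m _ p (begin
            (pred p + x ^ suc n) % p ≡⟨ %-+ p {pred p} {pred p} {x ^ suc n} {1} refl e ⟩
            (pred p + 1) % p ≡⟨ cong (_% p) (trans (+-comm (pred p) 1) (suc-pred p)) ⟩
            p % p ≡⟨ n%n≡0 p ⟩
            0 ∎)
            where open ≡-Reasoning

    ∣-dist : ∀ {a b} → a ~ b → p ∣ ∣ a - b ∣
    ∣-dist {a} {b} e with ≤-total a b
    ... | inj₁ a≤b = subst (p ∣_) (sym (m≤n⇒∣m-n∣≡n∸m a≤b)) (%-diff p a≤b e)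
    ... | inj₂ b≤a = subst (p ∣_) (sym (m≤n⇒∣n-m∣≡n∸m b≤a)) (%-diff p b≤a (sym e))
    dist-∣ : ∀ {a b} → p ∣ ∣ a - b ∣ → a ~ b
    dist-∣ {a} {b} h with ≤-total a b
    ... | inj₁ a≤b = %-from-diff p a≤b (subst (p ∣_) (m≤n⇒∣m-n∣≡n∸m a≤b) h)
    ... | inj₂ b≤a = sym (%-from-diff p b≤a (subst (p ∣_) (m≤n⇒∣n-m∣≡n∸m b≤a) h))

    product-sum : ∀ {x y z w} → x + y ~ z + w → x * y ~ z * w → x ~ z ⊎ x ~ w
    product-sum {x} {y} {z} {w} sum prod
      with euclidsLemma ∣ x - z ∣ ∣ x - w ∣ pp (subst (p ∣_) (sym factor) (∣-dist {x * x + z * w} {x * (z + w)} quadratic))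
      where
      -- x² + z w ≡ x² + x y = x (x + y) ≡ x (z + w), that is (x − z)(x − w) ≡ 0.
      quadratic : x * x + z * w ~ x * (z + w)
      quadratic = begin
        (x * x + z * w) % p ≡⟨ %-+ p {x * x} {x * x} {z * w} {x * y} refl (sym prod) ⟩
        (x * x + x * y) % p ≡⟨ cong (_% p) (*-distribˡ-+ x x y) ⟨
        x * (x + y) % p ≡⟨ %-* p {x} {x} {x + y} {z + w} refl sum ⟩
        x * (z + w) % p ∎
        where open ≡-Reasoning
      factor : ∣ x - z ∣ * ∣ x - w ∣ ≡ ∣ x * x + z * w - x * (z + w) ∣
      factor = begin
        ∣ x - z ∣ * ∣ x - w ∣ ≡⟨ cong₂ _*_ (sym (abs x z)) (sym (abs x w)) ⟩
        ℤ.∣ + x ℤ.- + z ∣ * ℤ.∣ + x ℤ.- + w ∣ ≡⟨ ℤ.abs-* (+ x ℤ.- + z) (+ x ℤ.- + w) ⟨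
        ℤ.∣ (+ x ℤ.- + z) ℤ.* (+ x ℤ.- + w) ∣ ≡⟨ cong ℤ.∣_∣ (lem (+ x) (+ z) (+ w)) ⟩
        ℤ.∣ (+ x ℤ.* + x ℤ.+ + z ℤ.* + w) ℤ.- + x ℤ.* (+ z ℤ.+ + w) ∣
          ≡⟨ cong ℤ.∣_∣ (cong₂ ℤ._-_ (cong₂ ℤ._+_ (sym (ℤ.pos-* x x)) (sym (ℤ.pos-* z w))) (sym (ℤ.pos-* x (z + w)))) ⟩
        ℤ.∣ + (x * x + z * w) ℤ.- + (x * (z + w)) ∣ ≡⟨ abs (x * x + z * w) (x * (z + w)) ⟩
        ∣ x * x + z * w - x * (z + w) ∣ ∎
        where
        open ≡-Reasoning
        abs : ∀ m n → ℤ.∣ + m ℤ.- + n ∣ ≡ ∣ m - n ∣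
        abs m n = trans (cong ℤ.∣_∣ (ℤ.[+m]-[+n]≡m⊖n m n)) (go (≤-total n m))
          where
          go : n ≤ m ⊎ m ≤ n → ℤ.∣ m ℤ.⊖ n ∣ ≡ ∣ m - n ∣
          go (inj₁ n≤m) = trans (cong ℤ.∣_∣ (ℤ.⊖-≥ n≤m)) (sym (m≤n⇒∣n-m∣≡n∸m n≤m))
          go (inj₂ m≤n) = trans (ℤ.∣m⊖n∣≡∣n⊖m∣ m n) (trans (cong ℤ.∣_∣ (ℤ.⊖-≥ m≤n)) (sym (m≤n⇒∣m-n∣≡n∸m m≤n)))
        lem : ∀ x z w → (x ℤ.- z) ℤ.* (x ℤ.- w) ≡ (x ℤ.* x ℤ.+ z ℤ.* w) ℤ.- x ℤ.* (z ℤ.+ w)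
        lem = ℤ-Solver.solve-∀
    ... | inj₁ h = inj₁ (dist-∣ {x} {z} h)
    ... | inj₂ h = inj₂ (dist-∣ {x} {w} h)

  SidonMod : ∀ m .{{_ : NonZero m}} → ℕ → (ℕ → ℕ) → Set
  SidonMod m N s = ∀ i j k l → i < N → j < N → k < N → l < N → (s i + s j) % m ≡ (s k + s l) % m → (i ≡ k × j ≡ l) ⊎ (i ≡ l × j ≡ k)

  -- Ruzsa's set: s_i ≡ i (mod p − 1) and s_i ≡ g^i (mod p).
  module Ruzsa (p q g : ℕ) (pp : Prime p) (p≡ : suc q ≡ p) {{q≢0 : NonZero q}}
               (p∤g : ¬ p ∣ g) (ord : ModPrime.Order p pp g q) where
    open ModPrime p pp
    instance
      pq≢0 : NonZero (p * q)
      pq≢0 = m*n≢0 p q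

    a : ℕ → ℕ
    a i = g ^ i % p
    s : ℕ → ℕ
    s i = p * i + q * (p ∸ a i)

    s-mod-q : ∀ i → s i % q ≡ i % q
    s-mod-q i = trans (%-remove-+ʳ (p * i) (m∣m*n (p ∸ a i))) (trans (cong (λ t → t * i % q) (sym p≡)) (%-remove-+ʳ i {q * i} {q} (m∣m*n i)))

    -- Since q ≡ -1 modulo p, the summand q (p - a) contributes (-1)(-a) = a.
    s-mod-p : ∀ i → s i ~ g ^ i
    s-mod-p i = begin
      (p * i + q * (p ∸ a i)) % p ≡⟨ %-remove-+ˡ (q * (p ∸ a i)) (m∣m*n i) ⟩
      q * (p ∸ a i) % p ≡⟨ %-remove-+ʳ (q * (p ∸ a i)) {p * a i} (m∣m*n (a i)) ⟨
      (q * (p ∸ a i) + p * a i) % p ≡⟨ cong (_% p) eq ⟩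
      (a i + q * p) % p ≡⟨ %-remove-+ʳ (a i) (n∣m*n q) ⟩
      a i % p ≡⟨ m%n%n≡m%n (g ^ i) p ⟩
      g ^ i % p ∎
      where
      open ≡-Reasoning
      lem : ∀ q b a → q * b + (1 + q) * a ≡ a + q * (b + a)
      lem = solve-∀
      eq : q * (p ∸ a i) + p * a i ≡ a i + q * p
      eq = trans (trans (cong (λ t → q * (p ∸ a i) + t * a i) (sym p≡)) (lem q (p ∸ a i) (a i))) (cong (λ t → a i + q * t) (m∸n+n≡m (<⇒≤ (m%n<n (g ^ i) p))))

    periodic : ∀ {i j} → i % q ≡ j % q → g ^ i ~ g ^ j
    periodic {i} {j} e = trans (reduce i) (trans (cong (λ t → g ^ t % p) e) (sym (reduce j)))
      where
      reduce : ∀ i → g ^ i ~ g ^ (i % q)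
      reduce i = begin
        g ^ i % p ≡⟨ cong (λ t → g ^ t % p) (trans (m≡m%n+[m/n]*n i q) (cong (_+_ (i % q)) (*-comm (i / q) q))) ⟩
        g ^ (i % q + q * (i / q)) % p ≡⟨ cong (_% p) (^-distribˡ-+-* g (i % q) _) ⟩
        g ^ (i % q) * g ^ (q * (i / q)) % p ≡⟨ %-* p {g ^ (i % q)} {g ^ (i % q)} {g ^ (q * (i / q))} {1} refl (~1-multiple {g} {q} (Order.one ord) (i / q)) ⟩
        g ^ (i % q) * 1 % p ≡⟨ cong (_% p) (*-identityʳ (g ^ (i % q))) ⟩
        g ^ (i % q) % p ∎
        where open ≡-Reasoning

    g-injective-≤ : ∀ {i j} → i ≤ j → j < q → g ^ i ~ g ^ j → i ≡ j
    g-injective-≤ {i} {j} i≤j j<q e with j ∸ i in eq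
    ... | zero = ≤-antisym i≤j (m∸n≡0⇒m≤n eq)
    ... | suc d = ⊥-elim (<⇒≱ (≤-<-trans (≤-trans (≤-reflexive (sym eq)) (m∸n≤m j i)) j<q)
            (∣⇒≤ (Order.least ord (suc d) (~-cancelˡ (g ^ i) (p∤^ p∤g i) (trans (cong (_% p) (trans (sym (^-distribˡ-+-* g i (suc d)))
              (cong (g ^_) (trans (cong (_+_ i) (sym eq)) (m+[n∸m]≡n i≤j))))) (trans (sym e) (cong (_% p) (sym (*-identityʳ (g ^ i))))))))))

    g-injective : ∀ {i j} → i < q → j < q → g ^ i ~ g ^ j → i ≡ j
    g-injective {i} {j} i<q j<q e with ≤-total i j
    ... | inj₁ i≤j = g-injective-≤ i≤j j<q e
    ... | inj₂ j≤i = sym (g-injective-≤ j≤i i<q (sym e))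

    other : ∀ i j l → i < q → j < q → l < q → (s i + s j) % (p * q) ≡ (s i + s l) % (p * q) → j ≡ l
    other i j l i< j< l< e = g-injective j< l< (begin
      g ^ j % p ≡⟨ s-mod-p j ⟨
      s j % p ≡⟨ +-cancel-% (s i) (%-weaken (p * q) p (m∣m*n q) e) ⟩
      s l % p ≡⟨ s-mod-p l ⟩
      g ^ l % p ∎)
      where
      open ≡-Reasoning
      +-cancel-% : ∀ c {a b} → c + a ~ c + b → a ~ b
      +-cancel-% c {a} {b} e with ≤-total a b
      ... | inj₁ a≤b = %-from-diff p a≤b (subst (p ∣_) ([m+n]∸[m+o]≡n∸o c b a) (%-diff p (+-monoʳ-≤ c a≤b) e))
      ... | inj₂ b≤a = sym (%-from-diff p b≤a (subst (p ∣_) ([m+n]∸[m+o]≡n∸o c a b) (%-diff p (+-monoʳ-≤ c b≤a) (sym e))))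

    -- Modulo p the sum of two elements determines g^i + g^j; modulo q it determines i + j, hence
    -- the product g^i g^j. Sum and product determine the pair, and g is injective on exponents
    -- below q.
    sidon : SidonMod (p * q) q s
    sidon i j k l i< j< k< l< e with product-sum {g ^ i} {g ^ j} {g ^ k} {g ^ l} sums prods
      where
      sums : g ^ i + g ^ j ~ g ^ k + g ^ l
      sums = trans (sym (%-+ p {s i} {g ^ i} {s j} {g ^ j} (s-mod-p i) (s-mod-p j)))
        (trans (%-weaken (p * q) p (m∣m*n q) e) (%-+ p {s k} {g ^ k} {s l} {g ^ l} (s-mod-p k) (s-mod-p l)))
      exps : (i + j) % q ≡ (k + l) % q
      exps = trans (sym (%-+ q {s i} {i} {s j} {j} (s-mod-q i) (s-mod-q j)))
        (trans (%-weaken (p * q) q (n∣m*n p) e) (%-+ q {s k} {k} {s l} {l} (s-mod-q k) (s-mod-q l)))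
      prods : g ^ i * g ^ j ~ g ^ k * g ^ l
      prods = trans (cong (_% p) (sym (^-distribˡ-+-* g i j))) (trans (periodic {i + j} {k + l} exps) (cong (_% p) (^-distribˡ-+-* g k l)))
    ... | inj₁ h with refl ← g-injective i< k< h = inj₁ (refl , other i j l i< j< l< e)
    ... | inj₂ h with refl ← g-injective i< l< h = inj₂ (refl , other i j k i< j< k< (trans e (cong (_% (p * q)) (+-comm (s k) (s i)))))

  sidon-mod : ∀ q {{_ : NonZero q}} (pp : Prime (suc q)) → ∃[ s ] SidonMod (suc q * q) {{m*n≢0 (suc q) q}} q s
  sidon-mod q pp = let (g , p∤g , ord) = ModPrime.primitive-root (suc q) pp in
    Ruzsa.s (suc q) q g pp refl p∤g ord , Ruzsa.sidon (suc q) q g pp refl p∤g ord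

-- Counting Sidon sets as weighted sums over sublists

module SublistSums where

  open import Data.Bool using (true; false)
  open import Data.Fin as Fin using (Fin; toℕ)
  import Data.Fin.Properties as Fin
  open import Data.Fin.Subset as Subset using (Subset; inside; outside)
  open import Data.Vec using ([]; _∷_; here; there)
  open import Data.List using (map; filter)
  open import Data.List.Properties using (filter-++; length-++)
  open import Data.List.Membership.Propositional using (_∈_)
  open import Data.List.Membership.Propositional.Properties using (∈-∃++; ∈-++⁺ˡ; ∈-++⁺ʳ; ∈-++⁻)
  open import Data.List.Relation.Unary.Any using (here; there)
  import Data.List.Relation.Unary.All as All
  open import Data.List.Relation.Unary.AllPairs using ([]; _∷_)
  open import Data.List.Relation.Unary.Unique.Propositional using (Unique)
  open import Data.List.Relation.Binary.Permutation.Propositional using (_↭_; refl; prep; swap; trans; ↭-sym; ↭-refl; ↭-trans)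
  open import Data.List.Relation.Binary.Permutation.Propositional.Properties using (∈-resp-↭; shift)
  open import Relation.Nullary.Decidable using (_×-dec_; _⊎-dec_; _→-dec_; map′)
  import Data.Sum as Sum
  module ≡ = Relation.Binary.PropositionalEquality
  open Sums

  ∑⊆ : List ℕ → (List ℕ → ℕ) → ℕ
  ∑⊆ [] w = w []
  ∑⊆ (x ∷ U) w = ∑⊆ U (w ∘ (x ∷_)) + ∑⊆ U w

  Symmetric : (List ℕ → ℕ) → Set
  Symmetric w = ∀ {A B} → A ↭ B → w A ≡ w B

  ∑⊆-cong : ∀ U {v w : List ℕ → ℕ} → (∀ A → v A ≡ w A) → ∑⊆ U v ≡ ∑⊆ U w
  ∑⊆-cong [] h = h []
  ∑⊆-cong (x ∷ U) h = cong₂ _+_ (∑⊆-cong U (h ∘ (x ∷_))) (∑⊆-cong U h)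

  ∑⊆-mono : ∀ U {v w : List ℕ → ℕ} → (∀ A → v A ≤ w A) → ∑⊆ U v ≤ ∑⊆ U w
  ∑⊆-mono [] h = h []
  ∑⊆-mono (x ∷ U) h = +-mono-≤ (∑⊆-mono U (h ∘ (x ∷_))) (∑⊆-mono U h)

  -- This permits regrouping [n] by residue classes in the lower bound and moving a chosen vertex to
  -- the front in the upper bound; both change the order in which sublists list their elements.
  ∑⊆-↭ : ∀ {U V} w → Symmetric w → U ↭ V → ∑⊆ U w ≡ ∑⊆ V w
  ∑⊆-↭ w s refl = refl
  ∑⊆-↭ w s (prep x p) = cong₂ _+_ (∑⊆-↭ (w ∘ (x ∷_)) (s ∘ prep x) p) (∑⊆-↭ w s p)
  ∑⊆-↭ {x ∷ y ∷ U} {y ∷ x ∷ V} w s (swap x y p) = begin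
    (∑⊆ U (w ∘ (x ∷_) ∘ (y ∷_)) + ∑⊆ U (w ∘ (x ∷_))) + (∑⊆ U (w ∘ (y ∷_)) + ∑⊆ U w)
      ≡⟨ cong₂ _+_ (cong₂ _+_ (≡.trans (∑⊆-cong U (λ A → s (swap x y ↭-refl))) (∑⊆-↭ _ (s ∘ prep y ∘ prep x) p)) (∑⊆-↭ _ (s ∘ prep x) p))
                   (cong₂ _+_ (∑⊆-↭ _ (s ∘ prep y) p) (∑⊆-↭ w s p)) ⟩
    (∑⊆ V (w ∘ (y ∷_) ∘ (x ∷_)) + ∑⊆ V (w ∘ (x ∷_))) + (∑⊆ V (w ∘ (y ∷_)) + ∑⊆ V w) ≡⟨ interchange (∑⊆ V (w ∘ (y ∷_) ∘ (x ∷_))) (∑⊆ V (w ∘ (x ∷_))) (∑⊆ V (w ∘ (y ∷_))) (∑⊆ V w) ⟩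
    (∑⊆ V (w ∘ (y ∷_) ∘ (x ∷_)) + ∑⊆ V (w ∘ (y ∷_))) + (∑⊆ V (w ∘ (x ∷_)) + ∑⊆ V w) ∎
    where open ≡-Reasoning
  ∑⊆-↭ w s (trans p q) = ≡.trans (∑⊆-↭ w s p) (∑⊆-↭ w s q)

  ∑⊆-drop : ∀ C U w → ∑⊆ U w ≤ ∑⊆ (C ++ U) w
  ∑⊆-drop [] U w = ≤-refl
  ∑⊆-drop (x ∷ C) U w = ≤-trans (∑⊆-drop C U w) (m≤n+m _ _)

  ∑⊆-dropʳ : ∀ C U w → ∑⊆ C w ≤ ∑⊆ (C ++ U) w
  ∑⊆-dropʳ [] [] w = ≤-refl
  ∑⊆-dropʳ [] (x ∷ U) w = ≤-trans (∑⊆-dropʳ [] U w) (m≤n+m _ _)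
  ∑⊆-dropʳ (x ∷ C) U w = +-mono-≤ (∑⊆-dropʳ C U (w ∘ (x ∷_))) (∑⊆-dropʳ C U w)

  SidonList : List ℕ → Set
  SidonList A = ∀ {w x y z} → w ∈ A → x ∈ A → y ∈ A → z ∈ A → w + x ≡ y + z → (w ≡ y × x ≡ z) ⊎ (w ≡ z × x ≡ y)

  sidonList? : ∀ A → Dec (SidonList A)
  sidonList? A = map′ (λ h w∈ x∈ y∈ z∈ → All.lookup (All.lookup (All.lookup (All.lookup h w∈) x∈) y∈) z∈)
    (λ h → All.tabulate λ w∈ → All.tabulate λ x∈ → All.tabulate λ y∈ → All.tabulate λ z∈ → h w∈ x∈ y∈ z∈)
    (All.all? (λ w → All.all? (λ x → All.all? (λ y → All.all? (λ z →
      (w + x ≟ y + z) →-dec (((w ≟ y) ×-dec (x ≟ z)) ⊎-dec ((w ≟ z) ×-dec (x ≟ y)))) A) A) A) A)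

  sidonList-⊆ : ∀ {A B} → (∀ {x} → x ∈ A → x ∈ B) → SidonList B → SidonList A
  sidonList-⊆ sub h w∈ x∈ y∈ z∈ = h (sub w∈) (sub x∈) (sub y∈) (sub z∈)

  sidon-weight : List ℕ → ℕ
  sidon-weight A = ⟦ sidonList? A ⟧

  sidon-weight-sym : Symmetric sidon-weight
  sidon-weight-sym {A} {B} p = ⟦⟧-cong (sidonList? A) (sidonList? B) (sidonList-⊆ (∈-resp-↭ (↭-sym p))) (sidonList-⊆ (∈-resp-↭ p))

  interval : ℕ → ℕ → List ℕ
  interval a zero = []
  interval a (suc n) = a ∷ interval (suc a) n

  private
    elements : ∀ {n} → ℕ → Subset n → List ℕ
    elements a [] = []
    elements a (true ∷ S) = a ∷ elements (suc a) S
    elements a (false ∷ S) = elements (suc a) S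

    elements⁺ : ∀ {n} a {S : Subset n} {i} → i Subset.∈ S → a + toℕ i ∈ elements a S
    elements⁺ a here = here (+-identityʳ a)
    elements⁺ a {true ∷ S} {Fin.suc i} (there h) = there (subst (_∈ elements (suc a) S) (sym (+-suc a (toℕ i))) (elements⁺ (suc a) h))
    elements⁺ a {false ∷ S} {Fin.suc i} (there h) = subst (_∈ elements (suc a) S) (sym (+-suc a (toℕ i))) (elements⁺ (suc a) h)

    elements⁻ : ∀ {n} a {S : Subset n} {x} → x ∈ elements a S → ∃[ i ] i Subset.∈ S × x ≡ a + toℕ i
    elements⁻ a {true ∷ S} (here refl) = Fin.zero , here , sym (+-identityʳ a)
    elements⁻ a {true ∷ S} (there h) = let (i , i∈ , e) = elements⁻ (suc a) h in Fin.suc i , there i∈ , ≡.trans e (sym (+-suc a (toℕ i)))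
    elements⁻ a {false ∷ S} h = let (i , i∈ , e) = elements⁻ (suc a) h in Fin.suc i , there i∈ , ≡.trans e (sym (+-suc a (toℕ i)))

    IsSidon⇒SidonList : ∀ {n} (S : Subset n) → IsSidon S → SidonList (elements 1 S)
    IsSidon⇒SidonList S h w∈ x∈ y∈ z∈ e =
      let (i , i∈ , w≡) = elements⁻ 1 w∈
          (j , j∈ , x≡) = elements⁻ 1 x∈
          (k , k∈ , y≡) = elements⁻ 1 y∈
          (l , l∈ , z≡) = elements⁻ 1 z∈
          eq : ∀ {a b i j} → a ≡ 1 + toℕ i → b ≡ 1 + toℕ j → i ≡ j → a ≡ b
          eq a≡ b≡ i≡j = ≡.trans a≡ (≡.trans (cong (suc ∘ toℕ) i≡j) (sym b≡))
      in Sum.map (λ (p , q) → eq w≡ y≡ p , eq x≡ z≡ q) (λ (p , q) → eq w≡ z≡ p , eq x≡ y≡ q)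
           (h i j k l i∈ j∈ k∈ l∈ (≡.trans (sym (cong₂ _+_ w≡ x≡)) (≡.trans e (cong₂ _+_ y≡ z≡))))

    SidonList⇒IsSidon : ∀ {n} (S : Subset n) → SidonList (elements 1 S) → IsSidon S
    SidonList⇒IsSidon S h i j k l i∈ j∈ k∈ l∈ e with h (elements⁺ 1 i∈) (elements⁺ 1 j∈) (elements⁺ 1 k∈) (elements⁺ 1 l∈) e
    ... | inj₁ (a , b) = inj₁ (Fin.toℕ-injective (suc-injective a) , Fin.toℕ-injective (suc-injective b))
    ... | inj₂ (a , b) = inj₂ (Fin.toℕ-injective (suc-injective a) , Fin.toℕ-injective (suc-injective b))

    length-filter-map : ∀ {a b p} {A : Set a} {B : Set b} {P : B → Set p} (P? : ∀ y → Dec (P y)) (f : A → B) xs →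
                        length (filter P? (map f xs)) ≡ length (filter (P? ∘ f) xs)
    length-filter-map P? f [] = refl
    length-filter-map P? f (x ∷ xs) with P? (f x)
    ... | yes _ = cong suc (length-filter-map P? f xs)
    ... | no _ = length-filter-map P? f xs

    count-subsets : ∀ {p} n a {P : Subset n → Set p} (P? : ∀ S → Dec (P S)) w → (∀ S → ⟦ P? S ⟧ ≡ w (elements a S)) →
                    length (filter P? (allSubsets n)) ≡ ∑⊆ (interval a n) w
    count-subsets zero a P? w h with P? [] | h []
    ... | yes _ | e = e
    ... | no _ | e = e
    count-subsets (suc n) a P? w h = begin
      length (filter P? (map (inside ∷_) (allSubsets n) ++ map (outside ∷_) (allSubsets n))) ≡⟨ cong length (filter-++ P? (map (inside ∷_) (allSubsets n)) _) ⟩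
      length (filter P? (map (inside ∷_) (allSubsets n)) ++ filter P? (map (outside ∷_) (allSubsets n))) ≡⟨ length-++ (filter P? (map (inside ∷_) (allSubsets n))) ⟩
      length (filter P? (map (inside ∷_) (allSubsets n))) + length (filter P? (map (outside ∷_) (allSubsets n)))
        ≡⟨ cong₂ _+_ (length-filter-map P? (inside ∷_) (allSubsets n)) (length-filter-map P? (outside ∷_) (allSubsets n)) ⟩
      length (filter (P? ∘ (inside ∷_)) (allSubsets n)) + length (filter (P? ∘ (outside ∷_)) (allSubsets n))
        ≡⟨ cong₂ _+_ (count-subsets n (suc a) (P? ∘ (inside ∷_)) (w ∘ (a ∷_)) (h ∘ (inside ∷_))) (count-subsets n (suc a) (P? ∘ (outside ∷_)) w (h ∘ (outside ∷_))) ⟩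
      ∑⊆ (interval a (suc n)) w ∎
      where open ≡-Reasoning

  numSidon≡ : ∀ n → numSidon n ≡ ∑⊆ (interval 1 n) sidon-weight
  numSidon≡ n = count-subsets n 1 isSidon? sidon-weight λ S →
    ⟦⟧-cong (isSidon? S) (sidonList? (elements 1 S)) (IsSidon⇒SidonList S) (SidonList⇒IsSidon S)

  interval⁺ : ∀ a n {x} → a ≤ x → x < a + n → x ∈ interval a n
  interval⁺ a zero a≤x x< = ⊥-elim (<⇒≱ x< (≤-trans (≤-reflexive (+-identityʳ a)) a≤x))
  interval⁺ a (suc n) {x} a≤x x< with m≤n⇒m<n∨m≡n a≤x
  ... | inj₂ refl = here refl
  ... | inj₁ a<x = there (interval⁺ (suc a) n a<x (subst (x <_) (+-suc a n) x<))

  interval⁻ : ∀ a n {x} → x ∈ interval a n → a ≤ x × x < a + n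
  interval⁻ a (suc n) (here refl) = ≤-refl , m<m+n a z<s
  interval⁻ a (suc n) {x} (there h) = let (l , u) = interval⁻ (suc a) n h in <⇒≤ l , subst (x <_) (sym (+-suc a n)) u

  unique-extract : ∀ {X U : List ℕ} → Unique X → (∀ {x} → x ∈ X → x ∈ U) → ∃[ V ] U ↭ X ++ V
  unique-extract {[]} {U} _ _ = U , ↭-refl
  unique-extract {x ∷ X} {U} (x∉X ∷ uX) sub with ∈-∃++ (sub (here refl))
  ... | as , bs , refl = let (V , p) = unique-extract {X} {as ++ bs} uX sub′ in V , ↭-trans (shift x as bs) (prep x p)
    where
    sub′ : ∀ {y} → y ∈ X → y ∈ as ++ bs
    sub′ {y} y∈X with ∈-++⁻ as (sub (there y∈X))
    ... | inj₁ h = ∈-++⁺ˡ h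
    ... | inj₂ (here refl) = ⊥-elim (All.lookup x∉X y∈X refl)
    ... | inj₂ (there h) = ∈-++⁺ʳ as h

-- Lifting a modular Sidon set to [n]

module ModularLifts where

  open import Data.List using (applyUpTo)
  open import Data.List.Properties using (length-applyUpTo)
  open import Data.List.Membership.Propositional using (_∈_)
  open import Data.List.Membership.Propositional.Properties using (∈-++⁻; ∈-applyUpTo⁻)
  open import Data.List.Relation.Unary.Any using (here; there)
  open import Data.List.Relation.Unary.AllPairs using ([]; _∷_)
  open import Data.List.Relation.Unary.Unique.Propositional using (Unique)
  import Data.List.Relation.Unary.Unique.Propositional.Properties as Unique
  open import Data.List.Relation.Binary.Permutation.Propositional.Properties using (shift)
  import Data.Sum as Sum
  open Sums
  open PrimePowerSums
  open RuzsaSets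
  open SublistSums

  ∑-rotate : ∀ m .{{_ : NonZero m}} c (f : ℕ → ℕ) → ∑ m (λ t → f ((c + t) % m)) ≡ ∑ m f
  ∑-rotate m zero f = ∑-cong m λ t t<m → cong f (m<n⇒m%n≡m t<m)
  ∑-rotate m (suc c) f = trans (+-cancelˡ-≡ (g 0) _ _ (begin
    g 0 + ∑ m (λ t → f ((suc c + t) % m)) ≡⟨ cong (g 0 +_) (∑-cong m (λ t _ → cong (λ u → f (u % m)) (sym (+-suc c t)))) ⟩
    g 0 + ∑ m (g ∘ suc) ≡⟨ ∑-shift m g ⟨
    ∑ m g + g m ≡⟨ cong (∑ m g +_) (cong f (trans (%-remove-+ʳ c ∣-refl) (cong (_% m) (sym (+-identityʳ c))))) ⟩
    ∑ m g + g 0 ≡⟨ +-comm (∑ m g) (g 0) ⟩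
    g 0 + ∑ m g ∎)) (∑-rotate m c f)
    where
    open ≡-Reasoning
    g : ℕ → ℕ
    g t = f ((c + t) % m)

  ∑-initial-exact : ∀ n r → r ≤ n → ∑ n (λ i → ⟦ i <? r ⟧) ≡ r
  ∑-initial-exact n r r≤n = begin
    ∑ n f ≡⟨ cong (λ t → ∑ t f) (m+[n∸m]≡n r≤n) ⟨
    ∑ (r + (n ∸ r)) f ≡⟨ ∑-split r (n ∸ r) f ⟩
    ∑ r f + ∑ (n ∸ r) (λ i → f (r + i))
      ≡⟨ cong₂ _+_ (trans (∑-cong r (λ i i<r → ⟦⟧-yes (i <? r) i<r)) (trans (∑-const r 1) (*-identityʳ r)))
                   (trans (∑-cong (n ∸ r) (λ i _ → ⟦⟧-no (r + i <? r) (≤⇒≯ (m≤m+n r i)))) (trans (∑-const (n ∸ r) 0) (*-zeroʳ (n ∸ r)))) ⟩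
    r + 0 ≡⟨ +-identityʳ r ⟩
    r ∎
    where open ≡-Reasoning
          f : ℕ → ℕ
          f i = ⟦ i <? r ⟧

  ∑-average : ∀ m (f : ℕ → ℕ) c → suc m * c ≤ ∑ (suc m) f → ∃[ t ] c ≤ f t
  ∑-average zero f c h = 0 , subst (_≤ f 0) (*-identityˡ c) h
  ∑-average (suc m) f c h with c ≤? f (suc m)
  ... | yes p = suc m , p
  ... | no ¬p = ∑-average m f c (+-cancelʳ-≤ c _ _ (≤-trans (≤-reflexive (+-comm (suc m * c) c))
                  (≤-trans h (+-monoʳ-≤ (∑ (suc m) f) (<⇒≤ (≰⇒> ¬p))))))

  -- Each residue class s_i mod m is lifted to [n]; a Sidon set may contain at most one lift of each.
  module Lifts (m : ℕ) {{m≢0 : NonZero m}} (N n : ℕ) (s : ℕ → ℕ) (sidon : SidonMod m N s) where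

    k e : ℕ
    k = n / m
    e = n % m

    r : ℕ → ℕ
    r i = s i % m

    size : ℕ → ℕ
    size i = k + ⟦ r i <? e ⟧

    lift : ℕ → ℕ → ℕ
    lift i j = suc (r i + j * m)

    class : ℕ → List ℕ
    class i = applyUpTo (lift i) (size i)

    classes : ℕ → List ℕ
    classes zero = []
    classes (suc i) = class i ++ classes i

    lift-% : ∀ i j → lift i j % m ≡ suc (s i) % m
    lift-% i j = trans (%-remove-+ʳ (suc (r i)) (n∣m*n j)) (%-+ m {1} {1} {r i} {s i} refl (m%n%n≡m%n (s i) m))

    class-% : ∀ {i x} → x ∈ class i → x % m ≡ suc (s i) % m
    class-% {i} x∈ with ∈-applyUpTo⁻ (lift i) x∈
    ... | j , _ , refl = lift-% i j

    class-≤ : ∀ {i x} → x ∈ class i → 1 ≤ x × x < 1 + n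
    class-≤ {i} x∈ with ∈-applyUpTo⁻ (lift i) x∈
    ... | j , j< , refl = s≤s z≤n , s≤s (bound (r i <? e) j<)
      where
      n≡ : n ≡ e + k * m
      n≡ = m≡m%n+[m/n]*n n m
      bound : (d : Dec (r i < e)) → j < k + ⟦ d ⟧ → r i + j * m < n
      bound (yes r<e) j<k+1 = <-≤-trans (+-mono-<-≤ r<e (*-monoˡ-≤ m (≤-pred (subst (j <_) (+-comm k 1) j<k+1)))) (≤-reflexive (sym n≡))
      bound (no _) j<k+0 = <-≤-trans (+-monoˡ-< (j * m) (m%n<n (s i) m)) (≤-trans (*-monoˡ-≤ m (subst (j <_) (+-identityʳ k) j<k+0))
                             (≤-trans (m≤n+m (k * m) e) (≤-reflexive (sym n≡))))

    -- `SidonMod` covers repeated indices, so comparing the pair (i, i) with (j, j) already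
    -- separates residues.
    residue-injective : ∀ {i j} → i < N → j < N → suc (s i) % m ≡ suc (s j) % m → i ≡ j
    residue-injective {i} {j} i< j< h with sidon i i j j i< i< j< j< (%-+ m {s i} {s j} {s i} {s j} e₀ e₀)
      where
      suc-cancel : ∀ {a b} → suc a % m ≡ suc b % m → a % m ≡ b % m
      suc-cancel {a} {b} h with ≤-total a b
      ... | inj₁ a≤b = %-from-diff m a≤b (%-diff m (s≤s a≤b) h)
      ... | inj₂ b≤a = sym (%-from-diff m b≤a (%-diff m (s≤s b≤a) (sym h)))
      e₀ : s i % m ≡ s j % m
      e₀ = suc-cancel h
    ... | inj₁ (p , _) = p
    ... | inj₂ (p , _) = p

    classes⁻ : ∀ i {x} → x ∈ classes i → ∃[ j ] j < i × x ∈ class j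
    classes⁻ (suc i) x∈ with ∈-++⁻ (class i) x∈
    ... | inj₁ h = i , ≤-refl , h
    ... | inj₂ h = let (j , j< , h′) = classes⁻ i h in j , m<n⇒m<1+n j< , h′

    classes-unique : ∀ i → i ≤ N → Unique (classes i)
    classes-unique zero _ = []
    classes-unique (suc i) i<N = Unique.++⁺ (Unique.applyUpTo⁺₁ (lift i) (size i) λ {a} {b} a<b _ eq →
        <⇒≢ (*-monoˡ-< m a<b) (+-cancelˡ-≡ (r i) _ _ (suc-injective eq)))
      (classes-unique i (<⇒≤ i<N)) λ (x∈ , x∈′) → let (j , j<i , h) = classes⁻ i x∈′ in
        <⇒≢ j<i (residue-injective (<-trans j<i i<N) i<N (trans (sym (class-% h)) (class-% x∈)))

    record Selection (i : ℕ) (A : List ℕ) : Set where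
      field
        from : ∀ {x} → x ∈ A → ∃[ j ] i ≤ j × j < N × x ∈ class j
        single : ∀ {x y} j → x ∈ A → y ∈ A → x ∈ class j → y ∈ class j → x ≡ y

    -- Equal sums reduce to equal sums modulo m, which force the same two classes; with one element
    -- per class, the elements agree too.
    selection-sidon : ∀ {i A} → Selection i A → SidonList A
    selection-sidon {i} {A} sel {w} {x} {y} {z} w∈ x∈ y∈ z∈ eq =
      let (a , _ , a< , w∈a) = from w∈
          (b , _ , b< , x∈b) = from x∈
          (c , _ , c< , y∈c) = from y∈
          (d , _ , d< , z∈d) = from z∈
          sums : (suc (s a) + suc (s b)) % m ≡ (suc (s c) + suc (s d)) % m
          sums = trans (sym (%-+ m {w} {suc (s a)} {x} {suc (s b)} (class-% w∈a) (class-% x∈b)))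
                   (trans (cong (_% m) eq) (%-+ m {y} {suc (s c)} {z} {suc (s d)} (class-% y∈c) (class-% z∈d)))
          same : ∀ {u v a b} → u ∈ A → v ∈ A → u ∈ class a → v ∈ class b → a ≡ b → u ≡ v
          same u∈ v∈ u∈a v∈b a≡b = single _ u∈ v∈ u∈a (subst (λ t → _ ∈ class t) (sym a≡b) v∈b)
      in Sum.map (λ (p , q) → same w∈ y∈ w∈a y∈c p , same x∈ z∈ x∈b z∈d q) (λ (p , q) → same w∈ z∈ w∈a z∈d p , same x∈ y∈ x∈b y∈c q)
           (sidon a b c d a< b< c< d< (shifted (s a) (s b) (s c) (s d) sums))
      where
      open Selection sel
      shifted : ∀ a b c d → (suc a + suc b) % m ≡ (suc c + suc d) % m → (a + b) % m ≡ (c + d) % m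
      shifted a b c d h rewrite +-suc a b | +-suc c d with ≤-total (a + b) (c + d)
      ... | inj₁ le = %-from-diff m le (%-diff m (s≤s (s≤s le)) h)
      ... | inj₂ le = sym (%-from-diff m le (%-diff m (s≤s (s≤s le)) (sym h)))

    extend : ∀ {i A x} → i < N → Selection (suc i) A → x ∈ class i → Selection i (x ∷ A)
    extend {i} {A} {x} i<N sel x∈i = record { from = from′ ; single = single′ }
      where
      open Selection sel
      from′ : ∀ {y} → y ∈ x ∷ A → ∃[ j ] i ≤ j × j < N × y ∈ class j
      from′ (here refl) = i , ≤-refl , i<N , x∈i
      from′ (there h) = let (j , i<j , j<N , y∈) = from h in j , <⇒≤ i<j , j<N , y∈
      clash : ∀ {y} j → y ∈ A → x ∈ class j → y ∈ class j → ⊥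
      clash j y∈A x∈j y∈j = let (j′ , i<j′ , j′<N , y∈j′) = from y∈A in
        <⇒≢ i<j′ (residue-injective i<N j′<N (trans (sym (class-% x∈i)) (trans (class-% x∈j) (trans (sym (class-% y∈j)) (class-% y∈j′)))))
      single′ : ∀ {y z} j → y ∈ x ∷ A → z ∈ x ∷ A → y ∈ class j → z ∈ class j → y ≡ z
      single′ j (here refl) (here refl) _ _ = refl
      single′ j (here refl) (there h) y∈ z∈ = ⊥-elim (clash j h y∈ z∈)
      single′ j (there h) (here refl) y∈ z∈ = ⊥-elim (clash j h z∈ y∈)
      single′ j (there h) (there h′) y∈ z∈ = single j h h′ y∈ z∈

    weaken : ∀ {i A} → Selection (suc i) A → Selection i A
    weaken sel = record { from = λ x∈ → let (j , i<j , rest) = from x∈ in j , <⇒≤ i<j , rest ; single = single }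
      where open Selection sel

    choices : ℕ → ℕ
    choices zero = 1
    choices (suc i) = suc (size i) * choices i

    choose-≤1 : ∀ C U w c → (∀ {x} → x ∈ C → c ≤ ∑⊆ U (w ∘ (x ∷_))) → c ≤ ∑⊆ U w → suc (length C) * c ≤ ∑⊆ (C ++ U) w
    choose-≤1 [] U w c _ h = ≤-trans (≤-reflexive (*-identityˡ c)) h
    choose-≤1 (x ∷ C) U w c f h = +-mono-≤ (≤-trans (f (here refl)) (∑⊆-drop C U (w ∘ (x ∷_)))) (choose-≤1 C U w c (f ∘ there) h)

    -- A holds what was already taken from the classes i, ..., N - 1. Going down, class i - 1
    -- contributes one of its lifts or nothing, a factor 1 + size; sublists with two lifts of one
    -- class are discarded from the sum.
    choices-≤ : ∀ i A → i ≤ N → Selection i A → choices i ≤ ∑⊆ (classes i) (λ B → sidon-weight (B ++ A))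
    choices-≤ zero A _ sel = ≤-reflexive (sym (⟦⟧-yes (sidonList? A) (selection-sidon sel)))
    choices-≤ (suc i) A i<N sel = subst (λ t → suc t * choices i ≤ ∑⊆ (class i ++ classes i) (λ B → sidon-weight (B ++ A))) (length-applyUpTo (lift i) (size i))
      (choose-≤1 (class i) (classes i) (λ B → sidon-weight (B ++ A)) (choices i)
        (λ {x} x∈ → ≤-trans (choices-≤ i (x ∷ A) (<⇒≤ i<N) (extend i<N sel x∈)) (≤-reflexive (∑⊆-cong (classes i) (λ B → sidon-weight-sym (shift x B A)))))
        (choices-≤ i A (<⇒≤ i<N) (weaken sel)))

    choices-≤-numSidon : choices N ≤ numSidon n
    choices-≤-numSidon with unique-extract {classes N} {interval 1 n} (classes-unique N ≤-refl)
      (λ x∈ → let (j , _ , h) = classes⁻ N x∈ ; (l , u) = class-≤ h in interval⁺ 1 n l u)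
    ... | V , p = begin
      choices N ≤⟨ choices-≤ N [] ≤-refl (record { from = λ () ; single = λ _ () }) ⟩
      ∑⊆ (classes N) (λ B → sidon-weight (B ++ [])) ≡⟨ ∑⊆-cong (classes N) (λ B → cong sidon-weight (++-identityʳ B)) ⟩
      ∑⊆ (classes N) sidon-weight ≤⟨ ∑⊆-dropʳ (classes N) V sidon-weight ⟩
      ∑⊆ (classes N ++ V) sidon-weight ≡⟨ ∑⊆-↭ sidon-weight sidon-weight-sym p ⟨
      ∑⊆ (interval 1 n) sidon-weight ≡⟨ numSidon≡ n ⟨
      numSidon n ∎
      where open ≤-Reasoning
            open import Data.List.Properties using (++-identityʳ)

    large : ℕ
    large = ∑ N (λ i → ⟦ r i <? e ⟧)

    -- Classes have k or k + 1 lifts, so the product is (1 + k)^(N - large) (2 + k)^large; the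
    -- factor on the left replaces the subtraction in the exponent.
    choices-≡ : choices N * (1 + k) ^ large ≡ (1 + k) ^ N * (2 + k) ^ large
    choices-≡ = go N
      where
      open ≡-Reasoning
      H : ℕ → ℕ
      H i = ∑ i (λ i → ⟦ r i <? e ⟧)
      factor : ∀ (d : ℕ) → d ≤ 1 → suc (k + d) * (1 + k) ^ d ≡ (1 + k) * (2 + k) ^ d
      factor zero _ = cong (λ t → suc t * 1) (+-identityʳ k)
      factor (suc zero) _ = lem k
        where lem : ∀ k → suc (k + 1) * ((1 + k) * 1) ≡ (1 + k) * ((2 + k) * 1)
              lem = solve-∀
      factor (suc (suc _)) (s≤s ())
      go : ∀ i → choices i * (1 + k) ^ H i ≡ (1 + k) ^ i * (2 + k) ^ H i
      go zero = refl
      go (suc i) = let d = ⟦ r i <? e ⟧ in begin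
        suc (size i) * choices i * (1 + k) ^ (H i + d) ≡⟨ cong (suc (size i) * choices i *_) (^-distribˡ-+-* (1 + k) (H i) d) ⟩
        suc (size i) * choices i * ((1 + k) ^ H i * (1 + k) ^ d) ≡⟨ lem (suc (size i)) (choices i) ((1 + k) ^ H i) ((1 + k) ^ d) ⟩
        (suc (size i) * (1 + k) ^ d) * (choices i * (1 + k) ^ H i) ≡⟨ cong₂ _*_ (factor d (⟦⟧≤1 (r i <? e))) (go i) ⟩
        (1 + k) * (2 + k) ^ d * ((1 + k) ^ i * (2 + k) ^ H i) ≡⟨ lem₂ (1 + k) ((2 + k) ^ d) ((1 + k) ^ i) ((2 + k) ^ H i) ⟩
        (1 + k) * (1 + k) ^ i * ((2 + k) ^ d * (2 + k) ^ H i) ≡⟨ cong ((1 + k) ^ suc i *_) (trans (*-comm _ ((2 + k) ^ H i)) (sym (^-distribˡ-+-* (2 + k) (H i) d))) ⟩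
        (1 + k) ^ suc i * (2 + k) ^ (H i + d) ∎
        where
        lem : ∀ a b c d → a * b * (c * d) ≡ (a * d) * (b * c)
        lem = solve-∀
        lem₂ : ∀ a b c d → a * b * (c * d) ≡ a * c * (b * d)
        lem₂ = solve-∀

  -- Translates of a Sidon set modulo m are Sidon. Over all m translations each residue lies below e
  -- = n % m exactly e times, so some translation has at least N e/m classes with an additional
  -- lift. The factor m keeps the averages integral.
  lower-count : ∀ m {{_ : NonZero m}} N n s → SidonMod m N s →
    ∃[ h ] N * (n % m) ≤ m * h × (1 + n / m) ^ N * (2 + n / m) ^ h ≤ numSidon n * (1 + n / m) ^ h
  lower-count m N n s sidon = h t , t-spec , (begin
      (1 + k) ^ N * (2 + k) ^ h t ≡⟨ Lifts.choices-≡ m N n (shifted t) (sidon′ t) ⟨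
      Lifts.choices m N n (shifted t) (sidon′ t) N * (1 + k) ^ h t ≤⟨ *-monoˡ-≤ ((1 + k) ^ h t) (Lifts.choices-≤-numSidon m N n (shifted t) (sidon′ t)) ⟩
      numSidon n * (1 + k) ^ h t ∎)
    where
    open ≤-Reasoning
    k = n / m
    e = n % m
    shifted : ℕ → ℕ → ℕ
    shifted t i = s i + t
    sidon′ : ∀ t → SidonMod m N (shifted t)
    sidon′ t a b c d a< b< c< d< eq = sidon a b c d a< b< c< d< (unshift (subst₂ (λ u v → u % m ≡ v % m) (interchange (s a) t (s b) t) (interchange (s c) t (s d) t) eq))
      where
      [m+n]∸[o+n] : ∀ y x → y + (t + t) ∸ (x + (t + t)) ≡ y ∸ x
      [m+n]∸[o+n] y x = trans (cong₂ _∸_ (+-comm y (t + t)) (+-comm x (t + t))) ([m+n]∸[m+o]≡n∸o (t + t) y x)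
      unshift : ∀ {x y} → (x + (t + t)) % m ≡ (y + (t + t)) % m → x % m ≡ y % m
      unshift {x} {y} h with ≤-total x y
      ... | inj₁ le = %-from-diff m le (subst (m ∣_) ([m+n]∸[o+n] y x) (%-diff m (+-monoˡ-≤ (t + t) le) h))
      ... | inj₂ le = sym (%-from-diff m le (subst (m ∣_) ([m+n]∸[o+n] x y) (%-diff m (+-monoˡ-≤ (t + t) le) (sym h))))
    h : ℕ → ℕ
    h t = ∑ N (λ i → ⟦ (s i + t) % m <? e ⟧)
    average : ∑ m (λ t → m * h t) ≡ m * (N * e)
    average = trans (∑-*ˡ m m h) (cong (m *_) (trans (∑-swap m N _) (trans (∑-cong N (λ i _ →
        trans (∑-rotate m (s i) (λ u → ⟦ u <? e ⟧)) (∑-initial-exact m e (m%n≤n n m)))) (∑-const N e))))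
    found = ∑-average (pred m) (λ t → m * h t) (N * e) (subst (λ u → u * (N * e) ≤ ∑ u (λ t → m * h t)) (sym (suc-pred m)) (≤-reflexive (sym average)))
    t = proj₁ found
    t-spec : N * e ≤ m * h t
    t-spec = proj₂ found

-- Counting small subsets, and the graph attached to a Sidon set

module SidonGraphs where

  open import Data.List using (filter)
  open import Data.List.Membership.Propositional using (_∈_; find; lose)
  open import Data.List.Membership.DecPropositional _≟_ using (_∈?_)
  open import Data.List.Membership.Propositional.Properties using (∈-++⁺ˡ; ∈-++⁺ʳ)
  open import Data.List.Relation.Unary.Any using (here; there)
  import Data.List.Relation.Unary.Any as Any
  import Data.List.Relation.Unary.All as All
  open import Data.List.Relation.Unary.AllPairs using ([]; _∷_)
  open import Data.List.Relation.Unary.Unique.Propositional using (Unique)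
  open import Relation.Nullary.Decidable using (_×-dec_; ¬?)
  import Data.Sum as Sum
  open Sums
  open PrimePowerSums
  open SublistSums

  ∑⊆-+ : ∀ U v w → ∑⊆ U (λ A → v A + w A) ≡ ∑⊆ U v + ∑⊆ U w
  ∑⊆-+ [] v w = refl
  ∑⊆-+ (x ∷ U) v w rewrite ∑⊆-+ U (v ∘ (x ∷_)) (w ∘ (x ∷_)) | ∑⊆-+ U v w = interchange (∑⊆ U (v ∘ (x ∷_))) _ _ _

  ∑⊆-*ˡ : ∀ U c w → ∑⊆ U (λ A → c * w A) ≡ c * ∑⊆ U w
  ∑⊆-*ˡ [] c w = refl
  ∑⊆-*ˡ (x ∷ U) c w rewrite ∑⊆-*ˡ U c (w ∘ (x ∷_)) | ∑⊆-*ˡ U c w = sym (*-distribˡ-+ c _ _)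

  ∑⊆-*ʳ : ∀ U c w → ∑⊆ U (λ A → w A * c) ≡ ∑⊆ U w * c
  ∑⊆-*ʳ [] c w = refl
  ∑⊆-*ʳ (x ∷ U) c w rewrite ∑⊆-*ʳ U c (w ∘ (x ∷_)) | ∑⊆-*ʳ U c w = sym (*-distribʳ-+ c (∑⊆ U (w ∘ (x ∷_))) _)

  ∑⊆-mono-⊆ : ∀ U {v w : List ℕ → ℕ} → (∀ A → (∀ {x} → x ∈ A → x ∈ U) → v A ≤ w A) → ∑⊆ U v ≤ ∑⊆ U w
  ∑⊆-mono-⊆ [] h = h [] λ ()
  ∑⊆-mono-⊆ (x ∷ U) h = +-mono-≤
    (∑⊆-mono-⊆ U λ A sub → h (x ∷ A) λ { (here e) → here e ; (there p) → there (sub p) })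
    (∑⊆-mono-⊆ U λ A sub → h A (there ∘ sub))

  Unique-tail : ∀ {x : ℕ} {U} → Unique (x ∷ U) → Unique U
  Unique-tail (_ ∷ u) = u

  ∑⊆-mono-unique : ∀ U {v w : List ℕ → ℕ} → Unique U → (∀ A → (∀ {x} → x ∈ A → x ∈ U) → Unique A → v A ≤ w A) → ∑⊆ U v ≤ ∑⊆ U w
  ∑⊆-mono-unique [] _ h = h [] (λ ()) []
  ∑⊆-mono-unique (x ∷ U) (x∉ ∷ uU) h = +-mono-≤
    (∑⊆-mono-unique U uU λ A sub uA → h (x ∷ A) (λ { (here e) → here e ; (there p) → there (sub p) }) (All.tabulate (λ y∈ → All.lookup x∉ (sub y∈)) ∷ uA))
    (∑⊆-mono-unique U uU λ A sub uA → h A (there ∘ sub) uA)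

  ∑⊆-[] : ∀ U w → w [] ≤ ∑⊆ U w
  ∑⊆-[] [] w = ≤-refl
  ∑⊆-[] (x ∷ U) w = ≤-trans (∑⊆-[] U w) (m≤n+m _ _)

  ∑⊆-0 : ∀ U → ∑⊆ U (λ _ → 0) ≡ 0
  ∑⊆-0 U = ∑⊆-*ˡ U 0 (λ _ → 0)

  ∑⊆-filter : ∀ {P : ℕ → Set} (P? : ∀ x → Dec (P x)) U w → (∀ A x → x ∈ A → ¬ P x → w A ≡ 0) → ∑⊆ U w ≤ ∑⊆ (filter P? U) w
  ∑⊆-filter P? [] w h = ≤-refl
  ∑⊆-filter P? (x ∷ U) w h with P? x
  ... | yes _ = +-mono-≤ (∑⊆-filter P? U (w ∘ (x ∷_)) λ A y y∈ → h (x ∷ A) y (there y∈)) (∑⊆-filter P? U w h)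
  ... | no ¬px = +-mono-≤ {∑⊆ U (w ∘ (x ∷_))} {0}
        (≤-reflexive (trans (∑⊆-cong U λ A → h (x ∷ A) x (here refl) ¬px) (∑⊆-0 U))) (∑⊆-filter P? U w h)

  -- Splitting off the first s elements of each sublist.
  ∑⊆-split : ∀ U s w → ∑⊆ U w ≤ ∑⊆ U (λ A → ⟦ length A <? s ⟧ * w A) + ∑⊆ U (λ A → ⟦ length A ≟ s ⟧ * ∑⊆ U (λ B → w (A ++ B)))
  ∑⊆-split U zero w = ≤-trans (≤-trans (≤-reflexive (sym (*-identityˡ _))) (∑⊆-[] U (λ A → ⟦ length A ≟ 0 ⟧ * ∑⊆ U (λ B → w (A ++ B))))) (m≤n+m _ _)
  ∑⊆-split [] (suc s) w = ≤-trans (≤-reflexive (sym (*-identityˡ _))) (m≤m+n _ _)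
  ∑⊆-split (x ∷ U) (suc s) w = begin
    ∑⊆ U (w ∘ (x ∷_)) + ∑⊆ U w ≤⟨ +-mono-≤ (∑⊆-split U s (w ∘ (x ∷_))) (∑⊆-split U (suc s) w) ⟩
    (∑⊆ U (λ A → ⟦ length A <? s ⟧ * w (x ∷ A)) + ∑⊆ U (λ A → ⟦ length A ≟ s ⟧ * ∑⊆ U (λ B → w (x ∷ A ++ B)))) +
    (∑⊆ U (λ A → ⟦ length A <? suc s ⟧ * w A) + ∑⊆ U (λ A → ⟦ length A ≟ suc s ⟧ * ∑⊆ U (λ B → w (A ++ B))))
      ≤⟨ +-mono-≤ (+-mono-≤ (∑⊆-mono U λ A → *-monoˡ-≤ (w (x ∷ A)) (⟦⟧-mono (length A <? s) (suc (length A) <? suc s) s≤s))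
                            (∑⊆-mono U λ A → *-mono-≤ (⟦⟧-mono (length A ≟ s) (suc (length A) ≟ suc s) (cong suc)) (m≤n+m _ _)))
                  (+-monoʳ-≤ (∑⊆ U (λ A → ⟦ length A <? suc s ⟧ * w A)) (∑⊆-mono U λ A → *-monoʳ-≤ ⟦ length A ≟ suc s ⟧ (m≤n+m _ _))) ⟩
    (∑⊆ U (λ A → ⟦ suc (length A) <? suc s ⟧ * w (x ∷ A)) + ∑⊆ U (λ A → ⟦ suc (length A) ≟ suc s ⟧ * ∑⊆ (x ∷ U) (λ B → w (x ∷ A ++ B)))) +
    (∑⊆ U (λ A → ⟦ length A <? suc s ⟧ * w A) + ∑⊆ U (λ A → ⟦ length A ≟ suc s ⟧ * ∑⊆ (x ∷ U) (λ B → w (A ++ B))))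
      ≡⟨ interchange (∑⊆ U (λ A → ⟦ suc (length A) <? suc s ⟧ * w (x ∷ A))) _ _ _ ⟩
    _ ∎
    where open ≤-Reasoning

  ∑⊆-one : ∀ U → ∑⊆ U (λ _ → 1) ≡ 2 ^ length U
  ∑⊆-one [] = refl
  ∑⊆-one (x ∷ U) rewrite ∑⊆-one U = cong (2 ^ length U +_) (sym (+-identityʳ _))

  few : ℕ → List ℕ → ℕ
  few s A = ⟦ length A ≤? s ⟧

  few≤ : ∀ U s → ∑⊆ U (few s) ≤ (suc (length U)) ^ s
  few≤ [] s = ≤-trans (⟦⟧≤1 (0 ≤? s)) (≤-reflexive (sym (^-zeroˡ s)))
  few≤ (x ∷ U) zero = ≤-trans (+-mono-≤ {∑⊆ U (few 0 ∘ (x ∷_))} {0} (≤-reflexive (∑⊆-0 U)) (few≤ U 0)) ≤-refl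
  few≤ (x ∷ U) (suc s) = begin
    ∑⊆ U (few (suc s) ∘ (x ∷_)) + ∑⊆ U (few (suc s))
      ≤⟨ +-mono-≤ (≤-trans (∑⊆-mono U (λ A → ⟦⟧-mono (suc (length A) ≤? suc s) (length A ≤? s) ≤-pred)) (few≤ U s)) (few≤ U (suc s)) ⟩
    u ^ s + u * u ^ s ≡⟨⟩
    suc u * u ^ s ≤⟨ *-monoʳ-≤ (suc u) (^-monoˡ-≤ s (n≤1+n u)) ⟩
    suc u * suc u ^ s ∎
    where open ≤-Reasoning
          u = suc (length U)

  -- Bernoulli's inequality (1 - 1/(z + 1))^k ≥ 1 - k/(z + 1), cleared of denominators.
  bernoulli : ∀ z k → k ≤ suc z → suc z ^ k * (suc z ∸ k) ≤ z ^ k * suc z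
  bernoulli z zero _ = ≤-refl
  bernoulli z (suc k) (s≤s k≤z) = begin
    suc z * suc z ^ k * (z ∸ k) ≡⟨ lem₁ (suc z) (suc z ^ k) (z ∸ k) ⟩
    suc z ^ k * (suc z * (z ∸ k)) ≤⟨ *-monoʳ-≤ (suc z ^ k) step ⟩
    suc z ^ k * (z * (suc z ∸ k)) ≡⟨ lem₂ (suc z ^ k) z (suc z ∸ k) ⟩
    z * (suc z ^ k * (suc z ∸ k)) ≤⟨ *-monoʳ-≤ z (bernoulli z k (m≤n⇒m≤1+n k≤z)) ⟩
    z * (z ^ k * suc z) ≡⟨ *-assoc z (z ^ k) (suc z) ⟨
    z * z ^ k * suc z ∎
    where
    open ≤-Reasoning
    lem₁ : ∀ a b c → a * b * c ≡ b * (a * c)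
    lem₁ = solve-∀
    lem₂ : ∀ a b c → a * (b * c) ≡ b * (a * c)
    lem₂ = solve-∀
    step : suc z * (z ∸ k) ≤ z * (suc z ∸ k)
    step = begin
      z ∸ k + z * (z ∸ k) ≤⟨ +-monoˡ-≤ _ (m∸n≤m z k) ⟩
      z + z * (z ∸ k) ≡⟨ *-suc z (z ∸ k) ⟨
      z * suc (z ∸ k) ≡⟨ cong (z *_) (+-∸-assoc 1 k≤z) ⟨
      z * (suc z ∸ k) ∎

  -- (1 + 1/z)^m ≤ 2 when z + 1 = 2m.
  double : ∀ m z → suc z ≡ m + m → suc z ^ m ≤ 2 * z ^ m
  double zero z ()
  double m@(suc _) z e = *-cancelʳ-≤ (suc z ^ m) (2 * z ^ m) m (begin
    suc z ^ m * m ≡⟨ cong (suc z ^ m *_) (trans (sym (m+n∸n≡m m m)) (cong (_∸ m) (sym e))) ⟩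
    suc z ^ m * (suc z ∸ m) ≤⟨ bernoulli z m (≤-trans (m≤m+n m m) (≤-reflexive (sym e))) ⟩
    z ^ m * suc z ≡⟨ cong (z ^ m *_) e ⟩
    z ^ m * (m + m) ≡⟨ lem (z ^ m) m ⟩
    2 * z ^ m * m ∎)
    where
    open ≤-Reasoning
    lem : ∀ a m → a * (m + m) ≡ 2 * a * m
    lem = solve-∀

  -- The sets A are counted with weight z^(s − |A|), which is at least 1 when |A| ≤ s.
  weighted : ∀ U s z .{{_ : NonZero z}} → z ^ length U * ∑⊆ U (few s) ≤ z ^ s * suc z ^ length U
  weighted [] s z = ≤-trans (*-mono-≤ (≤-refl {1}) (⟦⟧≤1 (0 ≤? s))) (*-mono-≤ (m^n>0 z s) ≤-refl)
  weighted (x ∷ U) zero z = begin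
    z * u * (∑⊆ U (few 0 ∘ (x ∷_)) + ∑⊆ U (few 0)) ≡⟨ cong (λ t → z * u * (t + ∑⊆ U (few 0))) (∑⊆-0 U) ⟩
    z * u * ∑⊆ U (few 0) ≡⟨ *-assoc z u _ ⟩
    z * (u * ∑⊆ U (few 0)) ≤⟨ *-mono-≤ (n≤1+n z) (weighted U 0 z) ⟩
    suc z * (1 * v) ≡⟨ lem (suc z) v ⟩
    1 * (suc z * v) ∎
    where
    open ≤-Reasoning
    u = z ^ length U
    v = suc z ^ length U
    lem : ∀ a b → a * (1 * b) ≡ 1 * (a * b)
    lem = solve-∀
  weighted (x ∷ U) (suc s) z = begin
    z * u * (∑⊆ U (few (suc s) ∘ (x ∷_)) + ∑⊆ U (few (suc s)))
      ≤⟨ *-monoʳ-≤ (z * u) (+-monoˡ-≤ _ (∑⊆-mono U (λ A → ⟦⟧-mono (suc (length A) ≤? suc s) (length A ≤? s) ≤-pred))) ⟩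
    z * u * (∑⊆ U (few s) + ∑⊆ U (few (suc s))) ≡⟨ lem₁ z u (∑⊆ U (few s)) (∑⊆ U (few (suc s))) ⟩
    z * (u * ∑⊆ U (few s)) + z * (u * ∑⊆ U (few (suc s))) ≤⟨ +-mono-≤ (*-monoʳ-≤ z (weighted U s z)) (*-monoʳ-≤ z (weighted U (suc s) z)) ⟩
    z * (z ^ s * v) + z * (z * z ^ s * v) ≡⟨ lem₂ z (z ^ s) v ⟩
    z * z ^ s * (suc z * v) ∎
    where
    open ≤-Reasoning
    u = z ^ length U
    v = suc z ^ length U
    lem₁ : ∀ z u a b → z * u * (a + b) ≡ z * (u * a) + z * (u * b)
    lem₁ = solve-∀
    lem₂ : ∀ z y v → z * (y * v) + z * (z * y * v) ≡ z * y * (suc z * v)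
    lem₂ = solve-∀

  -- Take z = 2m - 1 in `weighted`. By `double`, (1 + 1/z)^m ≤ 2, so the at most m c elements of U
  -- contribute at most 2^c, and z^s ≤ (2m)^s.
  few-bound : ∀ U s m c → 1 ≤ m → length U ≤ m * c → ∑⊆ U (few s) ≤ (m + m) ^ s * 2 ^ c
  few-bound U s (suc m) c _ len = *-cancelˡ-≤ (z ^ length U) {{m^n≢0 z (length U)}} (begin
    z ^ length U * ∑⊆ U (few s) ≤⟨ weighted U s z ⟩
    z ^ s * suc z ^ length U ≤⟨ *-mono-≤ (^-monoˡ-≤ s (n≤1+n z)) ratio ⟩
    suc z ^ s * (2 ^ c * z ^ length U) ≡⟨ lem (suc z ^ s) (2 ^ c) (z ^ length U) ⟩
    z ^ length U * (suc z ^ s * 2 ^ c) ∎)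
    where
    open ≤-Reasoning
    z = m + suc m
    instance
      z≢0 : NonZero z
      z≢0 = >-nonZero (≤-trans (s≤s z≤n) (m≤n+m (suc m) m))
    lem : ∀ a b c → a * (b * c) ≡ c * (a * b)
    lem = solve-∀
    u l : ℕ
    u = length U
    l = suc m * c
    ratio : suc z ^ u ≤ 2 ^ c * z ^ u
    ratio = *-cancelʳ-≤ _ _ (z ^ (l ∸ u)) {{m^n≢0 z (l ∸ u)}} (begin
      suc z ^ u * z ^ (l ∸ u) ≤⟨ *-monoʳ-≤ (suc z ^ u) (^-monoˡ-≤ (l ∸ u) (n≤1+n z)) ⟩
      suc z ^ u * suc z ^ (l ∸ u) ≡⟨ trans (sym (^-distribˡ-+-* (suc z) u (l ∸ u))) (cong (suc z ^_) (m+[n∸m]≡n len)) ⟩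
      suc z ^ l ≡⟨ ^-*-assoc (suc z) (suc m) c ⟨
      (suc z ^ suc m) ^ c ≤⟨ ^-monoˡ-≤ c (double (suc m) z refl) ⟩
      (2 * z ^ suc m) ^ c ≡⟨ trans (^-distrib-* 2 (z ^ suc m) c) (cong (2 ^ c *_) (^-*-assoc z (suc m) c)) ⟩
      2 ^ c * z ^ l ≡⟨ cong (2 ^ c *_) (trans (cong (z ^_) (sym (m+[n∸m]≡n len))) (^-distribˡ-+-* z u (l ∸ u))) ⟩
      2 ^ c * (z ^ u * z ^ (l ∸ u)) ≡⟨ *-assoc (2 ^ c) (z ^ u) _ ⟨
      2 ^ c * z ^ u * z ^ (l ∸ u) ∎)

  ∑∈ : List ℕ → (ℕ → ℕ) → ℕ
  ∑∈ [] f = 0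
  ∑∈ (x ∷ xs) f = f x + ∑∈ xs f

  ∑∈-cong : ∀ xs {f g : ℕ → ℕ} → (∀ x → f x ≡ g x) → ∑∈ xs f ≡ ∑∈ xs g
  ∑∈-cong [] h = refl
  ∑∈-cong (x ∷ xs) h = cong₂ _+_ (h x) (∑∈-cong xs h)

  ∑∈-mono : ∀ xs {f g : ℕ → ℕ} → (∀ {x} → x ∈ xs → f x ≤ g x) → ∑∈ xs f ≤ ∑∈ xs g
  ∑∈-mono [] h = z≤n
  ∑∈-mono (x ∷ xs) h = +-mono-≤ (h (here refl)) (∑∈-mono xs (h ∘ there))

  ∑∈-+ : ∀ xs (f g : ℕ → ℕ) → ∑∈ xs (λ x → f x + g x) ≡ ∑∈ xs f + ∑∈ xs g
  ∑∈-+ [] f g = refl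
  ∑∈-+ (x ∷ xs) f g rewrite ∑∈-+ xs f g = interchange (f x) (g x) _ _

  ∑∈-*ˡ : ∀ xs c (f : ℕ → ℕ) → ∑∈ xs (λ x → c * f x) ≡ c * ∑∈ xs f
  ∑∈-*ˡ [] c f = sym (*-zeroʳ c)
  ∑∈-*ˡ (x ∷ xs) c f rewrite ∑∈-*ˡ xs c f = sym (*-distribˡ-+ c (f x) _)

  ∑∈-const : ∀ xs c → ∑∈ xs (λ _ → c) ≡ length xs * c
  ∑∈-const [] c = refl
  ∑∈-const (x ∷ xs) c = cong (c +_) (∑∈-const xs c)

  ∑∈-swap : ∀ xs ys (f : ℕ → ℕ → ℕ) → ∑∈ xs (λ x → ∑∈ ys (f x)) ≡ ∑∈ ys (λ y → ∑∈ xs (λ x → f x y))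
  ∑∈-swap [] ys f = sym (trans (∑∈-const ys 0) (*-zeroʳ (length ys)))
  ∑∈-swap (x ∷ xs) ys f rewrite ∑∈-swap xs ys f = sym (∑∈-+ ys (f x) _)

  ∑-∑∈-swap : ∀ n xs (f : ℕ → ℕ → ℕ) → ∑ n (λ c → ∑∈ xs (f c)) ≡ ∑∈ xs (λ x → ∑ n (λ c → f c x))
  ∑-∑∈-swap n [] f = trans (∑-const n 0) (*-zeroʳ n)
  ∑-∑∈-swap n (x ∷ xs) f = trans (∑-+ n _ _) (cong (∑ n (λ c → f c x) +_) (∑-∑∈-swap n xs f))

  ∑∈-filter : ∀ {P : ℕ → Set} (P? : ∀ x → Dec (P x)) xs → length (filter P? xs) ≡ ∑∈ xs (λ x → ⟦ P? x ⟧)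
  ∑∈-filter P? [] = refl
  ∑∈-filter P? (x ∷ xs) with P? x
  ... | yes _ = cong suc (∑∈-filter P? xs)
  ... | no _ = ∑∈-filter P? xs

  ∑∈-zero : ∀ xs {f : ℕ → ℕ} → (∀ {x} → x ∈ xs → f x ≡ 0) → ∑∈ xs f ≡ 0
  ∑∈-zero [] h = refl
  ∑∈-zero (x ∷ xs) h = cong₂ _+_ (h (here refl)) (∑∈-zero xs (h ∘ there))

  ∑∈-single : ∀ {P : ℕ → Set} (P? : ∀ x → Dec (P x)) {xs} → Unique xs → (∀ {x y} → x ∈ xs → y ∈ xs → P x → P y → x ≡ y) → ∑∈ xs (λ x → ⟦ P? x ⟧) ≤ 1
  ∑∈-single P? {[]} _ _ = z≤n
  ∑∈-single P? {x ∷ xs} (x∉ ∷ u) h with P? x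
  ... | no _ = ∑∈-single P? u (λ a b → h (there a) (there b))
  ... | yes px = ≤-reflexive (cong suc (∑∈-zero xs λ {y} y∈ → ⟦⟧-no (P? y) λ py → All.lookup x∉ y∈ (h (here refl) (there y∈) px py)))

  ∑∈-exists : ∀ y ys (f : ℕ → ℕ) c → length (y ∷ ys) * c ≤ ∑∈ (y ∷ ys) f → ∃[ x ] x ∈ y ∷ ys × c ≤ f x
  ∑∈-exists y [] f c h = y , here refl , subst₂ _≤_ (+-identityʳ c) (+-identityʳ (f y)) h
  ∑∈-exists y (z ∷ zs) f c h with c ≤? f y
  ... | yes p = y , here refl , p
  ... | no ¬p with ∑∈-exists z zs f c (+-cancelˡ-≤ c _ _ (≤-trans h (+-monoˡ-≤ (∑∈ (z ∷ zs) f) (<⇒≤ (≰⇒> ¬p)))))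
  ... | x , x∈ , q = x , there x∈ , q

  -- For a Sidon set T, x and y are adjacent when x + t = y + t′ with t, t′ ∈ T: no Sidon set containing T contains both.
  module Graph (T : List ℕ) (uT : Unique T) (sT : SidonList T) where

    Adj : ℕ → ℕ → Set
    Adj x y = Any.Any (λ t → Any.Any (λ t′ → x + t ≡ y + t′ × x ≢ y × ¬ (t ≡ y × t′ ≡ x)) T) T

    adj? : ∀ x y → Dec (Adj x y)
    adj? x y = Any.any? (λ t → Any.any? (λ t′ → (x + t ≟ y + t′) ×-dec (¬? (x ≟ y) ×-dec ¬? ((t ≟ y) ×-dec (t′ ≟ x)))) T) T

    adj-conflict : ∀ {B x y} → x ∈ B → y ∈ B → Adj x y → ¬ SidonList (T ++ B)
    adj-conflict {B} {x} {y} x∈ y∈ a sid with find a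
    ... | t , t∈ , a′ with find a′
    ... | t′ , t′∈ , e , x≢y , ¬swap with sid (∈-++⁺ʳ T x∈) (∈-++⁺ˡ t∈) (∈-++⁺ʳ T y∈) (∈-++⁺ˡ t′∈) e
    ... | inj₁ (x≡y , _) = x≢y x≡y
    ... | inj₂ (x≡t′ , t≡y) = ¬swap (t≡y , sym x≡t′)

    degree : List ℕ → ℕ → ℕ
    degree W x = ∑∈ W (λ y → ⟦ adj? x y ⟧)

    s : ℕ
    s = length T

    collisions : ℕ → ℕ → ℕ
    collisions x y = ∑∈ T λ t → ∑∈ T λ t′ → ⟦ x + t ≟ y + t′ ⟧

    private
      row≤1 : ∀ a y → ∑∈ T (λ t′ → ⟦ a ≟ y + t′ ⟧) ≤ 1
      row≤1 a y = ∑∈-single (λ t′ → a ≟ y + t′) uT λ _ _ p q → +-cancelˡ-≡ y _ _ (trans (sym p) q)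

    -- For x ≠ y two collisions would give t + u′ = u + t′ inside the Sidon set T, forcing t = u or
    -- x = y; hence there is at most one. Collisions that are not adjacencies lie on the diagonal,
    -- one for each t, or come from the trivial x + y = y + x, which needs y ∈ T.
    collisions≤ : ∀ x y → collisions x y ≤ ⟦ adj? x y ⟧ + (⟦ x ≟ y ⟧ * s + ⟦ y ∈? T ⟧)
    collisions≤ x y = cases (x ≟ y)
      where
      Hit : ℕ → Set
      Hit t = Any.Any (λ t′ → x + t ≡ y + t′) T
      Hit? : ∀ t → Dec (Hit t)
      Hit? t = Any.any? (λ t′ → x + t ≟ y + t′) T
      row : ∀ t → ∑∈ T (λ t′ → ⟦ x + t ≟ y + t′ ⟧) ≤ ⟦ Hit? t ⟧
      row t with Hit? t
      ... | yes _ = row≤1 (x + t) y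
      ... | no none = ≤-reflexive (∑∈-zero T λ {t′} t′∈ → ⟦⟧-no (x + t ≟ y + t′) λ e → none (lose t′∈ e))
      unique : x ≢ y → ∀ {t u} → t ∈ T → u ∈ T → Hit t → Hit u → t ≡ u
      unique x≢y {t} {u} t∈ u∈ ht hu =
        let (t′ , t′∈ , e) = find ht
            (u′ , u′∈ , f) = find hu
            eq : t + u′ ≡ u + t′
            eq = +-cancelˡ-≡ (x + y) _ _ (trans (lem₁ x y t u′) (trans (cong₂ _+_ e (sym f)) (lem₂ x y u t′)))
        in Sum.[ proj₁ , (λ (t≡t′ , _) → ⊥-elim (x≢y (+-cancelʳ-≡ t x y (trans e (cong (_+_ y) (sym t≡t′)))))) ]′ (sT t∈ u′∈ u∈ t′∈ eq)
        where
        lem₁ : ∀ x y t u → x + y + (t + u) ≡ (x + t) + (y + u)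
        lem₁ = solve-∀
        lem₂ : ∀ x y u t → (y + t) + (x + u) ≡ x + y + (u + t)
        lem₂ = solve-∀
      ≤1 : x ≢ y → collisions x y ≤ 1
      ≤1 x≢y = ≤-trans (∑∈-mono T λ {t} _ → row t) (∑∈-single Hit? uT (unique x≢y))
      bound : x ≢ y → (a : Dec (Adj x y)) (d : Dec (y ∈ T)) → collisions x y ≤ ⟦ a ⟧ + ⟦ d ⟧
      bound x≢y (no ¬a) (no y∉T) = ≤-reflexive (∑∈-zero T λ {t} t∈ → ∑∈-zero T λ {t′} t′∈ → ⟦⟧-no (x + t ≟ y + t′)
              λ e → ¬a (lose t∈ (lose t′∈ (e , x≢y , λ (t≡y , _) → y∉T (subst (_∈ T) t≡y t∈)))))
      bound x≢y (yes _) _ = ≤-trans (≤1 x≢y) (s≤s z≤n)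
      bound x≢y (no _) (yes _) = ≤1 x≢y
      cases : (e : Dec (x ≡ y)) → collisions x y ≤ ⟦ adj? x y ⟧ + (⟦ e ⟧ * s + ⟦ y ∈? T ⟧)
      cases (yes refl) = ≤-trans (≤-trans (∑∈-mono T λ {t} _ → row≤1 (x + t) x) (≤-reflexive (trans (∑∈-const T 1) (*-comm s 1))))
                       (≤-trans (m≤m+n (1 * s) _) (m≤n+m _ ⟦ adj? x x ⟧))
      cases (no x≢y) = bound x≢y (adj? x y) (y ∈? T)

    module Count (W : List ℕ) (uW : Unique W) (M : ℕ) (small : ∀ {x t} → x ∈ W → t ∈ T → x + t < M) where

      u : ℕ
      u = length W

      private
        common : ∑∈ W (λ y → ⟦ y ∈? T ⟧) ≤ s
        common = begin
          ∑∈ W (λ y → ⟦ y ∈? T ⟧) ≤⟨ ∑∈-mono W (λ {y} _ → hit y (y ∈? T)) ⟩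
          ∑∈ W (λ y → ∑∈ T (λ t → ⟦ y ≟ t ⟧)) ≡⟨ ∑∈-swap W T (λ y t → ⟦ y ≟ t ⟧) ⟩
          ∑∈ T (λ t → ∑∈ W (λ y → ⟦ y ≟ t ⟧)) ≤⟨ ∑∈-mono T (λ {t} _ → ∑∈-single (_≟ t) uW (λ _ _ p q → trans p (sym q))) ⟩
          ∑∈ T (λ _ → 1) ≡⟨ trans (∑∈-const T 1) (*-identityʳ s) ⟩
          s ∎
          where
          open ≤-Reasoning
          one : ∀ {y xs} → y ∈ xs → 1 ≤ ∑∈ xs (λ t → ⟦ y ≟ t ⟧)
          one {y} (here refl) = ≤-trans (≤-reflexive (sym (⟦⟧-yes (y ≟ y) refl))) (m≤m+n _ _)
          one (there h) = ≤-trans (one h) (m≤n+m _ _)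
          hit : ∀ y (d : Dec (y ∈ T)) → ⟦ d ⟧ ≤ ∑∈ T (λ t → ⟦ y ≟ t ⟧)
          hit y (yes h) = one h
          hit y (no _) = z≤n

      total-collisions≤ : ∑∈ W (λ x → ∑∈ W (collisions x)) ≤ ∑∈ W (λ x → degree W x + (s + s))
      total-collisions≤ = ∑∈-mono W λ {x} _ → begin
        ∑∈ W (collisions x) ≤⟨ ∑∈-mono W (λ {y} _ → collisions≤ x y) ⟩
        ∑∈ W (λ y → ⟦ adj? x y ⟧ + (⟦ x ≟ y ⟧ * s + ⟦ y ∈? T ⟧)) ≡⟨ trans (∑∈-+ W _ _) (cong (degree W x +_) (∑∈-+ W _ _)) ⟩
        degree W x + (∑∈ W (λ y → ⟦ x ≟ y ⟧ * s) + ∑∈ W (λ y → ⟦ y ∈? T ⟧))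
          ≤⟨ +-monoʳ-≤ (degree W x) (+-mono-≤ (≤-trans (≤-reflexive (trans (∑∈-cong W (λ y → *-comm ⟦ x ≟ y ⟧ s)) (∑∈-*ˡ W s _)))
               (≤-trans (*-monoʳ-≤ s (∑∈-single (x ≟_) uW (λ _ _ p q → trans (sym p) q))) (≤-reflexive (*-identityʳ s)))) common) ⟩
        degree W x + (s + s) ∎
        where open ≤-Reasoning

      representations : ℕ → ℕ
      representations c = ∑∈ W λ x → ∑∈ T λ t → ⟦ x + t ≟ c ⟧

      weighted-representations : ∀ (g : ℕ → ℕ) → ∑ M (λ c → g c * representations c) ≡ ∑∈ W (λ x → ∑∈ T (λ t → ∑ M (λ c → g c * ⟦ x + t ≟ c ⟧)))
      weighted-representations g = begin
        ∑ M (λ c → g c * representations c)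
          ≡⟨ ∑-cong M (λ c _ → trans (sym (∑∈-*ˡ W (g c) _)) (∑∈-cong W (λ x → sym (∑∈-*ˡ T (g c) _)))) ⟩
        ∑ M (λ c → ∑∈ W (λ x → ∑∈ T (λ t → g c * ⟦ x + t ≟ c ⟧))) ≡⟨ ∑-∑∈-swap M W _ ⟩
        ∑∈ W (λ x → ∑ M (λ c → ∑∈ T (λ t → g c * ⟦ x + t ≟ c ⟧))) ≡⟨ ∑∈-cong W (λ x → ∑-∑∈-swap M T _) ⟩
        ∑∈ W (λ x → ∑∈ T (λ t → ∑ M (λ c → g c * ⟦ x + t ≟ c ⟧))) ∎
        where open ≡-Reasoning

      pick : ∀ (g : ℕ → ℕ) a → a < M → ∑ M (λ c → g c * ⟦ a ≟ c ⟧) ≡ g a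
      pick g a a<M = ∑-single M a (g a) _ a<M λ c _ → term c
        where
        term : ∀ c → g c * ⟦ a ≟ c ⟧ ≡ ⟦ c ≟ a ⟧ * g a
        term c with a ≟ c
        ... | yes refl = trans (*-comm (g a) 1) (cong (_* g a) (sym (⟦⟧-yes (a ≟ a) refl)))
        ... | no a≢c = trans (*-zeroʳ (g c)) (cong (_* g a) (sym (⟦⟧-no (c ≟ a) (a≢c ∘ sym))))

      -- The square of a representation count counts pairs (x, t), (y, t′) with the same sum, that
      -- is, collisions.
      second-moment : ∑ M (λ c → representations c * representations c) ≤ ∑∈ W (λ x → ∑∈ W (collisions x))
      second-moment = begin
        ∑ M (λ c → representations c * representations c) ≡⟨ weighted-representations representations ⟩
        ∑∈ W (λ x → ∑∈ T (λ t → ∑ M (λ c → representations c * ⟦ x + t ≟ c ⟧)))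
          ≤⟨ ∑∈-mono W (λ x∈ → ∑∈-mono T (λ t∈ → ≤-reflexive (pick representations _ (small x∈ t∈)))) ⟩
        ∑∈ W (λ x → ∑∈ T (λ t → ∑∈ W (λ y → ∑∈ T (λ t′ → ⟦ y + t′ ≟ x + t ⟧)))) ≡⟨ ∑∈-cong W (λ x → ∑∈-swap T W _) ⟩
        ∑∈ W (λ x → ∑∈ W (λ y → ∑∈ T (λ t → ∑∈ T (λ t′ → ⟦ y + t′ ≟ x + t ⟧))))
          ≡⟨ ∑∈-cong W (λ x → ∑∈-cong W (λ y → ∑∈-cong T (λ t → ∑∈-cong T (λ t′ → ⟦⟧-cong (y + t′ ≟ x + t) (x + t ≟ y + t′) sym sym)))) ⟩
        ∑∈ W (λ x → ∑∈ W (collisions x)) ∎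
        where open ≤-Reasoning

      first-moment : u * s ≤ ∑ M representations
      first-moment = begin
        u * s ≡⟨ trans (∑∈-cong W (λ _ → trans (∑∈-const T 1) (*-identityʳ s))) (∑∈-const W s) ⟨
        ∑∈ W (λ x → ∑∈ T (λ t → 1)) ≤⟨ ∑∈-mono W (λ x∈ → ∑∈-mono T (λ t∈ → ≤-reflexive (sym (pick (const 1) _ (small x∈ t∈))))) ⟩
        ∑∈ W (λ x → ∑∈ T (λ t → ∑ M (λ c → 1 * ⟦ x + t ≟ c ⟧))) ≡⟨ weighted-representations (const 1) ⟨
        ∑ M (λ c → 1 * representations c) ≡⟨ ∑-cong M (λ c _ → *-identityˡ _) ⟩
        ∑ M representations ∎
        where open ≤-Reasoning

      -- Cauchy–Schwarz in the form 2lr ≤ r² + l², with l at most the mean number of representations.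
      collisions≥ : ∀ l → M * l ≤ u * s → l * (u * s) ≤ ∑∈ W (λ x → ∑∈ W (collisions x))
      collisions≥ l Ml≤us = +-cancelʳ-≤ (l * (u * s)) _ _ (begin
        l * (u * s) + l * (u * s) ≡⟨ cong (l * (u * s) +_) (+-identityʳ (l * (u * s))) ⟨
        2 * (l * (u * s)) ≡⟨ *-assoc 2 l (u * s) ⟨
        2 * l * (u * s) ≤⟨ *-monoʳ-≤ (2 * l) first-moment ⟩
        2 * l * ∑ M representations ≡⟨ ∑-*ˡ M (2 * l) representations ⟨
        ∑ M (λ c → 2 * l * representations c) ≤⟨ ∑-mono M (λ c _ → am-gm l (representations c)) ⟩
        ∑ M (λ c → representations c * representations c + l * l) ≡⟨ trans (∑-+ M _ _) (cong (∑ M (λ c → representations c * representations c) +_) (∑-const M (l * l))) ⟩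
        ∑ M (λ c → representations c * representations c) + M * (l * l)
          ≤⟨ +-mono-≤ second-moment (≤-trans (≤-reflexive (lem M l)) (*-monoʳ-≤ l Ml≤us)) ⟩
        ∑∈ W (λ x → ∑∈ W (collisions x)) + l * (u * s) ∎)
        where
        open ≤-Reasoning
        lem : ∀ M l → M * (l * l) ≡ l * (M * l)
        lem = solve-∀
        square : ∀ a d → 2 * a * (a + d) ≤ (a + d) * (a + d) + a * a
        square a d = ≤-trans (m≤m+n _ (d * d)) (≤-reflexive (eq a d))
          where eq : ∀ a d → 2 * a * (a + d) + d * d ≡ (a + d) * (a + d) + a * a
                eq = solve-∀
        am-gm : ∀ a b → 2 * a * b ≤ b * b + a * a
        am-gm a b with ≤-total a b
        ... | inj₁ a≤b = subst (λ b → 2 * a * b ≤ b * b + a * a) (m+[n∸m]≡n a≤b) (square a (b ∸ a))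
        ... | inj₂ b≤a = subst (λ a → 2 * a * b ≤ b * b + a * a) (m+[n∸m]≡n b≤a)
                (≤-trans (≤-reflexive (comm b (b + (a ∸ b)))) (≤-trans (square b (a ∸ b)) (≤-reflexive (+-comm _ (b * b)))))
          where comm : ∀ b a → 2 * a * b ≡ 2 * b * a
                comm = solve-∀

      -- With at least 2 + l representations per sum on average, Cauchy-Schwarz gives (2 + l) s
      -- collisions per vertex on average. At most 2s per vertex are no adjacencies: s on the
      -- diagonal and s from the elements of W in T.
      high-degree : ∀ l → 1 ≤ u → M * (2 + l) ≤ u * s → ∃[ x ] x ∈ W × l * s ≤ degree W x
      high-degree l 1≤u h =
        let (x , x∈ , d) = average W 1≤u (≤-trans (≤-reflexive (lem₁ u l s)) (≤-trans (collisions≥ (2 + l) h) total-collisions≤))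
        in x , x∈ , +-cancelʳ-≤ (s + s) _ _ (≤-trans (≤-reflexive (lem₂ l s)) d)
        where
        lem₁ : ∀ u l s → u * ((2 + l) * s) ≡ (2 + l) * (u * s)
        lem₁ = solve-∀
        lem₂ : ∀ l s → l * s + (s + s) ≡ (2 + l) * s
        lem₂ = solve-∀
        f : ℕ → ℕ
        f x = degree W x + (s + s)
        average : ∀ V → 1 ≤ length V → length V * ((2 + l) * s) ≤ ∑∈ V f → ∃[ x ] x ∈ V × (2 + l) * s ≤ f x
        average (y ∷ ys) _ = ∑∈-exists y ys f ((2 + l) * s)

-- The Kleitman-Winston container argument

module Containers where

  open import Data.List using (filter)
  open import Data.List.Properties using (length-filter)
  open import Data.List.Membership.Propositional using (_∈_; find)
  open import Data.List.Membership.Propositional.Properties using (∈-∃++; ∈-filter⁻)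
  open import Data.List.Relation.Unary.Any using (here; there)
  open import Data.List.Relation.Unary.AllPairs using ([]; _∷_)
  open import Data.List.Relation.Unary.Unique.Propositional using (Unique)
  import Data.List.Relation.Unary.Unique.Propositional.Properties as Unique
  open import Data.List.Relation.Binary.Permutation.Propositional as ↭ using (_↭_; refl; prep; swap; ↭-sym; ↭⇒↭ₛ)
  open import Data.List.Relation.Binary.Permutation.Propositional.Properties using (shift; ↭-length; ∈-resp-↭; ++⁺ˡ)
  open import Data.List.Relation.Binary.Permutation.Setoid.Properties (setoid ℕ) using () renaming (Unique-resp-↭ to Unique-resp-↭ₛ)
  open import Relation.Nullary.Decidable using (¬?)
  open Sums
  open PrimePowerSums
  open SublistSums
  open SidonGraphs

  Unique-resp-↭ : ∀ {xs ys : List ℕ} → xs ↭ ys → Unique xs → Unique ys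
  Unique-resp-↭ p = Unique-resp-↭ₛ (↭⇒↭ₛ p)

  module KleitmanWinston (T : List ℕ) (uT : Unique T) (sT : SidonList T) (r n b′ R X : ℕ) (U : List ℕ) where
    open Graph T uT sT

    b : ℕ
    b = suc b′

    -- The Sidon sets containing T, restricted to at most r further elements.
    g : List ℕ → ℕ
    g B = sidon-weight (T ++ B) * few r B

    F : List ℕ → ℕ
    F W = ∑⊆ W g

    _⊑U : List ℕ → Set
    W ⊑U = ∀ {x} → x ∈ W → x ∈ U

    private
      g-sym : Symmetric g
      g-sym {A} {B} p = cong₂ _*_ (sidon-weight-sym (++⁺ˡ T p)) (cong (λ l → ⟦ l ≤? r ⟧) (↭-length p))

      g-remove : ∀ x B → g (x ∷ B) ≤ g B
      g-remove x B = *-mono-≤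
        (⟦⟧-mono (sidonList? (T ++ x ∷ B)) (sidonList? (T ++ B)) (sidonList-⊆ λ h → ∈-resp-↭ (↭-sym (shift x T B)) (there h)))
        (⟦⟧-mono (suc (length B) ≤? r) (length B ≤? r) <⇒≤)

      g-adjacent : ∀ x B y → y ∈ B → ¬ ¬ Adj x y → g (x ∷ B) ≡ 0
      g-adjacent x B y y∈ ¬¬a = cong (_* few r (x ∷ B)) (⟦⟧-no (sidonList? (T ++ x ∷ B)) λ sid →
        ¬¬a λ a → adj-conflict (here refl) (there y∈) a sid)

      ∑∈-↭ : ∀ {xs ys} (f : ℕ → ℕ) → xs ↭ ys → ∑∈ xs f ≡ ∑∈ ys f
      ∑∈-↭ f refl = refl
      ∑∈-↭ f (prep x p) = cong (f x +_) (∑∈-↭ f p)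
      ∑∈-↭ {ys = _ ∷ _ ∷ ys} f (swap x y p) = trans (cong (λ t → f x + (f y + t)) (∑∈-↭ f p)) (lem (f x) (f y) (∑∈ ys f))
        where lem : ∀ a b c → a + (b + c) ≡ b + (a + c)
              lem = solve-∀
      ∑∈-↭ f (↭.trans p q) = trans (∑∈-↭ f p) (∑∈-↭ f q)

      nonadj : ℕ → List ℕ → List ℕ
      nonadj x W = filter (λ y → ¬? (adj? x y)) W

      nonadj-length : ∀ x W → length (nonadj x W) + degree W x ≡ length W
      nonadj-length x W = begin
        length (nonadj x W) + degree W x ≡⟨ cong (_+ degree W x) (∑∈-filter (λ y → ¬? (adj? x y)) W) ⟩
        ∑∈ W (λ y → ⟦ ¬? (adj? x y) ⟧) + ∑∈ W (λ y → ⟦ adj? x y ⟧) ≡⟨ ∑∈-+ W _ _ ⟨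
        ∑∈ W (λ y → ⟦ ¬? (adj? x y) ⟧ + ⟦ adj? x y ⟧) ≡⟨ ∑∈-cong W (λ y → complement (adj? x y)) ⟩
        ∑∈ W (λ _ → 1) ≡⟨ trans (∑∈-const W 1) (*-identityʳ _) ⟩
        length W ∎
        where
        open ≡-Reasoning
        complement : ∀ {P : Set} (d : Dec P) → ⟦ ¬? d ⟧ + ⟦ d ⟧ ≡ 1
        complement (yes _) = refl
        complement (no _) = refl

      irreflexive : ∀ x → ¬ Adj x x
      irreflexive x a = let (_ , _ , a′) = find a ; (_ , _ , _ , x≢x , _) = find a′ in x≢x refl

      -- Either x is taken, which excludes its neighbours, or it is not. Once taken, x itself can be
      -- forgotten, since removing an element never decreases `g`.
      F-step : ∀ x W → F (x ∷ W) ≤ F (nonadj x W) + F W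
      F-step x W = +-monoˡ-≤ (F W) (≤-trans (∑⊆-filter (λ y → ¬? (adj? x y)) W (g ∘ (x ∷_)) (λ A y → g-adjacent x A y))
                                             (∑⊆-mono (nonadj x W) (g-remove x)))

      F≤ : ∀ W → F W ≤ ∑⊆ W (few r)
      F≤ W = ∑⊆-mono W λ B → ≤-trans (*-monoˡ-≤ (few r B) (⟦⟧≤1 (sidonList? (T ++ B)))) (≤-reflexive (*-identityˡ _))

    module _ (few≤X : ∀ W → length W ≤ R → ∑⊆ W (few r) ≤ X)
             (dense : ∀ W → Unique W → W ⊑U → R < length W → ∃[ x ] x ∈ W × length W ≤ b * degree W x) where

      -- Taking a high-degree vertex multiplies the set by at most b′/b, and q such choices bring it
      -- down to size R. Between two choices rejected vertices are deleted singly, so there are at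
      -- most n + 1 possibilities for what happens next, whence the factor (n + 1)^q.
      shrink : ∀ q W → Unique W → W ⊑U → length W ≤ n → length W * b′ ^ q ≤ R * b ^ q → F W ≤ suc n ^ q * X
      shrink zero W _ _ _ h = ≤-trans (F≤ W) (≤-trans (few≤X W (subst₂ _≤_ (*-identityʳ _) (*-identityʳ _) h)) (≤-reflexive (sym (*-identityˡ X))))
      shrink (suc q) W uW sub W≤n h = ≤-trans (inner (length W) W refl uW sub W≤n h)
        (≤-trans (*-monoˡ-≤ (suc n ^ q * X) (s≤s W≤n)) (≤-reflexive (sym (*-assoc (suc n) (suc n ^ q) X))))
        where
        open ≤-Reasoning
        Y = suc n ^ q * X
        X≤Y : X ≤ Y
        X≤Y = m≤n*m X (suc n ^ q) {{m^n≢0 (suc n) q}}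
        inner : ∀ l W → length W ≡ l → Unique W → W ⊑U → length W ≤ n → length W * b′ ^ suc q ≤ R * b ^ suc q → F W ≤ suc l * Y
        inner l W len uW sub W≤n h with length W ≤? R
        ... | yes W≤R = ≤-trans (F≤ W) (≤-trans (few≤X W W≤R) (≤-trans X≤Y (m≤m+n Y (l * Y))))
        ... | no W≰R with dense W uW sub (≰⇒> W≰R)
        inner zero [] len uW sub W≤n h | no W≰R | x , () , deg
        inner (suc l) W len uW sub W≤n h | no W≰R | x , x∈ , deg with ∈-∃++ x∈
        ... | as , bs , refl = begin
          F W ≡⟨ ∑⊆-↭ g g-sym p ⟩
          F (x ∷ W′) ≤⟨ F-step x W′ ⟩
          F (nonadj x W′) + F W′
            ≤⟨ +-mono-≤ (shrink q (nonadj x W′) (Unique.filter⁺ _ uW′) (λ y∈ → sub′ (proj₁ (∈-filter⁻ (λ y → ¬? (adj? x y)) {xs = W′} y∈)))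
                          (≤-trans (length-filter _ W′) W′≤n) smaller)
                        (inner l W′ (suc-injective (trans (sym (↭-length p)) len)) uW′ sub′ W′≤n (≤-trans (*-monoˡ-≤ (b′ ^ suc q) W′≤W) h)) ⟩
          Y + suc l * Y ∎
          where
          W′ = as ++ bs
          p : as ++ x ∷ bs ↭ x ∷ W′
          p = shift x as bs
          uW′ : Unique W′
          uW′ = Unique-tail (Unique-resp-↭ p uW)
          sub′ : W′ ⊑U
          sub′ y∈ = sub (∈-resp-↭ (↭-sym p) (there y∈))
          W′≤W : length W′ ≤ length W
          W′≤W = ≤-trans (n≤1+n _) (≤-reflexive (sym (↭-length p)))
          W′≤n : length W′ ≤ n
          W′≤n = ≤-trans W′≤W W≤n
          m = length (nonadj x W′)
          -- `dense` speaks of the degree in W, which still contains x, but the neighbours are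
          -- removed from W′; the two degrees agree since x is not adjacent to itself.
          deg′ : degree W x ≡ degree W′ x
          deg′ = trans (∑∈-↭ (λ y → ⟦ adj? x y ⟧) p) (cong (_+ degree W′ x) (⟦⟧-no (adj? x x) (irreflexive x)))
          bm≤ : b * m ≤ b′ * length W
          bm≤ = +-cancelʳ-≤ (length W) _ _ (begin
            b * m + length W ≤⟨ +-monoʳ-≤ (b * m) deg ⟩
            b * m + b * degree W x ≡⟨ cong (λ t → b * m + b * t) deg′ ⟩
            b * m + b * degree W′ x ≡⟨ *-distribˡ-+ b m (degree W′ x) ⟨
            b * (m + degree W′ x) ≡⟨ cong (b *_) (nonadj-length x W′) ⟩
            b * length W′ ≤⟨ *-monoʳ-≤ b W′≤W ⟩
            length W + b′ * length W ≡⟨ +-comm (length W) _ ⟩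
            b′ * length W + length W ∎)
          smaller : m * b′ ^ q ≤ R * b ^ q
          smaller = *-cancelˡ-≤ b (begin
            b * (m * b′ ^ q) ≡⟨ *-assoc b m (b′ ^ q) ⟨
            b * m * b′ ^ q ≤⟨ *-monoˡ-≤ (b′ ^ q) bm≤ ⟩
            b′ * length W * b′ ^ q ≡⟨ lem b′ (length W) (b′ ^ q) ⟩
            length W * b′ ^ suc q ≤⟨ h ⟩
            R * b ^ suc q ≡⟨ lem′ R b (b ^ q) ⟩
            b * (R * b ^ q) ∎)
            where
            lem : ∀ b w c → b * w * c ≡ w * (b * c)
            lem = solve-∀
            lem′ : ∀ r b c → r * (b * c) ≡ b * (r * c)
            lem′ = solve-∀

      -- (1 + 1/b′)^b ≥ 2, so b L rounds shrink any set of at most 2^L elements below R.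
      private
        growth : ∀ z k → z ^ k * (z + k) ≤ suc z ^ k * z
        growth z zero = ≤-reflexive (cong (1 *_) (+-identityʳ z))
        growth z (suc k) = begin
          z * z ^ k * (z + suc k) ≡⟨ lem₁ z (z ^ k) k ⟩
          z ^ k * (z * z + z * k + z) ≤⟨ *-monoʳ-≤ (z ^ k) (≤-trans (m≤m+n _ k) (≤-reflexive (lem₂ z k))) ⟩
          z ^ k * ((z + k) * suc z) ≡⟨ *-assoc (z ^ k) (z + k) (suc z) ⟨
          z ^ k * (z + k) * suc z ≤⟨ *-monoˡ-≤ (suc z) (growth z k) ⟩
          suc z ^ k * z * suc z ≡⟨ lem₃ (suc z ^ k) z (suc z) ⟩
          suc z * suc z ^ k * z ∎
          where
          open ≤-Reasoning
          lem₁ : ∀ z a k → z * a * (z + suc k) ≡ a * (z * z + z * k + z)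
          lem₁ = solve-∀
          lem₂ : ∀ z k → z * z + z * k + z + k ≡ (z + k) * suc z
          lem₂ = solve-∀
          lem₃ : ∀ a z s → a * z * s ≡ s * a * z
          lem₃ = solve-∀

        two : ∀ z → 2 * z ^ suc z ≤ suc z ^ suc z
        two zero = z≤n
        two z@(suc _) = *-cancelʳ-≤ _ _ z (≤-trans (≤-reflexive (lem z (z ^ suc z)))
            (≤-trans (*-monoʳ-≤ (z ^ suc z) (+-monoʳ-≤ z (n≤1+n z))) (growth z (suc z))))
          where lem : ∀ z a → 2 * a * z ≡ a * (z + z)
                lem = solve-∀

      container : ∀ L W → n ≤ 2 ^ L → 1 ≤ R → Unique W → W ⊑U → length W ≤ n → F W ≤ suc n ^ (b * L) * X
      container L W n≤ 1≤R uW sub W≤n = shrink (b * L) W uW sub W≤n (begin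
        length W * b′ ^ (b * L) ≤⟨ *-monoˡ-≤ (b′ ^ (b * L)) (≤-trans W≤n n≤) ⟩
        2 ^ L * b′ ^ (b * L) ≡⟨ cong (2 ^ L *_) (^-*-assoc b′ b L) ⟨
        2 ^ L * (b′ ^ b) ^ L ≡⟨ ^-distrib-* 2 (b′ ^ b) L ⟨
        (2 * b′ ^ b) ^ L ≤⟨ ^-monoˡ-≤ L (two b′) ⟩
        (b ^ b) ^ L ≡⟨ ^-*-assoc b b L ⟩
        b ^ (b * L) ≤⟨ m≤n*m (b ^ (b * L)) R {{>-nonZero 1≤R}} ⟩
        R * b ^ (b * L) ∎)
        where open ≤-Reasoning

-- The upper bound: doubling the size up to √n

module UpperBound where

  open import Data.List.Membership.Propositional using (_∈_)
  open import Data.List.Membership.Propositional.Properties using (∈-++⁺ˡ)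
  open import Data.List.Properties using (length-++)
  import Data.List.Relation.Unary.All as All
  open import Data.List.Relation.Unary.AllPairs using ([]; _∷_)
  open import Data.List.Relation.Unary.Unique.Propositional using (Unique)
  open Sums
  open PrimePowerSums
  open FactorialSums using (≤-/)
  open PrimeWindows using (poly<exp; n<2^n)
  open SublistSums
  open SidonGraphs
  open Containers

  interval-length : ∀ a n → length (interval a n) ≡ n
  interval-length a zero = refl
  interval-length a (suc n) = cong suc (interval-length (suc a) n)

  interval-unique : ∀ a n → Unique (interval a n)
  interval-unique a zero = []
  interval-unique a (suc n) = All.tabulate (λ x∈ → <⇒≢ (proj₁ (interval⁻ (suc a) n x∈))) ∷ interval-unique (suc a) n

  ∑⊆-mono-length : ∀ U {v w : List ℕ → ℕ} → (∀ A → length A ≤ length U → v A ≤ w A) → ∑⊆ U v ≤ ∑⊆ U w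
  ∑⊆-mono-length [] h = h [] z≤n
  ∑⊆-mono-length (x ∷ U) h = +-mono-≤ (∑⊆-mono-length U (λ A l → h (x ∷ A) (s≤s l))) (∑⊆-mono-length U (λ A l → h A (m≤n⇒m≤1+n l)))

  module Upper (n : ℕ) where

    U : List ℕ
    U = interval 1 n

    small-sidon : ℕ → ℕ
    small-sidon s = ∑⊆ U λ A → sidon-weight A * few s A

    -- Sidon sets with at most s + r elements are Sidon sets T of size s together with at most r further elements.
    phase : ∀ s r b′ R X L → 1 ≤ X → 1 ≤ R → n ≤ 2 ^ L → 3 * suc (n + n) ≤ R * s → 4 * suc (n + n) ≤ suc b′ * (s * s) →
            (∀ W → length W ≤ R → ∑⊆ W (few r) ≤ X) → small-sidon (s + r) ≤ small-sidon s * (suc n ^ (suc b′ * L) * X)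
    phase s r b′ R X L 1≤X 1≤R n≤ 3M≤ 4M≤ few≤X = begin
      ∑⊆ U w ≤⟨ ∑⊆-split U s w ⟩
      ∑⊆ U (λ A → ⟦ length A <? s ⟧ * w A) + ∑⊆ U (λ A → ⟦ length A ≟ s ⟧ * ∑⊆ U (λ B → w (A ++ B))) ≡⟨ ∑⊆-+ U _ _ ⟨
      ∑⊆ U (λ A → ⟦ length A <? s ⟧ * w A + ⟦ length A ≟ s ⟧ * ∑⊆ U (λ B → w (A ++ B)))
        ≤⟨ ∑⊆-mono-unique U (interval-unique 1 n) (λ A sub uA → pointwise A sub uA (<-cmp (length A) s)) ⟩
      ∑⊆ U (λ A → sidon-weight A * few s A * Y) ≡⟨ ∑⊆-*ʳ U Y _ ⟩
      small-sidon s * Y ∎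
      where
      open ≤-Reasoning
      open import Relation.Binary.Definitions using (Tri; tri<; tri≈; tri>)
      M Y : ℕ
      M = suc (n + n)
      Y = suc n ^ (suc b′ * L) * X
      w : List ℕ → ℕ
      w A = sidon-weight A * few (s + r) A
      1≤Y : 1 ≤ Y
      1≤Y = *-mono-≤ (m^n>0 (suc n) (suc b′ * L)) 1≤X

      s≢0 : 1 ≤ s
      s≢0 = ≮⇒≥ λ s<1 → <⇒≱ (s≤s z≤n) (≤-trans 3M≤ (≤-trans (*-monoʳ-≤ R (≤-pred s<1)) (≤-reflexive (*-zeroʳ R))))

      module Extensions (T : List ℕ) (uT : Unique T) (sT : SidonList T) (T⊆U : ∀ {x} → x ∈ T → x ∈ U) (len : length T ≡ s) where
        open KleitmanWinston T uT sT r n b′ R X U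
        open Graph T uT sT using (degree; module Count)

        dense : ∀ W → Unique W → W ⊑U → R < length W → ∃[ x ] x ∈ W × length W ≤ b * degree W x
        dense W uW sub R<W =
          let (x , x∈ , d) = Count.high-degree W uW M small l (≤-trans (s≤s z≤n) R<W) Ml≤ in
          x , x∈ , ≤-trans (*-cancelʳ-≤ u (b * (l * s)) (s * s) {{m*n≢0 s s {{>-nonZero s≢0}} {{>-nonZero s≢0}}}} (begin
            u * (s * s) ≡⟨ *-assoc u s s ⟨
            u * s * s ≤⟨ *-monoˡ-≤ s us≤ ⟩
            4 * M * l * s ≤⟨ *-monoˡ-≤ s (*-monoˡ-≤ l 4M≤) ⟩
            b * (s * s) * l * s ≡⟨ lem b s l ⟩
            b * (l * s) * (s * s) ∎)) (*-monoʳ-≤ b (subst (λ t → l * t ≤ degree W x) len d))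
          where
          u = length W
          -- From 3M ≤ u s follow l ≥ 1 and u s ≤ M (l + 3) ≤ 4 M l. The vertex found has degree at
          -- least l s ≥ u s²/(4M), which is at least u/b by 4M ≤ b s².
          l = u * s / M ∸ 2
          3M≤us : 3 * M ≤ u * s
          3M≤us = ≤-trans 3M≤ (*-monoˡ-≤ s (<⇒≤ R<W))
          3≤q : 3 ≤ u * s / M
          3≤q = ≤-/ 3 M (u * s) 3M≤us
          q≡ : 2 + l ≡ u * s / M
          q≡ = m+[n∸m]≡n (≤-trans (n≤1+n 2) 3≤q)
          1≤l : 1 ≤ l
          1≤l = +-cancelˡ-≤ 2 1 l (≤-trans 3≤q (≤-reflexive (sym q≡)))
          Ml≤ : M * (2 + l) ≤ u * length T
          Ml≤ = subst₂ (λ a t → M * a ≤ u * t) (sym q≡) (sym len) (≤-trans (≤-reflexive (*-comm M _)) (m/n*n≤m (u * s) M))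
          us≤ : u * s ≤ 4 * M * l
          us≤ = begin
            u * s ≡⟨ m≡m%n+[m/n]*n (u * s) M ⟩
            u * s % M + u * s / M * M ≤⟨ +-monoˡ-≤ _ (m%n≤n (u * s) M) ⟩
            M + u * s / M * M ≡⟨ cong (λ t → M + t * M) (sym q≡) ⟩
            M + (2 + l) * M ≡⟨ lem₁ M l ⟩
            3 * M * 1 + M * l ≤⟨ +-monoˡ-≤ (M * l) (*-monoʳ-≤ (3 * M) 1≤l) ⟩
            3 * M * l + M * l ≡⟨ lem₂ M l ⟩
            4 * M * l ∎
            where
            lem₁ : ∀ M l → M + (2 + l) * M ≡ 3 * M * 1 + M * l
            lem₁ = solve-∀
            lem₂ : ∀ M l → 3 * M * l + M * l ≡ 4 * M * l
            lem₂ = solve-∀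
          lem : ∀ b s l → b * (s * s) * l * s ≡ b * (l * s) * (s * s)
          lem = solve-∀
          small : ∀ {x t} → x ∈ W → t ∈ T → x + t < M
          small x∈ t∈ = s≤s (+-mono-≤ (≤-pred (proj₂ (interval⁻ 1 n (sub x∈)))) (≤-pred (proj₂ (interval⁻ 1 n (T⊆U t∈)))))

        bound : ∑⊆ U (λ B → w (T ++ B)) ≤ Y
        bound = ≤-trans (∑⊆-mono U λ B → *-monoʳ-≤ (sidon-weight (T ++ B)) (⟦⟧-mono (length (T ++ B) ≤? s + r) (length B ≤? r)
            λ h → +-cancelˡ-≤ s _ _ (subst (_≤ s + r) (trans (length-++ T) (cong (_+ length B) len)) h)))
          (container few≤X dense L U n≤ 1≤R (interval-unique 1 n) id (≤-reflexive (interval-length 1 n)))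

      pointwise : ∀ A → (∀ {x} → x ∈ A → x ∈ U) → Unique A → Tri (length A < s) (length A ≡ s) (length A > s) →
        ⟦ length A <? s ⟧ * w A + ⟦ length A ≟ s ⟧ * ∑⊆ U (λ B → w (A ++ B)) ≤ sidon-weight A * few s A * Y
      pointwise A sub uA (tri< a<s a≢s _) rewrite ⟦⟧-yes (length A <? s) a<s | ⟦⟧-no (length A ≟ s) a≢s | ⟦⟧-yes (length A ≤? s) (<⇒≤ a<s) = begin
        1 * w A + 0 ≡⟨ trans (+-identityʳ _) (*-identityˡ _) ⟩
        sidon-weight A * few (s + r) A ≤⟨ *-monoʳ-≤ (sidon-weight A) (⟦⟧≤1 (length A ≤? s + r)) ⟩
        sidon-weight A * 1 ≡⟨ *-identityʳ _ ⟨
        sidon-weight A * 1 * 1 ≤⟨ *-monoʳ-≤ (sidon-weight A * 1) 1≤Y ⟩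
        sidon-weight A * 1 * Y ∎
      pointwise A sub uA (tri> a≮s a≢s _) rewrite ⟦⟧-no (length A <? s) a≮s | ⟦⟧-no (length A ≟ s) a≢s = z≤n
      pointwise A sub uA (tri≈ a≮s a≡s _) rewrite ⟦⟧-no (length A <? s) a≮s | ⟦⟧-yes (length A ≟ s) a≡s | ⟦⟧-yes (length A ≤? s) (≤-reflexive a≡s) = begin
        0 + 1 * ∑⊆ U (λ B → w (A ++ B)) ≡⟨ *-identityˡ _ ⟩
        ∑⊆ U (λ B → w (A ++ B)) ≤⟨ inner (sidonList? A) ⟩
        ⟦ sidonList? A ⟧ * Y ≡⟨ cong (_* Y) (*-identityʳ ⟦ sidonList? A ⟧) ⟨
        ⟦ sidonList? A ⟧ * 1 * Y ∎
        where
        inner : (d : Dec (SidonList A)) → ∑⊆ U (λ B → w (A ++ B)) ≤ ⟦ d ⟧ * Y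
        inner (yes sA) = ≤-trans (Extensions.bound A uA sA sub a≡s) (≤-reflexive (sym (*-identityˡ Y)))
        inner (no ¬sA) = ≤-reflexive (trans (∑⊆-cong U λ B → cong (_* few (s + r) (A ++ B)) (⟦⟧-no (sidonList? (A ++ B)) λ h → ¬sA (sidonList-⊆ ∈-++⁺ˡ h)))
                                            (∑⊆-0 U))

    module Exponents (J : ℕ) (n< : n < 2 ^ (2 + J + J)) where

      L : ℕ
      L = 2 + J + J

      M≤ : suc (n + n) ≤ 8 * 2 ^ (J + J)
      M≤ = ≤-trans (+-mono-≤ n< (<⇒≤ n<)) (≤-reflexive (lem (2 ^ (J + J))))
        where lem : ∀ t → 2 * (2 * t) + 2 * (2 * t) ≡ 8 * t
              lem = solve-∀

      suc-n^ : ∀ k → suc n ^ (k * L) ≤ 2 ^ (L * (k * L))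
      suc-n^ k = ≤-trans (^-monoˡ-≤ (k * L) n<) (≤-reflexive (^-*-assoc 2 L (k * L)))

      4^_ : ℕ → ℕ
      4^ i = 2 ^ (i + i)

      module _ (i j : ℕ) (J≡ : J ≡ i + j) where
        private
          p q : ℕ
          p = 2 ^ i
          q = 2 ^ j
          pp : 4^ i ≡ p * p
          pp = ^-distribˡ-+-* 2 i i
          JJ : 2 ^ (J + J) ≡ (p * q) * (p * q)
          JJ = trans (^-distribˡ-+-* 2 J J) (cong (λ t → t * t) (trans (cong (2 ^_) J≡) (^-distribˡ-+-* 2 i j)))
          b≢0 : NonZero (32 * 4^ i)
          b≢0 = m*n≢0 32 (4^ i) {{_}} {{m^n≢0 2 (i + i)}}
          b≡ : suc (pred (32 * 4^ i)) ≡ 32 * 4^ i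
          b≡ = suc-pred (32 * 4^ i) {{b≢0}}

        -- Here s = q = 2^j falls short of 2^J, which has the order of √n, by the factor p = 2^i.
        -- From 2n + 1 ≤ 8 · 4^J = 8 p² q², the container size 24 p² q = 3 · 8 p² q²/s and b = 32 p²
        -- = 4 · 8 p² q²/s² are what `phase` requires.
        phase′ : ∀ r X → 1 ≤ X → (∀ W → length W ≤ 24 * (p * p * q) → ∑⊆ W (few r) ≤ X) →
                 small-sidon (q + r) ≤ small-sidon q * (2 ^ (L * (32 * 4^ i * L)) * X)
        phase′ r X 1≤X few≤X = ≤-trans
          (phase q r (pred (32 * 4^ i)) (24 * (p * p * q)) X L 1≤X
            (*-mono-≤ (s≤s (z≤n {23})) (*-mono-≤ (*-mono-≤ (m^n>0 2 i) (m^n>0 2 i)) (m^n>0 2 j))) (<⇒≤ n<)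
            (≤-trans (*-monoʳ-≤ 3 M≤) (≤-reflexive (trans (cong (λ t → 3 * (8 * t)) JJ) (lem₁ p q))))
            (≤-trans (*-monoʳ-≤ 4 M≤) (≤-reflexive (trans (cong (λ t → 4 * (8 * t)) JJ) (trans (lem₂ p q) (cong (_* (q * q)) (trans (cong (32 *_) (sym pp)) (sym b≡)))))))
            few≤X)
          (*-monoʳ-≤ (small-sidon q) (*-monoˡ-≤ X (≤-trans (≤-reflexive (cong (λ t → suc n ^ (t * L)) b≡)) (suc-n^ (32 * 4^ i)))))
          where
          lem₁ : ∀ p q → 3 * (8 * ((p * q) * (p * q))) ≡ 24 * (p * p * q) * q
          lem₁ = solve-∀
          lem₂ : ∀ p q → 4 * (8 * ((p * q) * (p * q))) ≡ 32 * (p * p) * (q * q)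
          lem₂ = solve-∀

        -- Containers of size 24 p² q = 8 p² · 3q admit at most (16 p²)^q 2^(3q) = 2^((7 + 2i) q)
        -- selections of at most q elements, by `few-bound`.
        doubling : small-sidon (2 ^ suc j) ≤ small-sidon (2 ^ j) * 2 ^ (L * (32 * 4^ i * L) + (7 + (i + i)) * q)
        doubling = ≤-trans (≤-reflexive (cong (λ t → small-sidon (q + t)) (+-identityʳ q)))
          (≤-trans (phase′ q (2 ^ ((7 + (i + i)) * q)) (m^n>0 2 ((7 + (i + i)) * q)) few≤X)
            (≤-reflexive (cong (small-sidon q *_) (sym (^-distribˡ-+-* 2 (L * (32 * 4^ i * L)) _)))))
          where
          open ≤-Reasoning
          lem : ∀ p q → 24 * (p * p * q) ≡ 8 * (p * p) * (3 * q)
          lem = solve-∀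
          few≤X : ∀ W → length W ≤ 24 * (p * p * q) → ∑⊆ W (few q) ≤ 2 ^ ((7 + (i + i)) * q)
          few≤X W h = begin
            ∑⊆ W (few q) ≤⟨ few-bound W q (8 * (p * p)) (3 * q) (*-mono-≤ (s≤s (z≤n {7})) (*-mono-≤ (m^n>0 2 i) (m^n>0 2 i))) (≤-trans h (≤-reflexive (lem p q))) ⟩
            (8 * (p * p) + 8 * (p * p)) ^ q * 2 ^ (3 * q) ≡⟨ cong (λ t → t ^ q * 2 ^ (3 * q)) base ⟩
            (2 ^ (4 + (i + i))) ^ q * 2 ^ (3 * q) ≡⟨ cong (_* 2 ^ (3 * q)) (^-*-assoc 2 (4 + (i + i)) q) ⟩
            2 ^ ((4 + (i + i)) * q) * 2 ^ (3 * q) ≡⟨ ^-distribˡ-+-* 2 ((4 + (i + i)) * q) (3 * q) ⟨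
            2 ^ ((4 + (i + i)) * q + 3 * q) ≡⟨ cong (2 ^_) (lem′ i q) ⟩
            2 ^ ((7 + (i + i)) * q) ∎
            where
            lem′ : ∀ i q → (4 + (i + i)) * q + 3 * q ≡ (7 + (i + i)) * q
            lem′ = solve-∀
            lem″ : ∀ t → 8 * t + 8 * t ≡ 16 * t
            lem″ = solve-∀
            base : 8 * (p * p) + 8 * (p * p) ≡ 2 ^ (4 + (i + i))
            base = trans (lem″ (p * p)) (trans (cong (16 *_) (sym pp)) (sym (^-distribˡ-+-* 2 4 (i + i))))

      -- The case i = 0: containers have at most 24 · 2^J elements, and r = n admits every subset of
      -- them. This gives the largest single share of the exponent.
      final : numSidon n ≤ small-sidon (2 ^ J) * 2 ^ (L * (32 * L) + 24 * 2 ^ J)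
      final = begin
        numSidon n ≡⟨ numSidon≡ n ⟩
        ∑⊆ U sidon-weight ≤⟨ ∑⊆-mono-length U (λ A l → ≤-trans (≤-reflexive (sym (*-identityʳ _)))
           (*-monoʳ-≤ (sidon-weight A) (≤-reflexive (sym (⟦⟧-yes (length A ≤? 2 ^ J + n) (≤-trans (≤-trans l (≤-reflexive (interval-length 1 n))) (m≤n+m n (2 ^ J)))))))) ⟩
        small-sidon (2 ^ J + n) ≤⟨ phase′ 0 J refl n (2 ^ (24 * 2 ^ J)) (m^n>0 2 (24 * 2 ^ J)) (λ W h → ≤-trans (∑⊆-mono W (λ B → ⟦⟧≤1 (length B ≤? n)))
           (≤-trans (≤-reflexive (∑⊆-one W)) (^-monoʳ-≤ 2 (≤-trans h (≤-reflexive (cong (24 *_) (*-identityˡ (2 ^ J)))))))) ⟩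
        small-sidon (2 ^ J) * (2 ^ (L * (32 * L)) * 2 ^ (24 * 2 ^ J)) ≡⟨ cong (small-sidon (2 ^ J) *_) (^-distribˡ-+-* 2 (L * (32 * L)) _) ⟨
        small-sidon (2 ^ J) * 2 ^ (L * (32 * L) + 24 * 2 ^ J) ∎
        where open ≤-Reasoning

      start : ∀ s → small-sidon s ≤ 2 ^ (L * s)
      start s = begin
        small-sidon s ≤⟨ ∑⊆-mono U (λ A → ≤-trans (*-monoˡ-≤ (few s A) (⟦⟧≤1 (sidonList? A))) (≤-reflexive (*-identityˡ _))) ⟩
        ∑⊆ U (few s) ≤⟨ few≤ U s ⟩
        suc (length U) ^ s ≡⟨ cong (λ t → suc t ^ s) (interval-length 1 n) ⟩
        suc n ^ s ≤⟨ ^-monoˡ-≤ s n< ⟩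
        (2 ^ L) ^ s ≡⟨ ^-*-assoc 2 L s ⟩
        2 ^ (L * s) ∎
        where open ≤-Reasoning

      -- The cost of the high-degree choices is estimated at its worst, i = i₀, in every round: it
      -- is only a power of log n. The containers need the precise dependence on i.
      iterate : ∀ i₀ j₀ → J ≡ i₀ + j₀ → ∀ k i j → i + k ≡ i₀ → j ≡ k + j₀ →
                small-sidon (2 ^ j) ≤ 2 ^ (L * 2 ^ j₀ + k * (L * (32 * 4^ i₀ * L)) + (11 + (i + i)) * 2 ^ j)
      iterate i₀ j₀ J≡ zero i j i≡ refl = ≤-trans (start (2 ^ j₀)) (^-monoʳ-≤ 2 (≤-trans (m≤m+n (L * 2 ^ j₀) 0) (m≤m+n (L * 2 ^ j₀ + 0) _)))
      iterate i₀ j₀ J≡ (suc k) i j i≡ refl = begin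
        small-sidon (2 ^ suc (k + j₀)) ≤⟨ doubling (suc i) (k + j₀) (trans J≡ (trans (cong (_+ j₀) (sym i′≡)) (+-assoc (suc i) k j₀))) ⟩
        small-sidon q * 2 ^ (L * (32 * 4^ (suc i) * L) + (7 + (suc i + suc i)) * 2 ^ (k + j₀))
          ≤⟨ *-mono-≤ (iterate i₀ j₀ J≡ k (suc i) (k + j₀) i′≡ refl) (^-monoʳ-≤ 2 (+-monoˡ-≤ _ (*-monoʳ-≤ L (*-monoˡ-≤ L (*-monoʳ-≤ 32 (^-monoʳ-≤ 2 (+-mono-≤ i<i₀ i<i₀))))))) ⟩
        2 ^ (A + k * P + (11 + (suc i + suc i)) * Q) * 2 ^ (P + (7 + (suc i + suc i)) * Q) ≡⟨ ^-distribˡ-+-* 2 (A + k * P + (11 + (suc i + suc i)) * Q) _ ⟨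
        -- The constant 11 solves the recursion exactly: (11 + 2(i + 1)) + (7 + 2(i + 1)) = 2 (11 +
        -- 2i).
        2 ^ (A + k * P + (11 + (suc i + suc i)) * Q + (P + (7 + (suc i + suc i)) * Q)) ≡⟨ cong (2 ^_) (lem A k P i Q) ⟩
        2 ^ (A + suc k * P + (11 + (i + i)) * (2 * Q)) ∎
        where
        open ≤-Reasoning
        A = L * 2 ^ j₀
        P = L * (32 * 4^ i₀ * L)
        Q = 2 ^ (k + j₀)
        q = 2 ^ (k + j₀)
        i′≡ : suc i + k ≡ i₀
        i′≡ = trans (sym (+-suc i k)) i≡
        i<i₀ : suc i ≤ i₀
        i<i₀ = ≤-trans (m≤m+n (suc i) k) (≤-reflexive i′≡)
        lem : ∀ A k P i Q → A + k * P + (11 + (suc i + suc i)) * Q + (P + (7 + (suc i + suc i)) * Q) ≡ A + (P + k * P) + (11 + (i + i)) * (2 * Q)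
        lem = solve-∀

      total-exponent : ∀ i₀ j₀ → J ≡ i₀ + j₀ →
        numSidon n ≤ 2 ^ (L * 2 ^ j₀ + i₀ * (L * (32 * 4^ i₀ * L)) + 11 * 2 ^ J + (L * (32 * L) + 24 * 2 ^ J))
      total-exponent i₀ j₀ J≡ = ≤-trans final (≤-trans (*-monoˡ-≤ _ (iterate i₀ j₀ J≡ i₀ 0 J refl J≡)) (≤-reflexive (sym (^-distribˡ-+-* 2 (L * 2 ^ j₀ + i₀ * (L * (32 * 4^ i₀ * L)) + 11 * 2 ^ J) _))))

  exponent-sum : ∀ J .{{_ : NonZero J}} a c C → 4 * a * a * c + a * c * a ≤ C → ∀ L q i P t → L * q ≤ 2 * t → i ≤ J → L ≤ a * J → P ≤ (J + J) * (J + J) →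
    C * J ^ 5 ≤ t → L * q + i * (L * (c * P * L)) + 11 * t + (L * (c * L) + 24 * t) ≤ 55 * t
  exponent-sum J a c C ≤C L q i P t A≤ i≤J L≤aJ P≤ C≤ = begin
    L * q + i * (L * (c * P * L)) + 11 * t + (L * (c * L) + 24 * t)
      ≤⟨ +-mono-≤ (+-monoˡ-≤ (11 * t) (+-mono-≤ A≤ (*-mono-≤ i≤J (*-mono-≤ L≤aJ (*-mono-≤ (*-monoʳ-≤ c P≤) L≤aJ)))))
                  (+-monoˡ-≤ (24 * t) (*-mono-≤ L≤aJ (*-monoʳ-≤ c L≤aJ))) ⟩
    2 * t + J * (a * J * (c * ((J + J) * (J + J)) * (a * J))) + 11 * t + (a * J * (c * (a * J)) + 24 * t)
      ≡⟨ rearrange t (J * (a * J * (c * ((J + J) * (J + J)) * (a * J)))) (a * J * (c * (a * J))) ⟩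
    J * (a * J * (c * ((J + J) * (J + J)) * (a * J))) + a * J * (c * (a * J)) + 37 * t ≡⟨ cong (_+ 37 * t) (cong₂ _+_ (quintic J a c) (quadratic J a c)) ⟩
    4 * a * a * c * J ^ 5 + a * c * a * (J * J) + 37 * t
      ≤⟨ +-monoˡ-≤ (37 * t) (+-monoʳ-≤ (4 * a * a * c * J ^ 5) (*-monoʳ-≤ (a * c * a) (*-monoʳ-≤ J (m≤m*n J (J ^ 3) {{m^n≢0 J 3}})))) ⟩
    4 * a * a * c * J ^ 5 + a * c * a * J ^ 5 + 37 * t ≡⟨ cong (_+ 37 * t) (*-distribʳ-+ (J ^ 5) (4 * a * a * c) (a * c * a)) ⟨
    (4 * a * a * c + a * c * a) * J ^ 5 + 37 * t ≤⟨ +-monoˡ-≤ (37 * t) (≤-trans (*-monoˡ-≤ (J ^ 5) ≤C) C≤) ⟩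
    -- 37 = 2 + 11 + 24 collects the starting sets, the doublings and the last container; the terms
    -- polynomial in J fit into one further t.
    t + 37 * t ≤⟨ *-monoˡ-≤ t {38} {55} (m≤m+n 38 17) ⟩
    55 * t ∎
    where
    open ≤-Reasoning
    rearrange : ∀ t A B → 2 * t + A + 11 * t + (B + 24 * t) ≡ A + B + 37 * t
    rearrange = solve-∀
    quintic : ∀ J a c → J * (a * J * (c * ((J + J) * (J + J)) * (a * J))) ≡ 4 * a * a * c * (J * (J * (J * (J * (J * 1)))))
    quintic = solve-∀
    quadratic : ∀ J a c → a * J * (c * (a * J)) ≡ a * c * a * (J * J)
    quadratic = solve-∀

  upper-count : ∃[ N ] ∀ n → N ≤ n → ∃[ J ] 2 ^ (J + J) ≤ n × numSidon n ≤ 2 ^ (55 * 2 ^ J)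
  -- 2560 = 4 · 4 · 4 · 32 + 4 · 32 · 4, with a = 4 from L ≤ 4J and c = 32 from b = 32 · 4^i.
  upper-count = from-growth 2560 ≤-refl (poly<exp 5 2560)
    where
    from-growth : ∀ C → 4 * 4 * 4 * 32 + 4 * 32 * 4 ≤ C → ∃[ H ] (∀ h → H ≤ h → C * h ^ 5 < 2 ^ h) → ∃[ N ] ∀ n → N ≤ n → ∃[ J ] 2 ^ (J + J) ≤ n × numSidon n ≤ 2 ^ (55 * 2 ^ J)
    from-growth C ≤C (H , growth) = 2 ^ (2 + H + H) , λ n N≤n →
      let J = lg n / 2
          instance _ = >-nonZero (≤-trans (m^n>0 2 (2 + H + H)) N≤n)
      in J , ≤-trans (^-monoʳ-≤ 2 (lower n)) (lg-lower n) , bound n J (upper n) (≤-trans (s≤s z≤n) (H<J n N≤n)) (<⇒≤ (H<J n N≤n))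
      where
      open ≤-Reasoning
      lower : ∀ n → lg n / 2 + lg n / 2 ≤ lg n
      lower n = ≤-trans (≤-reflexive (lem (lg n / 2))) (m/n*n≤m (lg n) 2)
        where lem : ∀ q → q + q ≡ q * 2
              lem = solve-∀
      upper : ∀ n → n < 2 ^ (2 + lg n / 2 + lg n / 2)
      upper n = <-≤-trans (lg-upper n) (^-monoʳ-≤ 2 (s≤s (begin
        lg n ≡⟨ m≡m%n+[m/n]*n (lg n) 2 ⟩
        lg n % 2 + lg n / 2 * 2 ≤⟨ +-monoˡ-≤ _ (≤-pred (m%n<n (lg n) 2)) ⟩
        1 + lg n / 2 * 2 ≡⟨ lem (lg n / 2) ⟩
        suc (lg n / 2 + lg n / 2) ∎)))
        where lem : ∀ q → 1 + q * 2 ≡ suc (q + q)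
              lem = solve-∀
      H<J : ∀ n → 2 ^ (2 + H + H) ≤ n → H < lg n / 2
      H<J n N≤n = ≰⇒> λ J≤H → <⇒≱ (upper n) (≤-trans (^-monoʳ-≤ 2 (s≤s (s≤s (+-mono-≤ J≤H J≤H)))) N≤n)
      bound : ∀ n J → n < 2 ^ (2 + J + J) → 1 ≤ J → H ≤ J → numSidon n ≤ 2 ^ (55 * 2 ^ J)
      bound n J n< 1≤J H≤J = ≤-trans (total-exponent i₀ j₀ J≡) (^-monoʳ-≤ 2
        (exponent-sum J 4 32 C ≤C L (2 ^ j₀) i₀ (4^ i₀) (2 ^ J) A≤ i₀≤J L≤4J 4^i₀≤ (<⇒≤ (growth J H≤J))))
        where
        open Upper n
        open Exponents J n<
        instance _ = >-nonZero 1≤J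
        -- J < 2^i₀ ≤ 2J: large enough that arbitrary sets of at most 2^j₀ elements cost only L 2^j₀
        -- ≤ 2 · 2^J in the exponent, small enough that 4^i₀ is polynomial in J.
        i₀ j₀ : ℕ
        i₀ = suc (lg J)
        j₀ = J ∸ i₀
        i₀≤J : i₀ ≤ J
        i₀≤J = ≮⇒≥ λ J<i₀ → <⇒≱ (n<2^n J) (≤-trans (^-monoʳ-≤ 2 (≤-pred J<i₀)) (lg-lower J))
        J≡ : J ≡ i₀ + j₀
        J≡ = sym (m+[n∸m]≡n i₀≤J)
        2^i₀≤ : 2 ^ i₀ ≤ J + J
        2^i₀≤ = ≤-trans (*-monoʳ-≤ 2 (lg-lower J)) (≤-reflexive (cong (J +_) (+-identityʳ J)))
        4^i₀≤ : 4^ i₀ ≤ (J + J) * (J + J)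
        4^i₀≤ = ≤-trans (≤-reflexive (^-distribˡ-+-* 2 i₀ i₀)) (*-mono-≤ 2^i₀≤ 2^i₀≤)
        L≤4J : L ≤ 4 * J
        L≤4J = ≤-trans (+-monoˡ-≤ J (+-monoˡ-≤ J (*-monoʳ-≤ 2 1≤J))) (≤-reflexive (lem J))
          where lem : ∀ J → 2 * J + J + J ≡ 4 * J
                lem = solve-∀
        A≤ : L * 2 ^ j₀ ≤ 2 * 2 ^ J
        A≤ = begin
          L * 2 ^ j₀ ≡⟨ cong (_* 2 ^ j₀) (lem J) ⟩
          2 * suc J * 2 ^ j₀ ≤⟨ *-monoˡ-≤ (2 ^ j₀) (*-monoʳ-≤ 2 (lg-upper J)) ⟩
          2 * 2 ^ i₀ * 2 ^ j₀ ≡⟨ *-assoc 2 (2 ^ i₀) (2 ^ j₀) ⟩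
          2 * (2 ^ i₀ * 2 ^ j₀) ≡⟨ cong (2 *_) (trans (sym (^-distribˡ-+-* 2 i₀ j₀)) (cong (2 ^_) (sym J≡))) ⟩
          2 * 2 ^ J ∎
          where lem : ∀ J → 2 + J + J ≡ 2 * suc J
                lem = solve-∀

  *-cancel-square-≤ : ∀ x y → x * x ≤ y * y → x ≤ y
  *-cancel-square-≤ x y h = ≮⇒≥ λ y<x → <⇒≱ (*-mono-< y<x y<x) h

  upper-bound : ∃[ N ] ∀ n → N ≤ n → ∀ a b .{{_ : NonZero b}} → 55 * b ≤ a → LePow2 a b n (numSidon n)
  upper-bound =
    let (N , count) = upper-count
    in N , λ n N≤n a b 55b≤a → go n (count n N≤n) a b 55b≤a
    where
    go : ∀ n → ∃[ J ] 2 ^ (J + J) ≤ n × numSidon n ≤ 2 ^ (55 * 2 ^ J) → ∀ a b .{{_ : NonZero b}} → 55 * b ≤ a → LePow2 a b n (numSidon n)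
    go n (J , 4^J≤n , X≤) a b 55b≤a k m 1≤m h = begin
      numSidon n ^ m ≤⟨ ^-monoˡ-≤ m X≤ ⟩
      (2 ^ (55 * 2 ^ J)) ^ m ≡⟨ ^-*-assoc 2 (55 * 2 ^ J) m ⟩
      2 ^ (55 * 2 ^ J * m) ≤⟨ ^-monoʳ-≤ 2 (*-cancelʳ-≤ (55 * 2 ^ J * m) k b (*-cancel-square-≤ _ (k * b) squares)) ⟩
      2 ^ k ∎
      where
      open ≤-Reasoning
      t = 2 ^ J
      squares : (55 * t * m * b) * (55 * t * m * b) ≤ (k * b) * (k * b)
      squares = begin
        (55 * t * m * b) * (55 * t * m * b) ≡⟨ lem₁ t m b 55 ⟩
        (55 * b) * (55 * b) * (m * m) * (t * t) ≤⟨ *-mono-≤ (*-monoˡ-≤ (m * m) (*-mono-≤ 55b≤a 55b≤a)) (≤-trans (≤-reflexive (sym (^-distribˡ-+-* 2 J J))) 4^J≤n) ⟩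
        a * a * (m * m) * n ≤⟨ h ⟩
        k * k * (b * b) ≡⟨ lem₂ k b ⟩
        (k * b) * (k * b) ∎
        where
        lem₁ : ∀ t m b c → (c * t * m * b) * (c * t * m * b) ≡ (c * b) * (c * b) * (m * m) * (t * t)
        lem₁ = solve-∀
        lem₂ : ∀ k b → k * k * (b * b) ≡ (k * b) * (k * b)
        lem₂ = solve-∀

-- The lower bound: numerical optimisation over n / (p (p - 1))

module LowerBounds where

  open PrimePowerSums
  open FactorialSums using (≤-/)
  open NoiseCheck using (≤ᵇ-sound)
  open RuzsaSets using (sidon-mod)
  open ModularLifts using (lower-count)
  open CertificateData using (prime-between)
  open UpperBound using (*-cancel-square-≤)

  pow-cancel-≤ : ∀ x y k .{{_ : NonZero k}} → x ^ k ≤ y ^ k → x ≤ y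
  pow-cancel-≤ x y k h = ≮⇒≥ λ y<x → <⇒≱ (^-monoˡ-< k y<x) h

  *-square-mono : ∀ {x y} → x ≤ y → x * x ≤ y * y
  *-square-mono h = *-mono-≤ h h

  -- α/D and γ/D are rational lower bounds for log₂ u and log₂ (v/u); the D-th power of the count
  -- clears both denominators.
  exponent-bound : ∀ D α γ u v N h X .{{_ : NonZero u}} → 2 ^ α ≤ u ^ D → 2 ^ γ * u ^ D ≤ v ^ D → u ^ N * v ^ h ≤ X * u ^ h → 2 ^ (α * N + γ * h) ≤ X ^ D
  exponent-bound D α γ u v N h X 2^α≤ 2^γ≤ le = *-cancelʳ-≤ _ _ ((u ^ D) ^ h) {{m^n≢0 (u ^ D) h {{m^n≢0 u D}}}} (begin
    2 ^ (α * N + γ * h) * (u ^ D) ^ h ≡⟨ cong (_* (u ^ D) ^ h) (trans (^-distribˡ-+-* 2 (α * N) (γ * h)) (cong₂ _*_ (sym (^-*-assoc 2 α N)) (sym (^-*-assoc 2 γ h)))) ⟩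
    (2 ^ α) ^ N * (2 ^ γ) ^ h * (u ^ D) ^ h ≡⟨ trans (*-assoc ((2 ^ α) ^ N) _ _) (cong ((2 ^ α) ^ N *_) (sym (^-distrib-* (2 ^ γ) (u ^ D) h))) ⟩
    (2 ^ α) ^ N * (2 ^ γ * u ^ D) ^ h ≤⟨ *-mono-≤ (^-monoˡ-≤ N 2^α≤) (^-monoˡ-≤ h 2^γ≤) ⟩
    (u ^ D) ^ N * (v ^ D) ^ h ≡⟨ cong₂ _*_ (swap u D N) (swap v D h) ⟩
    (u ^ N) ^ D * (v ^ h) ^ D ≡⟨ ^-distrib-* (u ^ N) (v ^ h) D ⟨
    (u ^ N * v ^ h) ^ D ≤⟨ ^-monoˡ-≤ D le ⟩
    (X * u ^ h) ^ D ≡⟨ trans (^-distrib-* X (u ^ h) D) (cong (X ^ D *_) (swap u h D)) ⟩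
    X ^ D * (u ^ D) ^ h ∎)
    where
    open ≤-Reasoning
    swap : ∀ u a b → (u ^ a) ^ b ≡ (u ^ b) ^ a
    swap u a b = trans (^-*-assoc u a b) (trans (cong (u ^_) (*-comm a b)) (sym (^-*-assoc u b a)))

  -- W/D is a lower bound for log₂ X. As √n is available only through its square, k/m ≤ W/D is
  -- proved by comparing squares, and the D-th powers are cancelled at the end.
  pow2Le-intro : ∀ D W n X a b c₁ c₂ .{{_ : NonZero D}} .{{_ : NonZero b}} .{{_ : NonZero c₂}} →
    2 ^ W ≤ X ^ D → c₂ * a ≤ c₁ * b → (D * c₁) * (D * c₁) * n ≤ (W * c₂) * (W * c₂) → Pow2Le a b n X
  pow2Le-intro D W n X a b c₁ c₂ 2^W≤ ratio sq k m 1≤m h = pow-cancel-≤ (2 ^ k) (X ^ m) D (begin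
    (2 ^ k) ^ D ≡⟨ ^-*-assoc 2 k D ⟩
    2 ^ (k * D) ≤⟨ ^-monoʳ-≤ 2 kD≤Wm ⟩
    2 ^ (W * m) ≡⟨ ^-*-assoc 2 W m ⟨
    (2 ^ W) ^ m ≤⟨ ^-monoˡ-≤ m 2^W≤ ⟩
    (X ^ D) ^ m ≡⟨ trans (^-*-assoc X D m) (trans (cong (X ^_) (*-comm D m)) (sym (^-*-assoc X m D))) ⟩
    (X ^ m) ^ D ∎)
    where
    open ≤-Reasoning
    kD≤Wm : k * D ≤ W * m
    kD≤Wm = *-cancelʳ-≤ _ _ (b * c₂) {{m*n≢0 b c₂}} (*-cancel-square-≤ _ (W * m * (b * c₂)) (begin
      (k * D * (b * c₂)) * (k * D * (b * c₂)) ≡⟨ lem₁ k D b c₂ ⟩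
      k * k * (b * b) * (D * c₂ * (D * c₂)) ≤⟨ *-monoˡ-≤ _ h ⟩
      a * a * (m * m) * n * (D * c₂ * (D * c₂)) ≡⟨ lem₂ a m n D c₂ ⟩
      (c₂ * a) * (c₂ * a) * (m * m * n * (D * D)) ≤⟨ *-monoˡ-≤ _ (*-square-mono ratio) ⟩
      (c₁ * b) * (c₁ * b) * (m * m * n * (D * D)) ≡⟨ lem₃ c₁ b m n D ⟩
      (D * c₁) * (D * c₁) * n * (m * b * (m * b)) ≤⟨ *-monoˡ-≤ _ sq ⟩
      (W * c₂) * (W * c₂) * (m * b * (m * b)) ≡⟨ lem₄ W c₂ m b ⟩
      (W * m * (b * c₂)) * (W * m * (b * c₂)) ∎))
      where
      lem₁ : ∀ k D b c → (k * D * (b * c)) * (k * D * (b * c)) ≡ k * k * (b * b) * (D * c * (D * c))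
      lem₁ = solve-∀
      lem₂ : ∀ a m n D c → a * a * (m * m) * n * (D * c * (D * c)) ≡ (c * a) * (c * a) * (m * m * n * (D * D))
      lem₂ = solve-∀
      lem₃ : ∀ c b m n D → (c * b) * (c * b) * (m * m * n * (D * D)) ≡ (D * c) * (D * c) * n * (m * b * (m * b))
      lem₃ = solve-∀
      lem₄ : ∀ W c m b → (W * c) * (W * c) * (m * b * (m * b)) ≡ (W * m * (b * c)) * (W * m * (b * c))
      lem₄ = solve-∀

  -- W ≥ N (α + γ e/m) with m = N (N + 1); the hypothesis on (α m + γ e)² has room for the factor (N + 1)/N ≤ (t + 1)/t.
  square-bound : ∀ t N D c₁ c₂ α γ e n h .{{_ : NonZero N}} .{{_ : NonZero t}} → let m = suc N * N ; A = α * m + γ * e in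
    t ≤ N → N * e ≤ m * h → suc t * (D * c₁ * (D * c₁)) * (n * m) ≤ t * (c₂ * c₂) * (A * A) →
    (D * c₁) * (D * c₁) * n ≤ ((α * N + γ * h) * c₂) * ((α * N + γ * h) * c₂)
  square-bound t N D c₁ c₂ α γ e n h t≤N Ne≤mh core = *-cancelʳ-≤ _ _ (m * m) {{m*n≢0 m m}} (*-cancelʳ-≤ _ _ t (begin
    (D * c₁) * (D * c₁) * n * (m * m) * t ≡⟨ lem₁ (D * c₁ * (D * c₁)) n N t ⟩
    t * suc N * (N * (D * c₁ * (D * c₁) * (n * m))) ≤⟨ *-monoˡ-≤ _ (≤-trans (≤-reflexive (*-suc t N)) (≤-trans (+-monoˡ-≤ (t * N) t≤N) (≤-reflexive (lem₂ N t)))) ⟩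
    N * suc t * (N * (D * c₁ * (D * c₁) * (n * m))) ≡⟨ lem₃ N t (D * c₁ * (D * c₁)) (n * m) ⟩
    N * N * (suc t * (D * c₁ * (D * c₁)) * (n * m)) ≤⟨ *-monoʳ-≤ (N * N) core ⟩
    N * N * (t * (c₂ * c₂) * (A * A)) ≡⟨ lem₄ N t c₂ A ⟩
    (N * A * c₂) * (N * A * c₂) * t ≤⟨ *-monoˡ-≤ t (*-square-mono (*-monoˡ-≤ c₂ NA≤)) ⟩
    (W * m * c₂) * (W * m * c₂) * t ≡⟨ lem₅ W m c₂ t ⟩
    (W * c₂) * (W * c₂) * (m * m) * t ∎))
    where
    open ≤-Reasoning
    m A W : ℕ
    m = suc N * N
    A = α * m + γ * e
    W = α * N + γ * h
    instance
      m≢0 : NonZero m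
      m≢0 = m*n≢0 (suc N) N
    NA≤ : N * A ≤ W * m
    NA≤ = begin
      N * (α * m + γ * e) ≡⟨ lem N α m γ e ⟩
      α * N * m + γ * (N * e) ≤⟨ +-monoʳ-≤ (α * N * m) (*-monoʳ-≤ γ Ne≤mh) ⟩
      α * N * m + γ * (m * h) ≡⟨ lem′ α N m γ h ⟩
      (α * N + γ * h) * m ∎
      where
      lem : ∀ N a m g e → N * (a * m + g * e) ≡ a * N * m + g * (N * e)
      lem = solve-∀
      lem′ : ∀ a N m g h → a * N * m + g * (m * h) ≡ (a * N + g * h) * m
      lem′ = solve-∀
    lem₁ : ∀ d n N t → d * n * ((suc N * N) * (suc N * N)) * t ≡ t * suc N * (N * (d * (n * (suc N * N))))
    lem₁ = solve-∀
    lem₂ : ∀ N t → N + t * N ≡ N * suc t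
    lem₂ = solve-∀
    lem₃ : ∀ N t d x → N * suc t * (N * (d * x)) ≡ N * N * (suc t * d * x)
    lem₃ = solve-∀
    lem₄ : ∀ N t c A → N * N * (t * (c * c) * (A * A)) ≡ (N * A * c) * (N * A * c) * t
    lem₄ = solve-∀
    lem₅ : ∀ W m c t → (W * m * c) * (W * m * c) * t ≡ (W * c) * (W * c) * (m * m) * t
    lem₅ = solve-∀

  -- Divided by m², the claim is C₂ (k + θ) ≤ C₁ (α + γ θ)² for θ = e/m ≤ y/d. The term in θ² is
  -- dropped. V bounds the excess of the slope C₂ over 2 C₁ α γ, so the loss is at most V y/d, which
  -- the first numerical condition sets aside at θ = 0.
  small-remainder : ∀ k C₁ C₂ α γ y d V m e .{{_ : NonZero d}} → d * e ≤ y * m → k * C₂ * d + V * y ≤ C₁ * (α * α) * d → C₂ ≤ 2 * C₁ * α * γ + V →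
    C₂ * ((e + k * m) * m) ≤ C₁ * ((α * m + γ * e) * (α * m + γ * e))
  small-remainder k C₁ C₂ α γ y d V m e e≤ num₁ num₂ = *-cancelˡ-≤ d (begin
    d * (C₂ * ((e + k * m) * m)) ≡⟨ lem₁ d C₂ e k m ⟩
    k * C₂ * d * (m * m) + C₂ * (d * (e * m)) ≤⟨ +-monoʳ-≤ _ (*-monoˡ-≤ _ num₂) ⟩
    k * C₂ * d * (m * m) + (2 * C₁ * α * γ + V) * (d * (e * m)) ≡⟨ lem₂ (k * C₂ * d) m (2 * C₁ * α * γ) V d e ⟩
    k * C₂ * d * (m * m) + V * (d * e) * m + 2 * C₁ * α * γ * (d * (e * m)) ≤⟨ +-monoˡ-≤ _ (+-monoʳ-≤ (k * C₂ * d * (m * m)) (*-monoˡ-≤ m (*-monoʳ-≤ V e≤))) ⟩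
    k * C₂ * d * (m * m) + V * (y * m) * m + 2 * C₁ * α * γ * (d * (e * m)) ≡⟨ lem₃ (k * C₂ * d) m V y (2 * C₁ * α * γ * (d * (e * m))) ⟩
    (k * C₂ * d + V * y) * (m * m) + 2 * C₁ * α * γ * (d * (e * m)) ≤⟨ +-monoˡ-≤ _ (*-monoˡ-≤ (m * m) num₁) ⟩
    C₁ * (α * α) * d * (m * m) + 2 * C₁ * α * γ * (d * (e * m)) ≤⟨ m≤m+n _ (d * (C₁ * (γ * e * (γ * e)))) ⟩
    C₁ * (α * α) * d * (m * m) + 2 * C₁ * α * γ * (d * (e * m)) + d * (C₁ * (γ * e * (γ * e))) ≡⟨ lem₄ C₁ α d m γ e ⟩
    d * (C₁ * ((α * m + γ * e) * (α * m + γ * e))) ∎)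
    where
    open ≤-Reasoning
    lem₁ : ∀ d C e k m → d * (C * ((e + k * m) * m)) ≡ k * C * d * (m * m) + C * (d * (e * m))
    lem₁ = solve-∀
    lem₂ : ∀ K m Q V d e → K * (m * m) + (Q + V) * (d * (e * m)) ≡ K * (m * m) + V * (d * e) * m + Q * (d * (e * m))
    lem₂ = solve-∀
    lem₃ : ∀ K m V y Q → K * (m * m) + V * (y * m) * m + Q ≡ (K + V * y) * (m * m) + Q
    lem₃ = solve-∀
    lem₄ : ∀ C a d m g e → C * (a * a) * d * (m * m) + 2 * C * a * g * (d * (e * m)) + d * (C * (g * e * (g * e))) ≡ d * (C * ((a * m + g * e) * (a * m + g * e)))
    lem₄ = solve-∀

  -- The same inequality for θ ≥ z/d, expanded at z/d: one numerical condition is its validity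
  -- there, the other says that the right side has at least the slope of the left. The quadratic
  -- term only helps.
  large-remainder : ∀ k C₁ C₂ α γ z d m e .{{_ : NonZero d}} → z * m ≤ d * e → let β = α * d + γ * z in
    C₂ * (d * (k * d + z)) ≤ C₁ * (β * β) → C₂ * d ≤ 2 * C₁ * β * γ →
    C₂ * ((e + k * m) * m) ≤ C₁ * ((α * m + γ * e) * (α * m + γ * e))
  large-remainder k C₁ C₂ α γ z d m e e≥ num₁ num₂ = *-cancelˡ-≤ (d * d) {{m*n≢0 d d}} (begin
    d * d * (C₂ * ((e + k * m) * m)) ≡⟨ lem₁ d C₂ e k m ⟩
    C₂ * (d * (d * e + d * (k * m)) * m) ≡⟨ cong (λ t → C₂ * (d * (t + d * (k * m)) * m)) (sym de≡) ⟩
    C₂ * (d * (z * m + f + d * (k * m)) * m) ≡⟨ lem₂ C₂ d z m f k ⟩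
    C₂ * (d * (k * d + z)) * (m * m) + C₂ * d * (f * m) ≤⟨ +-mono-≤ (*-monoˡ-≤ (m * m) num₁) (*-monoˡ-≤ (f * m) num₂) ⟩
    C₁ * (β * β) * (m * m) + 2 * C₁ * β * γ * (f * m) ≤⟨ m≤m+n _ (C₁ * (γ * f * (γ * f))) ⟩
    C₁ * (β * β) * (m * m) + 2 * C₁ * β * γ * (f * m) + C₁ * (γ * f * (γ * f)) ≡⟨ lem₃ C₁ α d γ z m f ⟩
    C₁ * ((α * d * m + γ * (z * m + f)) * (α * d * m + γ * (z * m + f))) ≡⟨ cong (λ t → C₁ * ((α * d * m + γ * t) * (α * d * m + γ * t))) de≡ ⟩
    C₁ * ((α * d * m + γ * (d * e)) * (α * d * m + γ * (d * e))) ≡⟨ lem₄ C₁ α d m γ e ⟩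
    d * d * (C₁ * ((α * m + γ * e) * (α * m + γ * e))) ∎)
    where
    open ≤-Reasoning
    β f : ℕ
    β = α * d + γ * z
    f = d * e ∸ z * m
    de≡ : z * m + f ≡ d * e
    de≡ = m+[n∸m]≡n e≥
    lem₁ : ∀ d C e k m → d * d * (C * ((e + k * m) * m)) ≡ C * (d * (d * e + d * (k * m)) * m)
    lem₁ = solve-∀
    lem₂ : ∀ C d z m f k → C * (d * (z * m + f + d * (k * m)) * m) ≡ C * (d * (k * d + z)) * (m * m) + C * d * (f * m)
    lem₂ = solve-∀
    lem₃ : ∀ C a d g z m f → C * ((a * d + g * z) * (a * d + g * z)) * (m * m) + 2 * C * (a * d + g * z) * g * (f * m) + C * (g * f * (g * f))
                            ≡ C * ((a * d * m + g * (z * m + f)) * (a * d * m + g * (z * m + f)))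
    lem₃ = solve-∀
    lem₄ : ∀ C a d m g e → C * ((a * d * m + g * (d * e)) * (a * d * m + g * (d * e))) ≡ d * d * (C * ((a * m + g * e) * (a * m + g * e)))
    lem₄ = solve-∀

  scaled-sqrt : ∀ a .{{_ : NonZero a}} n → ∃[ x ] a * (x * x) ≤ n × n < a * (suc x * suc x)
  scaled-sqrt a zero = 0 , ≤-reflexive (*-zeroʳ a) , ≤-trans (>-nonZero⁻¹ a) (≤-reflexive (sym (*-identityʳ a)))
  scaled-sqrt a (suc n) with scaled-sqrt a n
  ... | x , lo , hi with a * (suc x * suc x) ≤? suc n
  ... | no ¬p = x , m≤n⇒m≤1+n lo , ≰⇒> ¬p
  ... | yes p = suc x , p , ≤-<-trans hi (*-monoʳ-< a (*-mono-< (n<1+n (suc x)) (n<1+n (suc x))))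

  -- (q + 2)² exceeds (q + 1) q by 3q + 4 ≤ 4q, and for large q the difference b - a absorbs this.
  near-square : ∀ a b q → 4 ≤ q → a * 4 ≤ (b ∸ a) * suc q → a ≤ b → a * (suc (suc q) * suc (suc q)) ≤ b * (suc q * q)
  near-square a b q 4≤q h a≤b = begin
    a * (suc (suc q) * suc (suc q)) ≡⟨ lem₁ a q ⟩
    a * (suc q * q) + a * (3 * q + 4) ≤⟨ +-monoʳ-≤ _ (*-monoʳ-≤ a (+-monoʳ-≤ (3 * q) 4≤q)) ⟩
    a * (suc q * q) + a * (3 * q + q) ≡⟨ cong (a * (suc q * q) +_) (lem₂ a q) ⟩
    a * (suc q * q) + a * 4 * q ≤⟨ +-monoʳ-≤ _ (*-monoˡ-≤ q h) ⟩
    a * (suc q * q) + (b ∸ a) * suc q * q ≡⟨ cong (a * (suc q * q) +_) (*-assoc (b ∸ a) (suc q) q) ⟩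
    a * (suc q * q) + (b ∸ a) * (suc q * q) ≡⟨ *-distribʳ-+ (suc q * q) a (b ∸ a) ⟨
    (a + (b ∸ a)) * (suc q * q) ≡⟨ cong (_* (suc q * q)) (m+[n∸m]≡n a≤b) ⟩
    b * (suc q * q) ∎
    where
    open ≤-Reasoning
    lem₁ : ∀ a q → a * (suc (suc q) * suc (suc q)) ≡ a * (suc q * q) + a * (3 * q + 4)
    lem₁ = solve-∀
    lem₂ : ∀ a q → a * (3 * q + q) ≡ a * 4 * q
    lem₂ = solve-∀

  -- For suitable prime p the quotient n / (p (p − 1)) lies between 3 + z/d and 4 + y/d.
  module LowerBound (t D c₁ c₂ α₄ γ₄ α₃ γ₃ y z d V : ℕ) {{D≢0 : NonZero D}} {{c₂≢0 : NonZero c₂}} {{t≢0 : NonZero t}} {{d≢0 : NonZero d}}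
    (5≥ : 2 ^ α₄ ≤ 5 ^ D) (6/5≥ : 2 ^ γ₄ * 5 ^ D ≤ 6 ^ D) (4≥ : 2 ^ α₃ ≤ 4 ^ D) (5/4≥ : 2 ^ γ₃ * 4 ^ D ≤ 5 ^ D)
    (four₁ : 4 * (suc t * (D * c₁ * (D * c₁))) * d + V * y ≤ (t * (c₂ * c₂)) * (α₄ * α₄) * d) (four₂ : (suc t * (D * c₁ * (D * c₁))) ≤ 2 * (t * (c₂ * c₂)) * α₄ * γ₄ + V)
    (three₁ : (suc t * (D * c₁ * (D * c₁))) * (d * (3 * d + z)) ≤ (t * (c₂ * c₂)) * ((α₃ * d + γ₃ * z) * (α₃ * d + γ₃ * z))) (three₂ : (suc t * (D * c₁ * (D * c₁))) * d ≤ 2 * (t * (c₂ * c₂)) * (α₃ * d + γ₃ * z) * γ₃)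
    (y<d : y < d) (4≤t : 4 ≤ t) (room : (3 * d + z) * (63 * 63) * 4 ≤ (62 * 62 * (4 * d + y) ∸ (3 * d + z) * (63 * 63)) * t) (room′ : (3 * d + z) * (63 * 63) ≤ 62 * 62 * (4 * d + y)) where
    private
      C₁ C₂ a₀ b₀ : ℕ
      C₁ = t * (c₂ * c₂)
      C₂ = suc t * (D * c₁ * (D * c₁))
      a₀ = 3 * d + z
      b₀ = 4 * d + y

      instance
        a₀≢0 : NonZero a₀
        a₀≢0 = >-nonZero (≤-trans (>-nonZero⁻¹ d) (≤-trans (m≤m+n d (d + (d + 0))) (m≤m+n (3 * d) z)))

    module _ (q n : ℕ) {{q≢0 : NonZero q}} where
      private
        m e : ℕ
        m = suc q * q
        instance
          m≢0 : NonZero m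
          m≢0 = m*n≢0 (suc q) q
        e = n % m

        conclude : ∀ k α γ → n / m ≡ k → 2 ^ α ≤ suc k ^ D → 2 ^ γ * suc k ^ D ≤ suc (suc k) ^ D → t ≤ q → Prime (suc q) →
          C₂ * ((e + k * m) * m) ≤ C₁ * ((α * m + γ * e) * (α * m + γ * e)) →
          ∀ a b .{{_ : NonZero b}} → c₂ * a ≤ c₁ * b → Pow2Le a b n (numSidon n)
        conclude k α γ n/m≡k α≤ γ≤ t≤q pp core a b ratio =
          let (s , sidon) = sidon-mod q pp
              (h , Ne≤mh , count) = lower-count m q n s sidon
          in pow2Le-intro D (α * q + γ * h) n (numSidon n) a b c₁ c₂
               (exponent-bound D α γ (suc k) (suc (suc k)) q h (numSidon n) α≤ γ≤
                 (subst (λ k → suc k ^ q * suc (suc k) ^ h ≤ numSidon n * suc k ^ h) n/m≡k count))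
               ratio (square-bound t q D c₁ c₂ α γ e n h t≤q Ne≤mh
                 (subst (λ t → C₂ * (t * m) ≤ C₁ * ((α * m + γ * e) * (α * m + γ * e)))
                   (trans (cong (λ k → e + k * m) (sym n/m≡k)) (sym (m≡m%n+[m/n]*n n m))) core))

      in-range : t ≤ q → Prime (suc q) → a₀ * m ≤ d * n → d * n ≤ b₀ * m → ∀ a b .{{_ : NonZero b}} → c₂ * a ≤ c₁ * b → Pow2Le a b n (numSidon n)
      in-range t≤q pp lo hi a b ratio = cases (n / m) refl (≤-/ 3 m n 3m≤n) (m<n*o⇒m/o<n {n} {5} {m} n<5m)
        where
        open ≤-Reasoning
        dn≡ : ∀ k → n / m ≡ k → d * n ≡ d * e + k * d * m
        dn≡ k eq = trans (cong (d *_) (trans (m≡m%n+[m/n]*n n m) (cong (λ k → e + k * m) eq))) (lem d e k m)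
          where lem : ∀ d e k m → d * (e + k * m) ≡ d * e + k * d * m
                lem = solve-∀
        3m≤n : 3 * m ≤ n
        3m≤n = *-cancelˡ-≤ d (begin
          d * (3 * m) ≤⟨ m≤m+n _ (z * m) ⟩
          d * (3 * m) + z * m ≡⟨ lem d m z ⟩
          a₀ * m ≤⟨ lo ⟩
          d * n ∎)
          where lem : ∀ d m z → d * (3 * m) + z * m ≡ (3 * d + z) * m
                lem = solve-∀
        n<5m : n < 5 * m
        n<5m = *-cancelˡ-< d _ _ (begin-strict
          d * n ≤⟨ hi ⟩
          b₀ * m <⟨ *-monoˡ-< m (+-monoʳ-< (4 * d) y<d) ⟩
          (4 * d + d) * m ≡⟨ lem d m ⟩
          d * (5 * m) ∎)
          where lem : ∀ d m → (4 * d + d) * m ≡ d * (5 * m)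
                lem = solve-∀
        cases : ∀ k → n / m ≡ k → 3 ≤ k → k < 5 → Pow2Le a b n (numSidon n)
        cases 0 _ () _
        cases 1 _ (s≤s ()) _
        cases 2 _ (s≤s (s≤s ())) _
        cases 3 eq _ _ = conclude 3 α₃ γ₃ eq 4≥ 5/4≥ t≤q pp (large-remainder 3 C₁ C₂ α₃ γ₃ z d m e
          (+-cancelʳ-≤ (3 * d * m) _ _ (begin
            z * m + 3 * d * m ≡⟨ trans (+-comm (z * m) _) (sym (*-distribʳ-+ m (3 * d) z)) ⟩
            a₀ * m ≤⟨ lo ⟩
            d * n ≡⟨ dn≡ 3 eq ⟩
            d * e + 3 * d * m ∎)) three₁ three₂) a b ratio
        cases 4 eq _ _ = conclude 4 α₄ γ₄ eq 5≥ 6/5≥ t≤q pp (small-remainder 4 C₁ C₂ α₄ γ₄ y d V m e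
          (+-cancelʳ-≤ (4 * d * m) _ _ (begin
            d * e + 4 * d * m ≡⟨ dn≡ 4 eq ⟨
            d * n ≤⟨ hi ⟩
            b₀ * m ≡⟨ trans (*-distribʳ-+ m (4 * d) y) (+-comm _ (y * m)) ⟩
            y * m + 4 * d * m ∎)) four₁ four₂) a b ratio
        cases (suc (suc (suc (suc (suc _))))) _ _ (s≤s (s≤s (s≤s (s≤s (s≤s ())))))

    lower-bound : ∃[ N ] ∀ n → N ≤ n → ∀ a b .{{_ : NonZero b}} → c₂ * a ≤ c₁ * b → Pow2Le a b n (numSidon n)
    lower-bound = from-primes prime-between
      where
      from-primes : (∃[ N ] ∀ x → N ≤ x → ∃[ p ] Prime p × 62 * x / 63 < p × p ≤ x) →
        ∃[ N ] ∀ n → N ≤ n → ∀ a b .{{_ : NonZero b}} → c₂ * a ≤ c₁ * b → Pow2Le a b n (numSidon n)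
      from-primes (N , primes) = a₀ * (B * B) , λ n N≤n →
        -- With x = ⌊√(d n/a₀)⌋, every prime p ≤ x satisfies a₀ p (p - 1) ≤ d n; p > 62x/63 keeps n
        -- / (p (p - 1)) below a₀/d times (63/62)², up to a factor tending to 1 that `room` absorbs
        -- into b₀/d.
        let (x , lo , hi) = scaled-sqrt a₀ (d * n)
            B≤x = B≤ n x N≤n hi
            (p , pp , <p , p≤x) = primes x (≤-trans (m≤m+n N (2 * suc t)) B≤x)
        in at-prime n x lo hi (≤-trans (m≤n+m (2 * suc t) N) B≤x) p pp <p p≤x
        where
        open ≤-Reasoning
        B : ℕ
        B = N + 2 * suc t
        B≤ : ∀ n x → a₀ * (B * B) ≤ n → d * n < a₀ * (suc x * suc x) → B ≤ x
        B≤ n x N≤n hi = ≮⇒≥ λ x<B → <⇒≱ hi (begin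
          a₀ * (suc x * suc x) ≤⟨ *-monoʳ-≤ a₀ (*-square-mono x<B) ⟩
          a₀ * (B * B) ≤⟨ N≤n ⟩
          n ≤⟨ m≤n*m n d ⟩
          d * n ∎)
        at-prime : ∀ n x → a₀ * (x * x) ≤ d * n → d * n < a₀ * (suc x * suc x) → 2 * suc t ≤ x → ∀ p → Prime p → 62 * x / 63 < p → p ≤ x →
          ∀ a b .{{_ : NonZero b}} → c₂ * a ≤ c₁ * b → Pow2Le a b n (numSidon n)
        at-prime n x lo hi t≤x zero pp _ _ = ⊥-elim (¬prime[0] pp)
        at-prime n x lo hi t≤x (suc zero) pp _ _ = ⊥-elim (¬prime[1] pp)
        at-prime n x lo hi t≤x (suc q@(suc _)) pp <p p≤x = in-range q n t≤q pp
          (≤-trans (*-monoʳ-≤ a₀ (*-mono-≤ p≤x (≤-trans (n≤1+n q) p≤x))) lo)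
          (*-cancelˡ-≤ (62 * 62) (begin
            62 * 62 * (d * n) ≤⟨ *-monoʳ-≤ (62 * 62) (<⇒≤ hi) ⟩
            62 * 62 * (a₀ * (suc x * suc x)) ≡⟨ lem₁ a₀ (suc x) 62 ⟩
            a₀ * ((62 * suc x) * (62 * suc x)) ≤⟨ *-monoʳ-≤ a₀ (*-square-mono 62x≤) ⟩
            a₀ * ((63 * suc (suc q)) * (63 * suc (suc q))) ≡⟨ lem₂ a₀ (suc (suc q)) 63 ⟩
            a₀ * (63 * 63) * (suc (suc q) * suc (suc q))
              ≤⟨ near-square (a₀ * (63 * 63)) (62 * 62 * b₀) q (≤-trans 4≤t t≤q) (≤-trans room (*-monoʳ-≤ (62 * 62 * b₀ ∸ a₀ * (63 * 63)) (≤-trans t≤q (n≤1+n q)))) room′ ⟩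
            62 * 62 * b₀ * (suc q * q) ≡⟨ *-assoc (62 * 62) b₀ _ ⟩
            62 * 62 * (b₀ * (suc q * q)) ∎))
          where
          lem₁ : ∀ a s c → c * c * (a * (s * s)) ≡ a * ((c * s) * (c * s))
          lem₁ = solve-∀
          lem₂ : ∀ a s c → a * ((c * s) * (c * s)) ≡ a * (c * c) * (s * s)
          lem₂ = solve-∀
          62x< : 62 * x < 63 * suc q
          62x< = begin-strict
            62 * x ≡⟨ m≡m%n+[m/n]*n (62 * x) 63 ⟩
            62 * x % 63 + 62 * x / 63 * 63 <⟨ +-monoˡ-< _ (m%n<n (62 * x) 63) ⟩
            suc (62 * x / 63) * 63 ≤⟨ *-monoˡ-≤ 63 <p ⟩
            suc q * 63 ≡⟨ *-comm (suc q) 63 ⟩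
            63 * suc q ∎
          62x≤ : 62 * suc x ≤ 63 * suc (suc q)
          62x≤ = begin
            62 * suc x ≡⟨ *-suc 62 x ⟩
            62 + 62 * x ≤⟨ +-mono-≤ (n≤1+n 62) (<⇒≤ 62x<) ⟩
            63 + 63 * suc q ≡⟨ *-suc 63 (suc q) ⟨
            63 * suc (suc q) ∎
          t≤q : t ≤ q
          t≤q = ≤-pred (*-cancelˡ-≤ 63 (begin
            63 * suc t ≤⟨ *-monoˡ-≤ (suc t) (m≤m+n 63 61) ⟩
            124 * suc t ≡⟨ *-assoc 62 2 (suc t) ⟩
            62 * (2 * suc t) ≤⟨ *-monoʳ-≤ 62 t≤x ⟩
            62 * x ≤⟨ <⇒≤ 62x< ⟩
            63 * suc q ∎))

-- Numerical values and the two bounds combined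

open PrimePowerSums
open NoiseCheck using (≤ᵇ-sound)
open UpperBound using (upper-bound)
open LowerBounds

-- log₂ 5 ≥ 1695/730, log₂ (6/5) ≥ 192/730 and log₂ (5/4) ≥ 235/730.
sidon-lower : ∃[ N ] ∀ n → N ≤ n → ∀ a b .{{_ : NonZero b}} → 100 * a ≤ 116 * b → Pow2Le a b n (numSidon n)
sidon-lower = LowerBound.lower-bound 100000 730 116 100 1695 192 1460 235 71 942 1000 66197410702400
  (≤ᵇ-sound refl) (≤ᵇ-sound refl) (≤ᵇ-sound refl) (≤ᵇ-sound refl) (≤ᵇ-sound refl) (≤ᵇ-sound refl) (≤ᵇ-sound refl) (≤ᵇ-sound refl)
  (≤ᵇ-sound refl) (≤ᵇ-sound refl) (≤ᵇ-sound refl) (≤ᵇ-sound refl)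

-- The two fractions are 1.16 - 1/(j + 1) and 55 + 1/(j + 1), so quantifying over j before N
-- expresses o(1). The subtraction never truncates, as 116 (j + 1) ≥ 100.
theorem1p10 : ∀ (j : ℕ) → ∃[ N ] ∀ (n : ℕ) → N ≤ n →
    Pow2Le (116 * suc j ∸ 100) (100 * suc j) n (numSidon n)
    × LePow2 (55 * suc j + 1) (suc j) n (numSidon n)
theorem1p10 j = proj₁ sidon-lower + proj₁ upper-bound , λ n N≤n →
  proj₂ sidon-lower n (≤-trans (m≤m+n _ _) N≤n) (116 * suc j ∸ 100) (100 * suc j) {{m*n≢0 100 (suc j)}}
    (≤-trans (*-monoʳ-≤ 100 (m∸n≤m (116 * suc j) 100)) (≤-reflexive (*-swap 100 116 (suc j)))) ,
  proj₂ upper-bound n (≤-trans (m≤n+m _ (proj₁ sidon-lower)) N≤n) (55 * suc j + 1) (suc j) (m≤m+n (55 * suc j) 1)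
  where
  *-swap : ∀ a b c → a * (b * c) ≡ b * (a * c)
  *-swap = solve-∀
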